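{- A lopsp-operation $O$ can be written as an lsp-operation if and only if $O$ has an orientation-reversing automorphism that fixes $v_0$, $v_1$ and $v_2$.
   Context: A map is a connected multigraph (loops and parallel edges allowed) 2-cell embedded in a closed orientable surface; combinatorially it is given by its set $E'$ of directed edges (two per edge, also for loops), the involution $\theta$ sending a directed edge to its reverse, and a permutation $\sigma$ of $E'$ preserving start vertices that induces the cyclic order of directed edges around each vertex. Plane means embedded in the sphere. An orientation-reversing automorphism of a map is a bijection $\phi:E'\to E'$ with $\theta\circ\phi=\phi\circ\theta$ and $\sigma^{ -1}\circ\phi=\phi\circ\sigma$; it fixes a vertex if it maps the directed edges starting at that vertex to directed edges starting at that vertex. A lopsp-operation is a plane map $O$ with a colouring $c:V_O\to\{0,1,2\}$ and three marked vertices $v_0,v_1,v_2$ such that: (1) every face of $O$ is a triangle; (2) no edge joins two vertices of the same colour; (3) $c(v_0)\neq1$, $c(v_2)\neq1$, if $c(v_1)=1$ then $\deg(v_1)=2$, and every vertex $v\notin\{v_0,v_1,v_2\}$ with $c(v)=1$ has degree 4. An lsp-operation is a 2-connected plane map $L$ with a colouring $c:V_L\to\{0,1,2\}$, one face designated as the outer face, and three vertices $v_0,v_1,v_2$ on the outer face, such that: every face other than the outer face is a triangle; no edge joins two vertices of the same colour; every vertex $v$ not on the outer face with $c(v)=1$ has degree 4; every vertex $v$ on the outer face other than $v_0,v_1,v_2$ with $c(v)=1$ has degree 3; $c(v_0),c(v_2)\neq1$; and if $c(v_1)=1$ then $\deg(v_1)=2$. The lopsp-operation corresponding to an lsp-operation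 $L$ is obtained by gluing a mirror-image copy of $L$ into the outer face of $L$, identifying the boundaries of the two outer faces (and the corresponding copies of $v_0,v_1,v_2$). A lopsp-operation can be written as an lsp-operation if it is (isomorphic, as a coloured map with marked vertices, to) the lopsp-operation corresponding to some lsp-operation; equivalently, if there is a cycle in $O$ containing $v_0,v_1,v_2$ such that one side of the cycle is the mirror image of the other side. -}

module Defs where

open import Data.Nat using (ℕ; zero; suc; _+_; _*_; _≤ᵇ_; _≥_)
open import Data.Bool using (Bool; true; false; not; _∨_; _∧_; if_then_else_; T)
open import Data.Fin using (Fin; toℕ; _≟_)
  renaming (zero to fzero; suc to fsuc)
open import Data.Fin.Permutation using (Permutation′; _⟨$⟩ʳ_; _⟨$⟩ˡ_)
open import Data.List using (List; length; allFin; filterᵇ)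
open import Data.Bool.ListAction using (any; all)
open import Data.Product using (Σ; ∃; _×_; _,_)
open import Relation.Nullary using (¬_)
open import Data.Unit using (⊤)
open import Relation.Nullary.Decidable using (⌊_⌋)
open import Relation.Binary.PropositionalEquality using (_≡_; _≢_)

iter : {A : Set} → (A → A) → ℕ → A → A
iter f zero    x = x
iter f (suc k) x = f (iter f k x)

module _ {n : ℕ} where

  -- y lies in the orbit of x under a permutation f of Fin n
  -- (for a permutation the orbit of x is {f^k x | k < n}).
  inOrbit : (Fin n → Fin n) → Fin n → Fin n → Bool
  inOrbit f x y = any (λ k → ⌊ iter f (toℕ k) x ≟ y ⌋) (allFin n)

  orbitSize : (Fin n → Fin n) → Fin n → ℕ
  orbitSize f x = length (filterᵇ (inOrbit f x) (allFin n))

  isOrbitRep : (Fin n → Fin n) → Fin n → Bool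
  isOrbitRep f x = all (λ y → not (inOrbit f x y) ∨ (toℕ x ≤ᵇ toℕ y)) (allFin n)

  numOrbits : (Fin n → Fin n) → ℕ
  numOrbits f = length (filterᵇ (isOrbitRep f) (allFin n))

-- Maps (combinatorial): directed edges Fin n, θ (reversal), σ (rotation)

one : Fin 3
one = fsuc fzero

record Map : Set where
  field
    n     : ℕ                    -- number of directed edges |E'|
    θ     : Permutation′ n
    σ     : Permutation′ n
    θ-inv : ∀ e → θ ⟨$⟩ʳ (θ ⟨$⟩ʳ e) ≡ e
    θ-fpf : ∀ e → θ ⟨$⟩ʳ e ≢ e   -- two directed edges per edge, also for loops

  th : Fin n → Fin n
  th e = θ ⟨$⟩ʳ e

  sg : Fin n → Fin n
  sg e = σ ⟨$⟩ʳ e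

  sg⁻¹ : Fin n → Fin n
  sg⁻¹ e = σ ⟨$⟩ˡ e

  -- face permutation: directed edge e ↦ next directed edge of its face
  fc : Fin n → Fin n
  fc e = sg (th e)

  SameVertex : Fin n → Fin n → Set
  SameVertex e e' = ∃ λ k → iter sg k e ≡ e'

  deg : Fin n → ℕ
  deg e = orbitSize sg e

  numVertices numEdges×2 numFaces : ℕ
  numVertices = numOrbits sg
  numEdges×2  = n
  numFaces    = numOrbits fc

data Reach (M : Map) : Fin (Map.n M) → Fin (Map.n M) → Set where
  here : ∀ {e} → Reach M e e
  rot  : ∀ {e e'} → Reach M e e' → Reach M e (Map.sg M e')
  rev  : ∀ {e e'} → Reach M e e' → Reach M e (Map.th M e')

Connected : Map → Set
Connected M = ∀ e e' → Reach M e e'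

-- Plane: connected and Euler characteristic V - E + F = 2
-- (written as 2V + 2F = 2E + 4, where 2E = |E'| = n).
Plane : Map → Set
Plane M = Connected M × (2 * numVertices + 2 * numFaces ≡ numEdges×2 + 4)
  where open Map M

data ReachAvoid (M : Map) (w : Fin (Map.n M)) : Fin (Map.n M) → Fin (Map.n M) → Set where
  here : ∀ {e} → ReachAvoid M w e e
  rot  : ∀ {e e'} → ReachAvoid M w e e' → ReachAvoid M w e (Map.sg M e')
  rev  : ∀ {e e'} → ReachAvoid M w e e' → ¬ Map.SameVertex M w (Map.th M e') →
         ReachAvoid M w e (Map.th M e')

TwoConnected : Map → Set
TwoConnected M =
  (numVertices ≥ 3) × Connected M ×
  (∀ w e e' → ¬ SameVertex w e → ¬ SameVertex w e' → ReachAvoid M w e e')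
  where open Map M

record OrRevAut (M : Map) : Set where
  open Map M
  field
    φ     : Permutation′ n
    θ-com : ∀ e → th (φ ⟨$⟩ʳ e) ≡ φ ⟨$⟩ʳ (th e)
    σ-rev : ∀ e → sg⁻¹ (φ ⟨$⟩ʳ e) ≡ φ ⟨$⟩ʳ (sg e)

FixesVertex : (M : Map) → OrRevAut M → Fin (Map.n M) → Set
FixesVertex M A v = ∀ e → SameVertex v e → SameVertex v (φ ⟨$⟩ʳ e)
  where open Map M ; open OrRevAut A

-- lopsp-operations.  A vertex is given by a directed edge starting at it.

record Lopsp : Set where
  field
    map    : Map
  open Map map public
  field
    plane  : Plane map
    c      : Fin n → Fin 3
    c-vert : ∀ e → c (sg e) ≡ c e
    v₀ v₁ v₂ : Fin n
    triangles : ∀ e → orbitSize fc e ≡ 3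
    proper    : ∀ e → c e ≢ c (th e)
    c-v₀ : c v₀ ≢ one
    c-v₂ : c v₂ ≢ one
    c-v₁ : c v₁ ≡ one → deg v₁ ≡ 2
    deg-one : ∀ e → ¬ SameVertex v₀ e → ¬ SameVertex v₁ e → ¬ SameVertex v₂ e →
              c e ≡ one → deg e ≡ 4

record Lsp : Set where
  field
    map    : Map
  open Map map public
  field
    plane  : Plane map
    twoConnected : TwoConnected map
    outer  : Fin n
  InOuterB : Fin n → Bool
  InOuterB e = inOrbit fc outer e
  OnOuter : Fin n → Set
  OnOuter e = ∃ λ e' → SameVertex e e' × T (InOuterB e')
  field
    c      : Fin n → Fin 3
    c-vert : ∀ e → c (sg e) ≡ c e
    v₀ v₁ v₂ : Fin n
    v₀-out : OnOuter v₀
    v₁-out : OnOuter v₁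
    v₂-out : OnOuter v₂
    triangles : ∀ e → ¬ T (InOuterB e) → orbitSize fc e ≡ 3
    proper    : ∀ e → c e ≢ c (th e)
    deg-inner : ∀ e → ¬ OnOuter e → c e ≡ one → deg e ≡ 4
    deg-outer : ∀ e → OnOuter e → ¬ SameVertex v₀ e → ¬ SameVertex v₁ e →
                ¬ SameVertex v₂ e → c e ≡ one → deg e ≡ 3
    c-v₀ : c v₀ ≢ one
    c-v₂ : c v₂ ≢ one
    c-v₁ : c v₁ ≡ one → deg v₁ ≡ 2

-- The lopsp-operation corresponding to an lsp-operation L:
-- a mirror copy of L glued into the outer face of L.
-- Directed edges of the glued map are pairs (e , s): s = false is the copy
-- in L, s = true the mirror copy; directed edges of boundary edges of the
-- outer face are shared, so (e , true) is only used for e not on a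
-- boundary edge.

module Glue (L : Lsp) where
  open Lsp L

  OnBoundaryB : Fin n → Bool
  OnBoundaryB e = InOuterB e ∨ InOuterB (th e)

  GDart : Set
  GDart = Fin n × Bool

  Valid : GDart → Set
  Valid (e , false) = ⊤
  Valid (e , true)  = ¬ T (OnBoundaryB e)

  gθ : GDart → GDart
  gθ (e , s) = th e , s

  -- rotation: in L use σ; when reaching the outer angle, continue in the
  -- mirror copy, where the rotation is σ⁻¹, and return to L at the end.
  back : Fin n → GDart
  back e = sg⁻¹ e , not (OnBoundaryB (sg⁻¹ e))

  gσ : GDart → GDart
  gσ (e , false) = if InOuterB (sg e) then back e else (sg e , false)
  gσ (e , true)  = back e

  gc : GDart → Fin 3
  gc (e , _) = c e

  GSameVertex : GDart → GDart → Set
  GSameVertex p q = ∃ λ k → iter gσ k p ≡ q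

record IsoToGlued (O : Lopsp) (L : Lsp) : Set where
  module O = Lopsp O
  module L = Lsp L
  open Glue L
  field
    ψ      : Fin O.n → GDart
    valid  : ∀ d → Valid (ψ d)
    inj    : ∀ d d' → ψ d ≡ ψ d' → d ≡ d'
    surj   : ∀ p → Valid p → ∃ λ d → ψ d ≡ p
    θ-com  : ∀ d → ψ (O.th d) ≡ gθ (ψ d)
    σ-com  : ∀ d → ψ (O.sg d) ≡ gσ (ψ d)
    c-com  : ∀ d → gc (ψ d) ≡ O.c d
    v₀-com : GSameVertex (ψ O.v₀) (L.v₀ , false)
    v₁-com : GSameVertex (ψ O.v₁) (L.v₁ , false)
    v₂-com : GSameVertex (ψ O.v₂) (L.v₂ , false)

CanBeWrittenAsLsp : Lopsp → Set
CanBeWrittenAsLsp O = ∃ λ (L : Lsp) → IsoToGlued O L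

HasFixingOrRevAut : Lopsp → Set
HasFixingOrRevAut O = Σ (OrRevAut map) λ A →
  FixesVertex map A v₀ × FixesVertex map A v₁ × FixesVertex map A v₂
  where open Lopsp O

{-# OPTIONS --safe #-}
module Submission where

-- Working over F₂, a connected map has Euler characteristic 2 if and only if every even set of edges is the boundary of a
-- set of faces. Let φ be an orientation-reversing automorphism of O fixing v₀, v₁, v₂. It either preserves the colours or
-- exchanges two of them; in the latter case O is a bipyramid, and φ composed with a rotation preserves the colours. Then φ
-- fixes none or exactly two of the darts at each vertex, so the fixed edges form an even set and bound a set S of faces.
-- Comparing S with its image shows that φ exchanges S and its complement, and the same comparison for a single cycle of
-- fixed edges shows that there is only one. The half S, with the fixed cycle as boundary of the outer face, inherits the
-- criterion above from O, hence is plane, and gluing it to its image gives O back. Conversely, exchanging the two copies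
-- in a glued map is an automorphism of the required kind.

open import Defs
open import Algebra using (CommutativeMonoid; CommutativeRing)
open import Algebra.Properties.CommutativeSemigroup using (interchange)
open import Data.Bool using (Bool; T; _xor_; _∧_; _∨_; false; if_then_else_; not; true)
open import Data.Bool.Properties using (T?; not-injective; not-involutive; xor-assoc; xor-comm; xor-identityʳ;
  xor-same; xor-∧-commutativeRing; ¬-not; ∧-comm; ∧-distribˡ-xor; ∧-identityʳ; ∧-zeroʳ; ∨-comm; ∨-zeroʳ)
  renaming (_≟_ to _≟ᵇ_)
open import Data.Empty using (⊥; ⊥-elim)
open import Data.Fin using (Fin; _↑ʳ_; _↑ˡ_; _≟_; combine; finToFun; fromℕ<; funToFin; join; punchOut; splitAt; suc;
  toℕ; zero)
open import Data.Fin.Patterns using (0F; 1F; 2F)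
open import Data.Fin.Permutation using (Permutation′; _⟨$⟩ʳ_; _⟨$⟩ˡ_; inverseʳ; inverseˡ; permutation)
open import Data.Fin.Properties using (2↔Bool; all?; any?; cantor-schröder-bernstein; finToFun-funToFin;
  funToFin-finToFin; injective⇒≤; join-splitAt; pigeonhole; punchOut-injective; splitAt-join; splitAt-↑ʳ; splitAt-↑ˡ;
  suc-injective; toℕ-fromℕ<; toℕ-injective; toℕ<n)
open import Data.List using (List; _∷_; allFin; filterᵇ; length; lookup)
open import Data.List.Membership.Propositional using (_∈_; lose)
open import Data.List.Membership.Propositional.Properties using (∈-allFin; ∈-filter⁺; ∈-filter⁻; ∈-lookup)
open import Data.List.Relation.Unary.All as All using (All)
open import Data.List.Relation.Unary.All.Properties using (all⁺; all⁻)
open import Data.List.Relation.Unary.AllPairs using (_∷_)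
open import Data.List.Relation.Unary.Any using (index; satisfied)
open import Data.List.Relation.Unary.Any.Properties using (any⁺; any⁻; lookup-index)
open import Data.List.Relation.Unary.Unique.Propositional using (Unique)
open import Data.List.Relation.Unary.Unique.Propositional.Properties using (allFin⁺)
  renaming (filter⁺ to unique-filter⁺)
open import Data.Nat using (>-nonZero; NonZero; _*_; _+_; _<_; _<ᵇ_; _^_; _∸_; _≤_; _≤ᵇ_; suc; s≤s; zero; z≤n; ℕ;
  ⌊_/2⌋)
open import Data.Nat.DivMod using (_%_; _/_; m%n<n; m≡m%n+[m/n]*n)
open import Data.Nat.Properties using (*-cancelˡ-≡; +-assoc; +-cancelˡ-<; +-comm; +-mono-<; +-suc; <-cmp; <-trans;
  <-≤-trans; <ᵇ⇒<; <⇒<ᵇ; <⇒≤; <⇒≱; ^-monoʳ-<; m+[n∸m]≡n; m<m+n; m<n⇒0<n∸m; m∸n+n≡m; m∸n≤m; m≤m+n; n<1+n; n≡⌊n+n/2⌋;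
  ≤-<-trans; ≤-antisym; ≤-refl; ≤ᵇ⇒≤; ≤⇒≤ᵇ; ≮⇒≥)
  renaming (_≟_ to _≟ℕ_)
open import Data.Nat.Solver using (module +-*-Solver)
open import Data.Product using (_,_; _×_; proj₁; proj₂; ∃)
open import Data.Sum using ([_,_]′; _⊎_; inj₁; inj₂)
open import Data.Sum.Properties using (inj₁-injective; inj₂-injective)
open import Data.Unit using (tt)
open import Function using (Inverse; _∘_)
open import Function.Bundles using (_⇔_; mk⇔)
open import Relation.Binary using (tri<; tri>; tri≈)
open import Relation.Binary.PropositionalEquality
open import Relation.Nullary using (Dec; contradiction; no; yes; ¬_)
open import Relation.Nullary.Decidable using (_×-dec_; _→-dec_; dec-false; dec-true; does; from-yes; fromWitness;
  map′; toWitness; ¬?; ⌊_⌋)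

import Algebra.Properties.Semiring.Sum (CommutativeRing.semiring xor-∧-commutativeRing) as Sum

-- Orbits of permutations

-- Planarity has to pass from `O` to a half whose vertices, edges and faces are awkward to count.
-- The criterion over F₂ avoids the count: an even edge set of the half, extended by zero, is even
-- in `O`, and a face set that it bounds there restricts to the half. The colours decide whether a
-- reflection has darts on its axis. Around a vertex the far ends of the darts alternate between two
-- colours, so degrees are even. A colour-preserving reflection that fixes the vertex shifts a dart
-- by an even number of steps, and the dart halfway is fixed. A reflection that exchanges two
-- colours fixes no dart at all, so it yields no cycle and has to be replaced. The replacement works
-- because the fixed vertex `v₀` does not have colour 1: colour 1 is then one of the two exchanged
-- colours, no marked vertex has it, and its degree condition is carried over to the other exchanged
-- colour.

least : (P : ℕ → Set) → (∀ k → Dec (P k)) → ∀ k → P k →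
        ∃ λ m → m ≤ k × P m × (∀ i → i < m → ¬ P i)
least P P? k p with P? zero
... | yes p₀ = 0 , z≤n , p₀ , λ _ ()
least P P? zero p | no ¬p₀ = contradiction p ¬p₀
least P P? (suc k) p | no ¬p₀ with least (P ∘ suc) (P? ∘ suc) k p
... | m , m≤k , pm , min = suc m , s≤s m≤k , pm ,
      λ { zero _ → ¬p₀ ; (suc i) (s≤s i<m) → min i i<m }

Orb : {A : Set} → (A → A) → A → A → Set
Orb f x y = ∃ λ k → iter f k x ≡ y

record Period {A : Set} (f : A → A) (x : A) (p : ℕ) : Set where
  constructor mkPeriod
  field
    positive : 0 < p
    returns  : iter f p x ≡ x
    minimal  : ∀ i → 0 < i → i < p → iter f i x ≢ x

module _ {A : Set} (f : A → A) where

  iter-+ : ∀ a b x → iter f (a + b) x ≡ iter f a (iter f b x)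
  iter-+ zero    b x = refl
  iter-+ (suc a) b x = cong f (iter-+ a b x)

  iter-suc : ∀ k x → iter f (suc k) x ≡ iter f k (f x)
  iter-suc zero    x = refl
  iter-suc (suc k) x = cong f (iter-suc k x)

  iter-* : ∀ {p x} k → iter f p x ≡ x → iter f (k * p) x ≡ x
  iter-* zero    e = refl
  iter-* {p} {x} (suc k) e = trans (iter-+ p (k * p) x) (trans (cong (iter f p) (iter-* k e)) e)

  Orb-refl : ∀ {x} → Orb f x x
  Orb-refl = 0 , refl

  Orb-step : ∀ {x} → Orb f x (f x)
  Orb-step = 1 , refl

  Orb-trans : ∀ {x y z} → Orb f x y → Orb f y z → Orb f x z
  Orb-trans {x} (a , p) (b , q) = b + a , trans (iter-+ b a x) (trans (cong (iter f b) p) q)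

  Orb-closed : (P : A → Set) → (∀ x → P x → P (f x)) → ∀ {x y} → Orb f x y → P x → P y
  Orb-closed P step (zero  , refl) px = px
  Orb-closed P step (suc k , refl) px = step _ (Orb-closed P step (k , refl) px)

  Orb-invariant : {B : Set} (g : A → B) → (∀ x → g (f x) ≡ g x) → ∀ {x y} → Orb f x y → g y ≡ g x
  Orb-invariant g h {x} o = Orb-closed (λ y → g y ≡ g x) (λ y e → trans (h y) e) o refl

module Enum {n} (Q : Fin n → Bool) where

  elems : List (Fin n)
  elems = filterᵇ Q (allFin n)

  size : ℕ
  size = length elems

  abstract

    at : Fin size → Fin n
    at = lookup elems

    at-∈ : ∀ i → T (Q (at i))
    at-∈ i = proj₂ (∈-filter⁻ (T? ∘ Q) {xs = allFin n} (∈-lookup {xs = elems} i))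

    private
      lookup-injective : ∀ {xs : List (Fin n)} → Unique xs → ∀ i j → lookup xs i ≡ lookup xs j → i ≡ j
      lookup-injective (_ ∷ _) Fin.zero    Fin.zero    _ = refl
      lookup-injective (px ∷ _) Fin.zero    (Fin.suc j) e = contradiction e (All.lookup px (∈-lookup j))
      lookup-injective (px ∷ _) (Fin.suc i) Fin.zero    e = contradiction (sym e) (All.lookup px (∈-lookup i))
      lookup-injective (_ ∷ u) (Fin.suc i) (Fin.suc j) e = cong Fin.suc (lookup-injective u i j e)

    at-injective : ∀ {i j} → at i ≡ at j → i ≡ j
    at-injective {i} {j} = lookup-injective (unique-filter⁺ (T? ∘ Q) (allFin⁺ n)) i j

    private
      mem : ∀ x → T (Q x) → x ∈ elems
      mem x q = ∈-filter⁺ (T? ∘ Q) (∈-allFin x) q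

    pos : ∀ x → T (Q x) → Fin size
    pos x q = index (mem x q)

    at-pos : ∀ x (q : T (Q x)) → at (pos x q) ≡ x
    at-pos x q = sym (lookup-index (mem x q))

    pos-injective : ∀ {x y} (p : T (Q x)) (q : T (Q y)) → pos x p ≡ pos y q → x ≡ y
    pos-injective p q e = trans (sym (at-pos _ p)) (trans (cong at e) (at-pos _ q))

private
  not-∨-elim : ∀ a {b} → T (not a ∨ b) → T a → T b
  not-∨-elim true t _ = t

  not-∨-intro : ∀ a {b} → (T a → T b) → T (not a ∨ b)
  not-∨-intro true  f = f tt
  not-∨-intro false _ = tt

module Orbit {n} (f : Fin n → Fin n) (f-inj : ∀ {x y} → f x ≡ f y → x ≡ y) where

  iter-injective : ∀ k {x y} → iter f k x ≡ iter f k y → x ≡ y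
  iter-injective zero    e = e
  iter-injective (suc k) e = iter-injective k (f-inj e)

  cancel-< : ∀ {i j x} → i < j → iter f i x ≡ iter f j x → iter f (j ∸ i) x ≡ x
  cancel-< {i} {j} {x} i<j e = iter-injective i (begin
    iter f i (iter f (j ∸ i) x)  ≡⟨ iter-+ f i (j ∸ i) x ⟨
    iter f (i + (j ∸ i)) x       ≡⟨ cong (λ k → iter f k x) (trans (+-comm i (j ∸ i)) (m∸n+n≡m (<⇒≤ i<j))) ⟩
    iter f j x                   ≡⟨ e ⟨
    iter f i x                   ∎)
    where open ≡-Reasoning

  period : ∀ x → ∃ λ p → Period f x p
  period x with pigeonhole (n<1+n n) (λ i → iter f (toℕ i) x)
  ... | i , j , i<j , e with toℕ j ∸ toℕ i | m<n⇒0<n∸m i<j | cancel-< i<j e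
  ... | suc d | _ | r with least (λ k → iter f (suc k) x ≡ x) (λ k → iter f (suc k) x ≟ x) d r
  ... | m , _ , rm , min = suc m , mkPeriod (s≤s z≤n) rm λ { (suc i) _ (s≤s i<m) → min i i<m }

  module _ {x p} (per : Period f x p) where
    open Period per

    iter-unique : ∀ {i j} → i < p → j < p → iter f i x ≡ iter f j x → i ≡ j
    iter-unique {i} {j} i<p j<p e with <-cmp i j
    ... | tri≈ _ i≡j _ = i≡j
    ... | tri< i<j _ _ = contradiction (cancel-< i<j e)
            (minimal (j ∸ i) (m<n⇒0<n∸m i<j) (≤-<-trans (m∸n≤m j i) j<p))
    ... | tri> _ _ j<i = contradiction (cancel-< j<i (sym e))
            (minimal (i ∸ j) (m<n⇒0<n∸m j<i) (≤-<-trans (m∸n≤m i j) i<p))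

    reduce : ∀ {y} → Orb f x y → ∃ λ i → i < p × iter f i x ≡ y
    reduce {y} (k , e) = k % p , m%n<n k p , (begin
      iter f (k % p) x                        ≡⟨ cong (iter f (k % p)) (iter-* f (k / p) returns) ⟨
      iter f (k % p) (iter f (k / p * p) x)   ≡⟨ iter-+ f (k % p) (k / p * p) x ⟨
      iter f (k % p + k / p * p) x            ≡⟨ cong (λ m → iter f m x) (m≡m%n+[m/n]*n k p) ⟨
      iter f k x                              ≡⟨ e ⟩
      y                                       ∎)
      where
        open ≡-Reasoning
        instance
          p≢0 : NonZero p
          p≢0 = >-nonZero positive

    period≤n : p ≤ n
    period≤n = injective⇒≤ {f = λ (i : Fin p) → iter f (toℕ i) x}
      (λ {i} {j} e → toℕ-injective (iter-unique (toℕ<n i) (toℕ<n j) e))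

  Orb-sym : ∀ {x y} → Orb f x y → Orb f y x
  Orb-sym {x} {y} o with period x
  ... | p , per with reduce per o
  ... | i , i<p , refl = p ∸ i , trans (sym (iter-+ f (p ∸ i) i x))
        (trans (cong (λ k → iter f k x) (m∸n+n≡m (<⇒≤ i<p))) (Period.returns per))

  Period-Orb : ∀ {x y p} → Orb f x y → Period f x p → Period f y p
  Period-Orb {x} {p = p} (k , refl) (mkPeriod positive returns minimal) =
    mkPeriod positive (trans (iter-comm p k) (cong (iter f k) returns))
      λ i 0<i i<p e → minimal i 0<i i<p (iter-injective k (trans (sym (iter-comm i k)) e))
    where
    iter-comm : ∀ i k → iter f i (iter f k x) ≡ iter f k (iter f i x)
    iter-comm i k = trans (sym (iter-+ f i k x)) (trans (cong (λ j → iter f j x) (+-comm i k)) (iter-+ f k i x))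

  inOrbit-sound : ∀ {x y} → T (inOrbit f x y) → Orb f x y
  inOrbit-sound {x} {y} t with satisfied (any⁻ (λ k → ⌊ iter f (toℕ k) x ≟ y ⌋) (allFin n) t)
  ... | k , w = toℕ k , toWitness w

  inOrbit-complete : ∀ {x y} → Orb f x y → T (inOrbit f x y)
  inOrbit-complete {x} {y} o with period x
  ... | p , per with reduce per o
  ... | i , i<p , e = any⁺ _ (lose (∈-allFin (fromℕ< i<n))
        (fromWitness (subst (λ k → iter f k x ≡ y) (sym (toℕ-fromℕ< i<n)) e)))
    where
      i<n : i < n
      i<n = <-≤-trans i<p (period≤n per)

  Orb? : ∀ x y → Dec (Orb f x y)
  Orb? x y = map′ inOrbit-sound inOrbit-complete (T? (inOrbit f x y))

  -- Two injections between finite types: every orbit element is an iterate with exponent below the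
  -- period, and these iterates are distinct.
  orbitSize-period : ∀ {x p} → Period f x p → orbitSize f x ≡ p
  orbitSize-period {x} {p} per = cantor-schröder-bernstein
    {f = λ i → fromℕ< (proj₁ (proj₂ (red i)))} {g = λ i → pos (iter f (toℕ i) x) (mem i)}
    (λ {i} {j} e → at-injective (trans (sym (proj₂ (proj₂ (red i))))
       (trans (cong (λ k → iter f k x) (trans (sym (toℕ-fromℕ< (proj₁ (proj₂ (red i)))))
         (trans (cong toℕ e) (toℕ-fromℕ< (proj₁ (proj₂ (red j))))))) (proj₂ (proj₂ (red j))))))
    (λ {i} {j} e → toℕ-injective (iter-unique per (toℕ<n i) (toℕ<n j) (pos-injective (mem i) (mem j) e)))
    where
      open Enum (inOrbit f x)
      red : ∀ i → ∃ λ k → k < p × iter f k x ≡ at i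
      red i = reduce per (inOrbit-sound (at-∈ i))
      mem : ∀ (i : Fin p) → T (inOrbit f x (iter f (toℕ i) x))
      mem i = inOrbit-complete (toℕ i , refl)

  period-orbitSize : ∀ x → Period f x (orbitSize f x)
  period-orbitSize x with period x
  ... | p , per = subst (Period f x) (sym (orbitSize-period per)) per

  orbitSize≡⇒Period : ∀ {x p} → orbitSize f x ≡ p → Period f x p
  orbitSize≡⇒Period {x} e = subst (Period f x) e (period-orbitSize x)

  -- The representatives counted by numOrbits are the least elements of the orbits.
  private
    module R = Enum (isOrbitRep f)

    isOrbitRep-sound : ∀ {r y} → T (isOrbitRep f r) → Orb f r y → toℕ r ≤ toℕ y
    isOrbitRep-sound {r} {y} t o = ≤ᵇ⇒≤ _ _ (not-∨-elim (inOrbit f r y)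
      (All.lookup (all⁺ (λ y → not (inOrbit f r y) ∨ (toℕ r ≤ᵇ toℕ y)) (allFin n) t) (∈-allFin y))
      (inOrbit-complete o))

    isOrbitRep-complete : ∀ {r} → (∀ y → Orb f r y → toℕ r ≤ toℕ y) → T (isOrbitRep f r)
    isOrbitRep-complete {r} min = all⁻ (λ y → not (inOrbit f r y) ∨ (toℕ r ≤ᵇ toℕ y)) {xs = allFin n}
      (All.tabulate λ {y} _ → not-∨-intro (inOrbit f r y) (λ t → ≤⇒≤ᵇ (min y (inOrbit-sound t))))

    least-rep : ∀ x → ∃ λ r → T (isOrbitRep f r) × Orb f x r
    least-rep x = conclude (least Met (λ k → any? (λ y → Orb? x y ×-dec toℕ y ≟ℕ k)) (toℕ x) (x , Orb-refl f , refl))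
      where
      Met : ℕ → Set
      Met k = ∃ λ y → Orb f x y × toℕ y ≡ k
      conclude : (∃ λ m → m ≤ toℕ x × Met m × (∀ i → i < m → ¬ Met i)) → ∃ λ r → T (isOrbitRep f r) × Orb f x r
      conclude (k , _ , (r , o , e) , min) = r , isOrbitRep-complete
        (λ y r~y → ≮⇒≥ (λ y<r → min (toℕ y) (subst (toℕ y <_) e y<r) (y , Orb-trans f o r~y , refl))) , o

  abstract

    cls : Fin n → Fin (numOrbits f)
    cls x = R.pos _ (proj₁ (proj₂ (least-rep x)))

    rep : Fin (numOrbits f) → Fin n
    rep = R.at

    rep-cls : ∀ x → Orb f x (rep (cls x))
    rep-cls x = subst (Orb f x) (sym (R.at-pos _ (proj₁ (proj₂ (least-rep x))))) (proj₂ (proj₂ (least-rep x)))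

    cls-≡ : ∀ {x y} → cls x ≡ cls y → Orb f x y
    cls-≡ {x} {y} e = Orb-trans f (subst (λ i → Orb f x (rep i)) e (rep-cls x)) (Orb-sym (rep-cls y))

    rep-injective : ∀ {i j} → Orb f (rep i) (rep j) → i ≡ j
    rep-injective {i} {j} o = R.at-injective (toℕ-injective (≤-antisym
      (isOrbitRep-sound (R.at-∈ i) o) (isOrbitRep-sound (R.at-∈ j) (Orb-sym o))))

    cls-cong : ∀ {x y} → Orb f x y → cls x ≡ cls y
    cls-cong {x} {y} o = rep-injective (Orb-trans f (Orb-sym (rep-cls x)) (Orb-trans f o (rep-cls y)))

    cls-rep : ∀ i → cls (rep i) ≡ i
    cls-rep i = rep-injective (Orb-sym (rep-cls (rep i)))

-- Sums modulo 2

T⇒≡ : ∀ {b} → T b → b ≡ true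
T⇒≡ {true} _ = refl

≡⇒T : ∀ {b} → b ≡ true → T b
≡⇒T refl = tt

T-iff : ∀ {a b} → (T a → T b) → (T b → T a) → a ≡ b
T-iff {true}  {true}  _ _ = refl
T-iff {false} {false} _ _ = refl
T-iff {true}  {false} f _ = contradiction (f tt) λ ()
T-iff {false} {true}  _ g = contradiction (g tt) λ ()

abstract

  sum : ∀ {n} → (Fin n → Bool) → Bool
  sum = Sum.sum

  sum-cong : ∀ {n} {g h : Fin n → Bool} → (∀ i → g i ≡ h i) → sum g ≡ sum h
  sum-cong = Sum.sum-cong-≗

  sum-zero : ∀ {n} {h : Fin n → Bool} → (∀ i → h i ≡ false) → sum h ≡ false
  sum-zero {n} z = trans (sum-cong z) (Sum.sum-replicate-zero n)

  sum-xor : ∀ {n} (g h : Fin n → Bool) → sum (λ i → g i xor h i) ≡ sum g xor sum h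
  sum-xor = Sum.∑-distrib-+

  sum-comm : ∀ {m n} (h : Fin m → Fin n → Bool) →
             sum (λ i → sum (λ j → h i j)) ≡ sum (λ j → sum (λ i → h i j))
  sum-comm = Sum.∑-comm

  sum-permute : ∀ {n} (h : Fin n → Bool) (π : Permutation′ n) → sum h ≡ sum (λ i → h (π ⟨$⟩ʳ i))
  sum-permute = Sum.sum-permute

  ∧-distribˡ-sum : ∀ {n} b (h : Fin n → Bool) → b ∧ sum h ≡ sum (λ i → b ∧ h i)
  ∧-distribˡ-sum = Sum.*-distribˡ-sum

  sum-single : ∀ {n} (h : Fin n → Bool) j → (∀ i → i ≢ j → h i ≡ false) → sum h ≡ h j
  sum-single h zero    z = trans (cong (h zero xor_) (sum-zero (λ i → z (suc i) λ ()))) (xor-identityʳ _)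
  sum-single h (suc j) z = trans (cong (_xor sum (h ∘ suc)) (z zero λ ()))
    (sum-single (h ∘ suc) j (λ i i≢j → z (suc i) (i≢j ∘ suc-injective)))

xor-cancel : ∀ {a b} → a xor b ≡ false → a ≡ b
xor-cancel {false} {false} _ = refl
xor-cancel {true}  {true}  _ = refl

-- The terms at `i` and `π i` cancel. `up` selects the smaller element of each pair and `down` the
-- larger one; fixed points also fall under `down`, where `h` vanishes.
sum-involution : ∀ {n} (π : Fin n → Fin n) (h : Fin n → Bool) → (∀ i → π (π i) ≡ i) →
                 (∀ i → h (π i) ≡ h i) → (∀ i → π i ≡ i → h i ≡ false) → sum h ≡ false
sum-involution {n} π h inv hπ fix = begin
  sum h                                   ≡⟨ sum-cong split ⟩
  sum (λ i → up i xor down i)             ≡⟨ sum-xor up down ⟩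
  sum up xor sum down                     ≡⟨ cong (sum up xor_) (sum-permute down (permutation π π inv inv)) ⟩
  sum up xor sum (λ i → down (π i))       ≡⟨ cong (sum up xor_) (sum-cong flip) ⟩
  sum up xor sum up                       ≡⟨ xor-same (sum up) ⟩
  false                                   ∎
  where
  open ≡-Reasoning
  o : Fin n → Bool
  o i = toℕ i <ᵇ toℕ (π i)
  up down : Fin n → Bool
  up i   = o i ∧ h i
  down i = not (o i) ∧ h i
  split : ∀ i → h i ≡ up i xor down i
  split i with o i
  ... | true  = sym (xor-identityʳ (h i))
  ... | false = refl
  o-flip : ∀ i → π i ≢ i → not (o (π i)) ≡ o i
  o-flip i π≢ rewrite inv i with <-cmp (toℕ i) (toℕ (π i))
  ... | tri≈ _ e _ = contradiction (sym (toℕ-injective e)) π≢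
  ... | tri< l _ ¬g rewrite T⇒≡ (<⇒<ᵇ l) = cong not (¬-not (λ e → ¬g (<ᵇ⇒< _ _ (≡⇒T e))))
  ... | tri> ¬l _ g rewrite T⇒≡ (<⇒<ᵇ g) = sym (¬-not (λ e → ¬l (<ᵇ⇒< _ _ (≡⇒T e))))
  flip : ∀ i → down (π i) ≡ up i
  flip i with h i in eq
  ... | false rewrite hπ i | eq = trans (∧-zeroʳ _) (sym (∧-zeroʳ _))
  ... | true  rewrite hπ i | eq = cong (_∧ true) (o-flip i λ e → contradiction (trans (sym eq) (fix i e)) λ ())

-- Insert the indicator of `emb i ≡ d` and exchange the two sums: by injectivity one `i` remains for
-- each `d` in the image, and `h` vanishes elsewhere.
sum-embed : ∀ {m n} (emb : Fin m → Fin n) → (∀ {i j} → emb i ≡ emb j → i ≡ j) →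
            (h : Fin n → Bool) → (∀ d → ¬ (∃ λ i → emb i ≡ d) → h d ≡ false) →
            sum h ≡ sum (λ i → h (emb i))
sum-embed emb inj h z = trans (sum-cong outer) (trans (sum-comm _) (sum-cong inner))
  where
  outer : ∀ d → h d ≡ sum (λ i → does (emb i ≟ d) ∧ h d)
  outer d with any? (λ i → emb i ≟ d)
  ... | no ∄i = trans (z d ∄i) (sym (sum-zero (λ i → trans (cong (_ ∧_) (z d ∄i)) (∧-zeroʳ _))))
  ... | yes (i , refl) = sym (trans
          (sum-single _ i (λ j j≢i → cong (_∧ h (emb i)) (dec-false (emb j ≟ emb i) (j≢i ∘ inj))))
          (cong (_∧ h (emb i)) (dec-true (emb i ≟ emb i) refl)))
  inner : ∀ i → sum (λ d → does (emb i ≟ d) ∧ h d) ≡ h (emb i)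
  inner i = trans (sum-single _ (emb i) (λ d d≢ → cong (_∧ h d) (dec-false (emb i ≟ d) (d≢ ∘ sym))))
                  (cong (_∧ h (emb i)) (dec-true (emb i ≟ emb i) refl))

perm-injective : ∀ {n} (π : Permutation′ n) {x y} → π ⟨$⟩ʳ x ≡ π ⟨$⟩ʳ y → x ≡ y
perm-injective π e = trans (sym (inverseˡ π)) (trans (cong (π ⟨$⟩ˡ_) e) (inverseˡ π))

module OrbitSum {n} (π : Permutation′ n) where

  f : Fin n → Fin n
  f = π ⟨$⟩ʳ_

  open Orbit f (perm-injective π) public

  orbitSum : (Fin n → Bool) → Fin n → Bool
  orbitSum X e = sum (λ d → inOrbit f e d ∧ X d)

  inOrbit-cong : ∀ {e e' d d'} → (Orb f e d → Orb f e' d') → (Orb f e' d' → Orb f e d) →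
                 inOrbit f e d ≡ inOrbit f e' d'
  inOrbit-cong to from = T-iff (inOrbit-complete ∘ to ∘ inOrbit-sound) (inOrbit-complete ∘ from ∘ inOrbit-sound)

  inOrbit-true : ∀ {e d} → Orb f e d → inOrbit f e d ≡ true
  inOrbit-true o = T⇒≡ (inOrbit-complete o)

  inOrbit-false : ∀ {e d} → ¬ Orb f e d → inOrbit f e d ≡ false
  inOrbit-false ¬o = ¬-not (λ e → ¬o (inOrbit-sound (≡⇒T e)))

  orbitSum-cong : ∀ {X Y} e → (∀ d → Orb f e d → X d ≡ Y d) → orbitSum X e ≡ orbitSum Y e
  orbitSum-cong {X} {Y} e h = sum-cong go
    where
    go : ∀ d → inOrbit f e d ∧ X d ≡ inOrbit f e d ∧ Y d
    go d with inOrbit f e d | inOrbit-sound {e} {d}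
    ... | true  | o = h d (o tt)
    ... | false | _ = refl

  orbitSum-zero : ∀ {X} e → (∀ d → Orb f e d → X d ≡ false) → orbitSum X e ≡ false
  orbitSum-zero {X} e h = trans (orbitSum-cong {X} {λ _ → false} e h) (sum-zero (λ d → ∧-zeroʳ _))

  orbitSum-xor : ∀ X Y e → orbitSum (λ d → X d xor Y d) e ≡ orbitSum X e xor orbitSum Y e
  orbitSum-xor X Y e = trans (sum-cong (λ d → ∧-distribˡ-xor (inOrbit f e d) (X d) (Y d))) (sum-xor _ _)

  orbitSum-orbit : ∀ X {e e'} → Orb f e e' → orbitSum X e ≡ orbitSum X e'
  orbitSum-orbit X {e} {e'} o = sum-cong λ d → cong (_∧ X d)
    (inOrbit-cong (Orb-trans f (Orb-sym o)) (Orb-trans f o))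

  orbitSum-shift : ∀ X e → orbitSum (X ∘ f) e ≡ orbitSum X e
  orbitSum-shift X e = sym (trans (sum-permute (λ d → inOrbit f e d ∧ X d) π)
    (sum-cong λ d → cong (_∧ X (f d)) (inOrbit-cong
      (λ o → Orb-trans f o (Orb-sym (Orb-step f))) (λ o → Orb-trans f o (Orb-step f)))))

  orbitSum-coboundary : ∀ g e → orbitSum (λ d → g d xor g (f d)) e ≡ false
  orbitSum-coboundary g e = trans (orbitSum-xor g (g ∘ f) e)
    (trans (cong (orbitSum g e xor_) (orbitSum-shift g e)) (xor-same (orbitSum g e)))

  orbitSum-involution : ∀ (τ : Fin n → Fin n) X e → (∀ d → τ (τ d) ≡ d) → (∀ d → Orb f d (τ d)) →
                        (∀ d → X (τ d) ≡ X d) → (∀ d → Orb f e d → τ d ≡ d → X d ≡ false) → orbitSum X e ≡ false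
  orbitSum-involution τ X e inv orb Xτ fix = sum-involution τ _ inv
    (λ d → cong₂ _∧_ (inOrbit-cong (λ o → Orb-trans f o (Orb-sym (orb d))) (λ o → Orb-trans f o (orb d))) (Xτ d))
    (λ d e≡ → fixed d e≡)
    where
    fixed : ∀ d → τ d ≡ d → inOrbit f e d ∧ X d ≡ false
    fixed d e≡ with inOrbit f e d | inOrbit-sound {e} {d}
    ... | true  | o = fix d (o tt) e≡
    ... | false | _ = refl

  orbitSum-sum : ∀ {m} (t : Fin m → Bool) (P : Fin m → Fin n → Bool) e →
                 orbitSum (λ d → sum (λ v → t v ∧ P v d)) e ≡ sum (λ v → t v ∧ orbitSum (P v) e)
  orbitSum-sum t P e = begin
    sum (λ d → inOrbit f e d ∧ sum (λ v → t v ∧ P v d))    ≡⟨ sum-cong (λ d → ∧-distribˡ-sum (inOrbit f e d)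
        (λ v → t v ∧ P v d)) ⟩
    sum (λ d → sum (λ v → inOrbit f e d ∧ (t v ∧ P v d)))  ≡⟨ sum-comm _ ⟩
    sum (λ v → sum (λ d → inOrbit f e d ∧ (t v ∧ P v d)))  ≡⟨ sum-cong (λ v → sum-cong (λ d → swap (inOrbit f e d)
        (t v) (P v d))) ⟩
    sum (λ v → sum (λ d → t v ∧ (inOrbit f e d ∧ P v d)))  ≡⟨ sum-cong (λ v → ∧-distribˡ-sum (t v)
        (λ d → inOrbit f e d ∧ P v d)) ⟨
    sum (λ v → t v ∧ orbitSum (P v) e)                     ∎
    where
    open ≡-Reasoning
    swap : ∀ a b c → a ∧ (b ∧ c) ≡ b ∧ (a ∧ c)
    swap false b c = sym (∧-zeroʳ b)
    swap true  b c = refl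

-- Maps and the Jordan property

injective⇒surjective : ∀ {m} (h : Fin m → Fin m) → (∀ {i j} → h i ≡ h j → i ≡ j) → ∀ y → ∃ λ x → h x ≡ y
injective⇒surjective {suc m} h inj y with any? (λ x → h x ≟ y)
... | yes x = x
... | no ∄x = contradiction (injective⇒≤ {f = λ x → punchOut (y≢h x)} (inj ∘ punchOut-injective (y≢h _) (y≢h _)))
    (<⇒≱ (n<1+n m))
  where
  y≢h : ∀ x → y ≢ h x
  y≢h x e = ∄x (x , sym e)

private
  funToFin-cong : ∀ {m n} {f g : Fin m → Fin n} → f ≗ g → funToFin f ≡ funToFin g
  funToFin-cong {zero}  e = refl
  funToFin-cong {suc m} e = cong₂ combine (e zero) (funToFin-cong (e ∘ suc))

  encode : ∀ {a} → (Fin a → Bool) → Fin (2 ^ a)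
  encode g = funToFin (Inverse.from 2↔Bool ∘ g)

  decode : ∀ {a} → Fin (2 ^ a) → Fin a → Bool
  decode i x = Inverse.to 2↔Bool (finToFun i x)

  decode-encode : ∀ {a} (g : Fin a → Bool) → decode (encode g) ≗ g
  decode-encode g x = trans (cong (Inverse.to 2↔Bool) (finToFun-funToFin _ x)) (Inverse.strictlyInverseˡ 2↔Bool (g x))

  encode-decode : ∀ {a} (i : Fin (2 ^ a)) → encode {a} (decode i) ≡ i
  encode-decode {a} i = trans (funToFin-cong {a} (λ x → Inverse.strictlyInverseʳ 2↔Bool (finToFun i x)))
      (funToFin-finToFin {a} i)

  encode-cong : ∀ {a} {g h : Fin a → Bool} → g ≗ h → encode g ≡ encode h
  encode-cong e = funToFin-cong (λ x → cong (Inverse.from 2↔Bool) (e x))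

BoolInjective : ∀ {a b} → ((Fin a → Bool) → (Fin b → Bool)) → Set
BoolInjective Φ = ∀ g h → Φ g ≗ Φ h → g ≗ h

private
  coded : ∀ {a b} → ((Fin a → Bool) → (Fin b → Bool)) → Fin (2 ^ a) → Fin (2 ^ b)
  coded Φ i = encode (Φ (decode i))

  coded-injective : ∀ {a b} (Φ : (Fin a → Bool) → (Fin b → Bool)) → BoolInjective Φ →
                    ∀ {i j} → coded Φ i ≡ coded Φ j → i ≡ j
  coded-injective {a} Φ inj {i} {j} e = trans (sym (encode-decode {a} i))
    (trans (encode-cong (inj _ _ λ x → trans (sym (decode-encode (Φ (decode i)) x))
      (trans (cong (λ k → decode k x) e) (decode-encode (Φ (decode j)) x)))) (encode-decode {a} j))

-- Cardinality takes the place of dimension: an injection between sets of subsets gives 2 ^ a ≤ 2 ^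
-- b, hence `a ≤ b`.
boolInjective⇒≤ : ∀ {a b} (Φ : (Fin a → Bool) → (Fin b → Bool)) → BoolInjective Φ → a ≤ b
boolInjective⇒≤ {a} {b} Φ inj =
  ≮⇒≥ λ b<a → <⇒≱ (^-monoʳ-< 2 ≤-refl b<a) (injective⇒≤ (coded-injective Φ inj))

boolInjective⇒surjective : ∀ {a b} (Φ : (Fin a → Bool) → (Fin b → Bool)) → BoolInjective Φ → a ≡ b →
                           ∀ y → ∃ λ g → Φ g ≗ y
boolInjective⇒surjective Φ inj refl y with injective⇒surjective (coded Φ) (coded-injective Φ inj) (encode y)
... | i , e = decode i , λ x → trans (sym (decode-encode _ x)) (trans (cong (λ k → decode k x) e) (decode-encode y x))

module MapProps (M : Map) where
  open Map M public

  module V = OrbitSum σ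

  th-injective : ∀ {x y} → th x ≡ th y → x ≡ y
  th-injective e = trans (sym (θ-inv _)) (trans (cong th e) (θ-inv _))

  sg-injective : ∀ {x y} → sg x ≡ sg y → x ≡ y
  sg-injective = perm-injective σ

  fc-injective : ∀ {x y} → fc x ≡ fc y → x ≡ y
  fc-injective = th-injective ∘ sg-injective

  module F = Orbit fc fc-injective
  module E = Orbit th th-injective

  fc-th : ∀ d → fc (th d) ≡ sg d
  fc-th d = cong sg (θ-inv d)

  Reach-closed : (P : Fin n → Set) → (∀ d → P d → P (sg d)) → (∀ d → P d → P (th d)) →
                 ∀ {e e'} → Reach M e e' → P e → P e'
  Reach-closed P s t here    p = p
  Reach-closed P s t (rot r) p = s _ (Reach-closed P s t r p)
  Reach-closed P s t (rev r) p = t _ (Reach-closed P s t r p)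

  -- Since `sg d` is `fc (th d)`, such a `g` is invariant under both generators of `Reach`. On a
  -- connected map it is constant.
  faceReach-invariant : {B : Set} (g : Fin n → B) → (∀ d → g (fc d) ≡ g d) → (∀ d → g (th d) ≡ g d) →
                        ∀ {e e'} → Reach M e e' → g e' ≡ g e
  faceReach-invariant g hf ht {e} r = Reach-closed (λ d → g d ≡ g e)
    (λ d p → trans (cong g (sym (fc-th d))) (trans (hf (th d)) (trans (ht d) p)))
    (λ d p → trans (ht d) p) r refl

  Orb-th : ∀ {x y} → Orb th x y → y ≡ x ⊎ y ≡ th x
  Orb-th {x} o = Orb-closed th (λ y → y ≡ x ⊎ y ≡ th x)
    (λ { y (inj₁ e) → inj₂ (cong th e) ; y (inj₂ e) → inj₁ (trans (cong th e) (θ-inv x)) }) o (inj₁ refl)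

  numE : ℕ
  numE = numOrbits th

  edge-rep : ∀ d → d ≡ E.rep (E.cls d) ⊎ d ≡ th (E.rep (E.cls d))
  edge-rep d = Orb-th (E.Orb-sym (E.rep-cls d))

  -- A dart is the representative of its edge or the reverse of it. The two kinds never meet because
  -- `th` has no fixed point.
  darts-edges : numE + numE ≡ n
  darts-edges = cantor-schröder-bernstein {f = dart ∘ splitAt numE} {g = join numE numE ∘ half}
    (λ {i} {j} e → trans (sym (join-splitAt numE numE i)) (trans (cong (join numE numE)
      (dart-injective (splitAt numE i) (splitAt numE j) e)) (join-splitAt numE numE j)))
    (λ {i} {j} e → half-injective i j (edge-rep i) (edge-rep j) (trans (sym (splitAt-join numE numE (half i)))
      (trans (cong (splitAt numE) e) (splitAt-join numE numE (half j)))))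
    where
    dart : Fin numE ⊎ Fin numE → Fin n
    dart = [ E.rep , th ∘ E.rep ]′
    crossed : ∀ {i j} → E.rep i ≢ th (E.rep j)
    crossed {i} {j} e = θ-fpf (E.rep j) (trans (sym e) (cong E.rep (E.rep-injective (1 , trans (cong th e) (θ-inv _)))))
    dart-injective : ∀ x y → dart x ≡ dart y → x ≡ y
    dart-injective (inj₁ i) (inj₁ j) e = cong inj₁ (E.rep-injective (0 , e))
    dart-injective (inj₂ i) (inj₂ j) e = cong inj₂ (E.rep-injective (0 , th-injective e))
    dart-injective (inj₁ i) (inj₂ j) e = contradiction e crossed
    dart-injective (inj₂ i) (inj₁ j) e = contradiction (sym e) crossed
    side : ∀ d → d ≡ E.rep (E.cls d) ⊎ d ≡ th (E.rep (E.cls d)) → Fin numE ⊎ Fin numE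
    side d (inj₁ _) = inj₁ (E.cls d)
    side d (inj₂ _) = inj₂ (E.cls d)
    half : Fin n → Fin numE ⊎ Fin numE
    half d = side d (edge-rep d)
    half-injective : ∀ i j p q → side i p ≡ side j q → i ≡ j
    half-injective i j (inj₁ p) (inj₁ q) e = trans p (trans (cong E.rep (inj₁-injective e)) (sym q))
    half-injective i j (inj₂ p) (inj₂ q) e = trans p (trans (cong (th ∘ E.rep) (inj₂-injective e)) (sym q))

  distinct-vertices : ∀ {k} (d : Fin k → Fin n) → (∀ {x y} → Orb sg (d x) (d y) → x ≡ y) → k ≤ numVertices
  distinct-vertices d h = injective⇒≤ {f = V.cls ∘ d} λ e → h (V.cls-≡ e)

  -- For a `th`-invariant `X`, that is an edge set, this is membership in the cycle space modulo 2.
  -- A loop has two darts at its vertex and counts twice.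
  Even : (Fin n → Bool) → Set
  Even X = ∀ e → V.orbitSum X e ≡ false

  -- A face set is a function on darts that is constant along `fc`; the edge of `d` separates the
  -- faces of `d` and `th d`.
  Bounding : (Fin n → Bool) → (Fin n → Bool) → Set
  Bounding X S = (∀ d → S (fc d) ≡ S d) × (∀ d → S d xor S (th d) ≡ X d)

  -- `th d` and `sg d` lie on the same face, so around a vertex the terms are differences of
  -- consecutive values of `S` and telescope.
  boundary-even : ∀ S → (∀ d → S (fc d) ≡ S d) → Even (λ d → S d xor S (th d))
  boundary-even S hS e = trans (V.orbitSum-cong e λ d _ → cong (S d xor_)
    (trans (sym (hS (th d))) (cong S (fc-th d)))) (V.orbitSum-coboundary S e)

  -- Vanishing of the first homology with coefficients modulo 2.
  Jordan : Set
  Jordan = ∀ X → (∀ d → X (th d) ≡ X d) → Even X → ∃ (Bounding X)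

xor-telescope : ∀ a b c → (a xor b) xor (b xor c) ≡ a xor c
xor-telescope false false c     = refl
xor-telescope false true  false = refl
xor-telescope false true  true  = refl
xor-telescope true  false c     = refl
xor-telescope true  true  c     = refl

xor-interchange : ∀ a b c d → (a xor b) xor (c xor d) ≡ (a xor c) xor (b xor d)
xor-interchange = interchange (CommutativeMonoid.commutativeSemigroup
    (CommutativeRing.+-commutativeMonoid xor-∧-commutativeRing))

xor-cancelˡ : ∀ a {b c} → a xor b ≡ c → b ≡ a xor c
xor-cancelˡ false e = e
xor-cancelˡ true {false} refl = refl
xor-cancelˡ true {true} refl = refl

private
  does-iff : ∀ {A B : Set} (a? : Dec A) (b? : Dec B) → (A → B) → (B → A) → does a? ≡ does b?
  does-iff (yes a) b? f g = sym (dec-true b? (f a))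
  does-iff (no ¬a) b? f g = sym (dec-false b? (¬a ∘ g))

-- Face sets S, vertex sets t and two marks are encoded injectively by the edge sets ∂S + Σ_{v ∈ t} (path from root to v)
-- and the two marks. Comparing cardinalities, V + F = E + 2 if and only if this encoding Φ is onto, and Φ is onto if and
-- only if every even edge set is some ∂S.
module Homology (M : Map) (conn : Connected M) (root : Fin (Map.n M)) where
  open MapProps M

  edge : Fin n → Fin n → Bool
  edge x d = does (d ≟ x) xor does (d ≟ th x)

  chain : ∀ {e} → Reach M root e → Fin n → Bool
  chain here           d = false
  chain (rot p)        d = chain p d
  chain (rev {e' = x} p) d = chain p d xor edge x d

  edge-θ : ∀ x d → edge x (th d) ≡ edge x d
  edge-θ x d = trans (cong₂ _xor_ (does-iff (th d ≟ x) (d ≟ th x) (λ e → trans (sym (θ-inv d)) (cong th e))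
      (λ e → trans (cong th e) (θ-inv x)))
                                  (does-iff (th d ≟ th x) (d ≟ x) th-injective (cong th)))
                     (xor-comm (does (d ≟ th x)) (does (d ≟ x)))

  chain-θ : ∀ {e} (p : Reach M root e) d → chain p (th d) ≡ chain p d
  chain-θ here d    = refl
  chain-θ (rot p) d = chain-θ p d
  chain-θ (rev p) d = cong₂ _xor_ (chain-θ p d) (edge-θ _ d)

  orbitSum-point : ∀ x e → V.orbitSum (λ d → does (d ≟ x)) e ≡ inOrbit sg e x
  orbitSum-point x e = trans (sum-single _ x λ d d≢x → trans (cong (inOrbit sg e d ∧_) (dec-false (d ≟ x) d≢x))
      (∧-zeroʳ _))
    (trans (cong (inOrbit sg e x ∧_) (dec-true (x ≟ x) refl)) (∧-identityʳ _))

  -- The boundary of a path consists of its two end vertices: `rot` stays at the vertex, and the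
  -- edge added by `rev` moves the end.
  orbitSum-chain : ∀ {y} (p : Reach M root y) e → V.orbitSum (chain p) e ≡ inOrbit sg e root xor inOrbit sg e y
  orbitSum-chain here e = trans (V.orbitSum-zero e (λ _ _ → refl)) (sym (xor-same (inOrbit sg e root)))
  orbitSum-chain (rot {e' = y} p) e = trans (orbitSum-chain p e) (cong (inOrbit sg e root xor_) (V.inOrbit-cong
    (λ o → Orb-trans sg o (Orb-step sg)) (λ o → Orb-trans sg o (V.Orb-sym (Orb-step sg)))))
  orbitSum-chain (rev {e' = y} p) e = begin
    V.orbitSum (λ d → chain p d xor edge y d) e
      ≡⟨ V.orbitSum-xor (chain p) (edge y) e ⟩
    V.orbitSum (chain p) e xor V.orbitSum (edge y) e
      ≡⟨ cong₂ _xor_ (orbitSum-chain p e) (trans (V.orbitSum-xor _ _ e) (cong₂ _xor_ (orbitSum-point y e)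
          (orbitSum-point (th y) e))) ⟩
    (inOrbit sg e root xor inOrbit sg e y) xor (inOrbit sg e y xor inOrbit sg e (th y))
      ≡⟨ xor-telescope (inOrbit sg e root) _ _ ⟩
    inOrbit sg e root xor inOrbit sg e (th y) ∎
    where open ≡-Reasoning

  paths : (Fin numVertices → Bool) → Fin n → Bool
  paths t d = sum (λ v → t v ∧ chain (conn root (V.rep v)) d)

  paths-θ : ∀ t d → paths t (th d) ≡ paths t d
  paths-θ t d = sum-cong λ v → cong (t v ∧_) (chain-θ (conn root (V.rep v)) d)

  paths-zero : ∀ t → (∀ v → t v ≡ false) → ∀ d → paths t d ≡ false
  paths-zero t z d = sum-zero λ v → cong (_∧ chain (conn root (V.rep v)) d) (z v)

  -- Away from the root, the only path with an odd sum at the vertex of `e` is the one that ends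
  -- there. So the vertex sums recover `t` off the root.
  orbitSum-paths : ∀ t e → ¬ Orb sg e root → V.orbitSum (paths t) e ≡ t (V.cls e)
  orbitSum-paths t e ¬o = begin
    V.orbitSum (paths t) e
      ≡⟨ V.orbitSum-sum t (λ v → chain (conn root (V.rep v))) e ⟩
    sum (λ v → t v ∧ V.orbitSum (chain (conn root (V.rep v))) e)
      ≡⟨ sum-cong (λ v → cong (t v ∧_) (trans (orbitSum-chain (conn root (V.rep v)) e)
           (cong (_xor inOrbit sg e (V.rep v)) (V.inOrbit-false ¬o)))) ⟩
    sum (λ v → t v ∧ inOrbit sg e (V.rep v))
      ≡⟨ sum-single _ (V.cls e) (λ v v≢ → trans (cong (t v ∧_) (V.inOrbit-false
           (λ o → v≢ (trans (sym (V.cls-rep v)) (sym (V.cls-cong o)))))) (∧-zeroʳ _)) ⟩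
    t (V.cls e) ∧ inOrbit sg e (V.rep (V.cls e))
      ≡⟨ cong (t (V.cls e) ∧_) (V.inOrbit-true (V.rep-cls e)) ⟩
    t (V.cls e) ∧ true
      ≡⟨ ∧-identityʳ _ ⟩
    t (V.cls e) ∎
    where open ≡-Reasoning

  -- Every edge contributes twice to the total of the vertex sums.
  even-off-root : ∀ Y → (∀ d → Y (th d) ≡ Y d) → (∀ e → ¬ Orb sg e root → V.orbitSum Y e ≡ false) → Even Y
  even-off-root Y hθ h e = by-cases (V.Orb? e root)
    where
    open ≡-Reasoning
    at-vertex : Fin numVertices → Fin n → Bool
    at-vertex v d = inOrbit sg (V.rep v) d ∧ Y d
    total : sum Y ≡ V.orbitSum Y (V.rep (V.cls root))
    total = begin
      sum Y
        ≡⟨ sum-cong (λ d → sym (trans (sum-single (λ v → at-vertex v d) (V.cls d) (λ v v≢ → cong (_∧ Y d)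
             (V.inOrbit-false λ o → v≢ (trans (sym (V.cls-rep v)) (V.cls-cong o)))))
             (cong (_∧ Y d) (V.inOrbit-true (V.Orb-sym (V.rep-cls d)))))) ⟩
      sum (λ d → sum (λ v → at-vertex v d))
        ≡⟨ sum-comm _ ⟩
      sum (λ v → V.orbitSum Y (V.rep v))
        ≡⟨ sum-single _ (V.cls root) (λ v v≢ → h (V.rep v) (λ o → v≢ (trans (sym (V.cls-rep v)) (V.cls-cong o)))) ⟩
      V.orbitSum Y (V.rep (V.cls root)) ∎
    by-cases : Dec (Orb sg e root) → V.orbitSum Y e ≡ false
    by-cases (no ¬o) = h e ¬o
    by-cases (yes o) = begin
      V.orbitSum Y e                        ≡⟨ V.orbitSum-orbit Y (Orb-trans sg o (V.rep-cls root)) ⟩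
      V.orbitSum Y (V.rep (V.cls root))     ≡⟨ total ⟨
      sum Y                                 ≡⟨ sum-involution th Y θ-inv hθ (λ d e≡ → contradiction e≡ (θ-fpf d)) ⟩
      false ∎

  cochain : (Fin numVertices → Bool) → (Fin numFaces → Bool) → Fin n → Bool
  cochain t S d = (S (F.cls d) xor S (F.cls (th d))) xor paths t d

  cochain-θ : ∀ t S d → cochain t S (th d) ≡ cochain t S d
  cochain-θ t S d = cong₂ _xor_
    (trans (cong (λ x → S (F.cls (th d)) xor S (F.cls x)) (θ-inv d)) (xor-comm (S (F.cls (th d))) _)) (paths-θ t d)

  face-function : ∀ (S : Fin numFaces → Bool) d → S (F.cls (fc d)) ≡ S (F.cls d)
  face-function S d = cong S (F.cls-cong (F.Orb-sym (Orb-step fc)))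

  orbitSum-cochain : ∀ t S e → V.orbitSum (cochain t S) e ≡ V.orbitSum (paths t) e
  orbitSum-cochain t S e = trans (V.orbitSum-xor _ (paths t) e)
    (cong (_xor V.orbitSum (paths t) e) (boundary-even (S ∘ F.cls) (face-function S) e))

  vertexPart : (Fin (numVertices + numFaces) → Bool) → Fin numVertices → Bool
  vertexPart g v = g (v ↑ˡ numFaces)

  facePart : (Fin (numVertices + numFaces) → Bool) → Fin numFaces → Bool
  facePart g k = g (numVertices ↑ʳ k)

  -- The edge set does not tell whether the face and the vertex of root belong to S and t; two marks record this.
  marks : Bool → Bool → Fin 2 → Bool
  marks a b zero    = a
  marks a b (suc _) = b

  glueParts : ∀ {a b} → (Fin a → Bool) → (Fin b → Bool) → Fin (a + b) → Bool
  glueParts {a} g h x = [ g , h ]′ (splitAt a x)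

  glueParts-ˡ : ∀ {a b} (g : Fin a → Bool) (h : Fin b → Bool) i → glueParts g h (i ↑ˡ b) ≡ g i
  glueParts-ˡ {a} {b} g h i = cong [ g , h ]′ (splitAt-↑ˡ a i b)

  glueParts-ʳ : ∀ {a b} (g : Fin a → Bool) (h : Fin b → Bool) i → glueParts g h (a ↑ʳ i) ≡ h i
  glueParts-ʳ {a} {b} g h i = cong [ g , h ]′ (splitAt-↑ʳ a b i)

  Φ : (Fin (numVertices + numFaces) → Bool) → Fin (numE + 2) → Bool
  Φ g = glueParts (λ i → cochain (vertexPart g) (facePart g) (E.rep i))
                  (marks (vertexPart g (V.cls root)) (facePart g (F.cls root)))

  θ-determined : ∀ (X Y : Fin n → Bool) → (∀ d → X (th d) ≡ X d) → (∀ d → Y (th d) ≡ Y d) →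
                 (∀ i → X (E.rep i) ≡ Y (E.rep i)) → ∀ d → X d ≡ Y d
  θ-determined X Y hX hY h d = by-cases (edge-rep d)
    where
    by-cases : d ≡ E.rep (E.cls d) ⊎ d ≡ th (E.rep (E.cls d)) → X d ≡ Y d
    by-cases (inj₁ e) = trans (cong X e) (trans (h _) (sym (cong Y e)))
    by-cases (inj₂ e) = trans (cong X e) (trans (hX _) (trans (h _) (trans (sym (hY _)) (sym (cong Y e)))))

  -- The boundary of the face set disappears from the vertex sums, which leaves `t` off the root; at
  -- the root the mark decides.
  coefficient : ∀ t S t' S' → (∀ d → cochain t S d ≡ cochain t' S' d) → t (V.cls root) ≡ t' (V.cls root) → t ≗ t'
  coefficient t S t' S' h h₀ v = by-cases (V.Orb? (V.rep v) root)
    where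
    by-cases : Dec (Orb sg (V.rep v) root) → t v ≡ t' v
    by-cases (yes o) = subst (λ w → t w ≡ t' w) (trans (sym (V.cls-cong o)) (V.cls-rep v)) h₀
    by-cases (no ¬o) = subst (λ w → t w ≡ t' w) (V.cls-rep v) (begin
      t (V.cls (V.rep v))                      ≡⟨ orbitSum-paths t (V.rep v) ¬o ⟨
      V.orbitSum (paths t) (V.rep v)           ≡⟨ orbitSum-cochain t S (V.rep v) ⟨
      V.orbitSum (cochain t S) (V.rep v)       ≡⟨ V.orbitSum-cong (V.rep v) (λ d _ → h d) ⟩
      V.orbitSum (cochain t' S') (V.rep v)     ≡⟨ orbitSum-cochain t' S' (V.rep v) ⟩
      V.orbitSum (paths t') (V.rep v)          ≡⟨ orbitSum-paths t' (V.rep v) ¬o ⟩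
      t' (V.cls (V.rep v))                     ∎)
      where open ≡-Reasoning

  Φ-injective : BoolInjective Φ
  Φ-injective g h eq x = subst (λ y → g y ≡ h y) (join-splitAt numVertices numFaces x) (parts (splitAt numVertices x))
    where
    t t' : Fin numVertices → Bool
    t  = vertexPart g
    t' = vertexPart h
    S S' : Fin numFaces → Bool
    S  = facePart g
    S' = facePart h
    on-edges : ∀ i → cochain t S (E.rep i) ≡ cochain t' S' (E.rep i)
    on-edges i = trans (sym (glueParts-ˡ _ _ i)) (trans (eq (i ↑ˡ 2)) (glueParts-ˡ _ _ i))
    on-marks : ∀ i → marks (t (V.cls root)) (S (F.cls root)) i ≡ marks (t' (V.cls root)) (S' (F.cls root)) i
    on-marks i = trans (sym (glueParts-ʳ {numE} _ _ i)) (trans (eq (numE ↑ʳ i)) (glueParts-ʳ {numE} _ _ i))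
    on-darts : ∀ d → cochain t S d ≡ cochain t' S' d
    on-darts = θ-determined _ _ (cochain-θ t S) (cochain-θ t' S') on-edges
    t≗t' : t ≗ t'
    t≗t' = coefficient t S t' S' on-darts (on-marks zero)
    -- Once the vertex parts agree, the path sums cancel and both face sets have the same boundary.
    -- Their difference is therefore constant, and the second mark makes it zero at `root`.
    δ : Fin n → Bool
    δ d = S (F.cls d) xor S' (F.cls d)
    same-boundary : ∀ d → S (F.cls d) xor S (F.cls (th d)) ≡ S' (F.cls d) xor S' (F.cls (th d))
    same-boundary d = trans (xor-cancelʳ (paths t d) (on-darts d))
      (trans (cong (λ b → cochain t' S' d xor b) (sum-cong (λ v → cong (_∧ chain (conn root (V.rep v)) d) (t≗t' v))))
      (sym (xor-cancelʳ (paths t' d) {c = cochain t' S' d} refl)))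
      where
      xor-cancelʳ : ∀ b {a c} → a xor b ≡ c → a ≡ c xor b
      xor-cancelʳ b {a} {c} e = trans (xor-cancelˡ b (trans (xor-comm b a) e)) (xor-comm b c)
    δ-θ : ∀ d → δ (th d) ≡ δ d
    δ-θ d = xor-cancel (trans (xor-interchange (S (F.cls (th d))) (S' (F.cls (th d))) (S (F.cls d)) (S' (F.cls d)))
      (trans (cong₂ _xor_ (xor-comm (S (F.cls (th d))) _) (xor-comm (S' (F.cls (th d))) _))
      (trans (cong (_xor (S' (F.cls d) xor S' (F.cls (th d)))) (same-boundary d)) (xor-same (S' (F.cls d) xor S'
          (F.cls (th d)))))))
    δ-zero : ∀ d → δ d ≡ false
    δ-zero d = trans (faceReach-invariant δ (λ d → cong₂ _xor_ (face-function S d) (face-function S' d)) δ-θ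
        (conn root d))
      (trans (cong (_xor S' (F.cls root)) (on-marks (suc zero))) (xor-same (S' (F.cls root))))
    parts : ∀ y → g (join numVertices numFaces y) ≡ h (join numVertices numFaces y)
    parts (inj₁ v) = t≗t' v
    parts (inj₂ k) = subst (λ k → S k ≡ S' k) (F.cls-rep k) (xor-cancel (δ-zero (F.rep k)))

  -- The inequality half of Euler's formula, valid for every connected map.
  V+F≤E+2 : numVertices + numFaces ≤ numE + 2
  V+F≤E+2 = boolInjective⇒≤ Φ Φ-injective

  private
    double : ∀ {a b e} → 2 * a + 2 * b ≡ (e + e) + 4 → a + b ≡ e + 2
    double {a} {b} {e} h = *-cancelˡ-≡ (a + b) (e + 2) 2 (trans (solve 2 (λ a b → con 2 :*
        (a :+ b) := con 2 :* a :+ con 2 :* b) refl a b)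
      (trans h (solve 1 (λ e → (e :+ e) :+ con 4 := con 2 :* (e :+ con 2)) refl e)))
      where open +-*-Solver

    halve : ∀ {a b e} → a + b ≡ e + 2 → 2 * a + 2 * b ≡ (e + e) + 4
    halve {a} {b} {e} h = trans (solve 2 (λ a b → con 2 :* a :+ con 2 :* b := con 2 :* (a :+ b)) refl a b)
      (trans (cong (2 *_) h) (solve 1 (λ e → con 2 :* (e :+ con 2) := (e :+ e) :+ con 4) refl e))
      where open +-*-Solver

  -- With equality of sizes the injection `Φ` is onto and hits `X` with both marks zero. Evenness of
  -- `X` makes `t` vanish off the root and the first mark makes it vanish there, so `X` is the
  -- boundary of `S` alone.
  euler⇒jordan : 2 * numVertices + 2 * numFaces ≡ n + 4 → Jordan
  euler⇒jordan euler X hX even = S ∘ F.cls , face-function S , λ d → sym (trans (X≗ d)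
      (trans (cong ((S (F.cls d) xor S (F.cls (th d))) xor_) (paths-zero t t-zero d)) (xor-identityʳ _)))
    where
    target : Fin (numE + 2) → Bool
    target = glueParts (X ∘ E.rep) (λ _ → false)
    solution : ∃ λ g → Φ g ≗ target
    solution = boolInjective⇒surjective Φ Φ-injective (double {numVertices} {numFaces}
      (trans euler (cong (_+ 4) (sym darts-edges)))) target
    t : Fin numVertices → Bool
    t = vertexPart (proj₁ solution)
    S : Fin numFaces → Bool
    S = facePart (proj₁ solution)
    X≗ : ∀ d → X d ≡ cochain t S d
    X≗ = θ-determined _ _ hX (cochain-θ t S) λ i → trans (sym (glueParts-ˡ (X ∘ E.rep) (λ _ → false) i))
      (trans (sym (proj₂ solution (i ↑ˡ 2))) (glueParts-ˡ _ _ i))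
    t-root : t (V.cls root) ≡ false
    t-root = trans (sym (glueParts-ʳ {numE} _ (marks (t (V.cls root)) (S (F.cls root))) zero))
      (trans (proj₂ solution (numE ↑ʳ zero)) (glueParts-ʳ {numE} (X ∘ E.rep) (λ _ → false) zero))
    t-zero : ∀ v → t v ≡ false
    t-zero v = by-cases (V.Orb? (V.rep v) root)
      where
      by-cases : Dec (Orb sg (V.rep v) root) → t v ≡ false
      by-cases (yes o) = subst (λ w → t w ≡ false) (trans (sym (V.cls-cong o)) (V.cls-rep v)) t-root
      by-cases (no ¬o) = trans (cong t (sym (V.cls-rep v))) (trans (sym (orbitSum-paths t (V.rep v) ¬o))
        (trans (sym (orbitSum-cochain t S (V.rep v))) (trans (sym (V.orbitSum-cong (V.rep v) λ d _ → X≗ d)) (even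
            (V.rep v)))))

  -- The missing inequality comes from a right inverse of `Φ`, which is injective because `Φ`
  -- recovers its argument.
  jordan⇒euler : Jordan → 2 * numVertices + 2 * numFaces ≡ n + 4
  jordan⇒euler jordan = trans (halve {numVertices} {numFaces} (≤-antisym V+F≤E+2
      (boolInjective⇒≤ (λ y → proj₁ (preimage y)) (λ y z e x → trans (sym (proj₂ (preimage y) x))
        (trans (Φ-cong e x) (proj₂ (preimage z) x)))))) (cong (_+ 4) darts-edges)
    where
    Φ-cong : ∀ {g h} → g ≗ h → Φ g ≗ Φ h
    Φ-cong {g} {h} e x = go (splitAt numE x)
      where
      go : ∀ y → [ (λ i → cochain (vertexPart g) (facePart g) (E.rep i)) , marks (vertexPart g (V.cls root))
          (facePart g (F.cls root)) ]′ y
               ≡ [ (λ i → cochain (vertexPart h) (facePart h) (E.rep i)) , marks (vertexPart h (V.cls root))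
                   (facePart h (F.cls root)) ]′ y
      go (inj₁ i) = cong₂ _xor_ (cong₂ _xor_ (e _) (e _)) (sum-cong λ v → cong (_∧ chain (conn root (V.rep v))
          (E.rep i)) (e _))
      go (inj₂ zero) = e _
      go (inj₂ (suc _)) = e _
    preimage : ∀ y → ∃ λ g → Φ g ≗ y
    preimage y = glueParts t S , hit
      where
      X : Fin n → Bool
      X d = y (E.cls d ↑ˡ 2)
      X-θ : ∀ d → X (th d) ≡ X d
      X-θ d = cong (λ i → y (i ↑ˡ 2)) (E.cls-cong (E.Orb-sym (Orb-step th)))
      -- Off the root the vertex sums of `X` prescribe `t`; at the root `t` is free and takes the
      -- value of the first mark. Subtracting `paths t` leaves an even set.
      t : Fin numVertices → Bool
      t v = if does (v ≟ V.cls root) then y (numE ↑ʳ zero) else V.orbitSum X (V.rep v)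
      Y : Fin n → Bool
      Y d = X d xor paths t d
      Y-θ : ∀ d → Y (th d) ≡ Y d
      Y-θ d = cong₂ _xor_ (X-θ d) (paths-θ t d)
      Y-even : Even Y
      Y-even = even-off-root Y Y-θ λ e ¬o → trans (V.orbitSum-xor X (paths t) e)
        (trans (cong (V.orbitSum X e xor_) (trans (orbitSum-paths t e ¬o)
          (trans (cong (λ b → if b then y (numE ↑ʳ zero) else V.orbitSum X (V.rep (V.cls e))) (dec-false
              (V.cls e ≟ V.cls root) (¬o ∘ V.cls-≡)))
            (sym (V.orbitSum-orbit X (V.rep-cls e)))))) (xor-same (V.orbitSum X e)))
      bounded : ∃ (Bounding Y)
      bounded = jordan Y Y-θ Y-even
      S₀ : Fin n → Bool
      S₀ = proj₁ bounded
      -- Complementing a face set keeps its boundary, which leaves the freedom to meet the second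
      -- mark.
      shift : Bool
      shift = S₀ root xor y (numE ↑ʳ suc zero)
      S : Fin numFaces → Bool
      S k = S₀ (F.rep k) xor shift
      S-cls : ∀ d → S (F.cls d) ≡ S₀ d xor shift
      S-cls d = cong (_xor shift) (Orb-invariant fc S₀ (proj₁ (proj₂ bounded)) (F.rep-cls d))
      vp : ∀ v → vertexPart (glueParts t S) v ≡ t v
      vp = glueParts-ˡ t S
      fp : ∀ k → facePart (glueParts t S) k ≡ S k
      fp = glueParts-ʳ t S
      hit : Φ (glueParts t S) ≗ y
      hit x = subst (λ x → Φ (glueParts t S) x ≡ y x) (join-splitAt numE 2 x) (go (splitAt numE x))
        where
        go : ∀ z → Φ (glueParts t S) (join numE 2 z) ≡ y (join numE 2 z)
        go (inj₁ i) = begin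
          Φ (glueParts t S) (i ↑ˡ 2)
            ≡⟨ glueParts-ˡ _ _ i ⟩
          cochain (vertexPart (glueParts t S)) (facePart (glueParts t S)) (E.rep i)
            ≡⟨ cong₂ _xor_ (cong₂ _xor_ (trans (fp _) (S-cls (E.rep i))) (trans (fp _) (S-cls (th (E.rep i)))))
                 (sum-cong λ v → cong (_∧ chain (conn root (V.rep v)) (E.rep i)) (vp v)) ⟩
          ((S₀ (E.rep i) xor shift) xor (S₀ (th (E.rep i)) xor shift)) xor paths t (E.rep i)
            ≡⟨ cong (_xor paths t (E.rep i)) (trans (xor-interchange (S₀ (E.rep i)) shift (S₀ (th (E.rep i))) shift)
                 (trans (cong ((S₀ (E.rep i) xor S₀ (th (E.rep i))) xor_) (xor-same shift)) (xor-identityʳ (S₀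
                     (E.rep i) xor S₀ (th (E.rep i)))))) ⟩
          (S₀ (E.rep i) xor S₀ (th (E.rep i))) xor paths t (E.rep i)
            ≡⟨ cong (_xor paths t (E.rep i)) (proj₂ (proj₂ bounded) (E.rep i)) ⟩
          (X (E.rep i) xor paths t (E.rep i)) xor paths t (E.rep i)
            ≡⟨ trans (xor-assoc (X (E.rep i)) _ _) (trans (cong (X (E.rep i) xor_) (xor-same (paths t (E.rep i))))
                (xor-identityʳ _)) ⟩
          X (E.rep i)
            ≡⟨ cong (λ j → y (j ↑ˡ 2)) (E.cls-rep i) ⟩
          y (i ↑ˡ 2) ∎
          where open ≡-Reasoning
        go (inj₂ zero) = trans (glueParts-ʳ {numE} _ _ zero) (trans (vp _)
          (cong (λ b → if b then y (numE ↑ʳ zero) else V.orbitSum X (V.rep (V.cls root))) (dec-true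
              (V.cls root ≟ V.cls root) refl)))
        go (inj₂ (suc zero)) = trans (glueParts-ʳ {numE} _ _ (suc zero)) (trans (fp _) (trans (S-cls root)
          (trans (sym (xor-assoc (S₀ root) (S₀ root) (y (numE ↑ʳ suc zero)))) (cong (_xor y (numE ↑ʳ suc zero))
              (xor-same (S₀ root))))))

-- From an lsp-operation to an automorphism

module Reversal (M : Map) (φ : Fin (Map.n M) → Fin (Map.n M)) (σφσ : ∀ d → Map.sg M (φ (Map.sg M d)) ≡ φ d) where
  open MapProps M

  iter-reversal : ∀ k d → iter sg k (φ (iter sg k d)) ≡ φ d
  iter-reversal zero    d = refl
  iter-reversal (suc k) d = trans (iter-suc sg k _) (trans (cong (iter sg k) (σφσ (iter sg k d))) (iter-reversal k d))

  Orb-reversal : ∀ {d e} → Orb sg d e → Orb sg (φ e) (φ d)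
  Orb-reversal (k , refl) = k , iter-reversal k _

  fixes-vertex : ∀ {v} → Orb sg v (φ v) → ∀ e → Orb sg v e → Orb sg v (φ e)
  fixes-vertex o e v~e = Orb-trans sg o (V.Orb-sym (Orb-reversal v~e))

  fixed-dart-fixes : ∀ {v d} → Orb sg v d → φ d ≡ d → Orb sg v (φ v)
  fixed-dart-fixes {v} v~d e = Orb-trans sg v~d (subst (λ x → Orb sg x (φ v)) e (Orb-reversal v~d))

module Mirror (O : Lopsp) (L : Lsp) (I : IsoToGlued O L) where
  private
    module O = Lopsp O
    module L = Lsp L
    module OP = MapProps O.map
  open IsoToGlued I hiding (module O; module L)
  open Glue L
  open MapProps L.map

  out : Fin n → Bool
  out = L.InOuterB

  out-fc : ∀ e → out (fc e) ≡ out e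
  out-fc e = T-iff (λ t → F.inOrbit-complete (Orb-trans fc (F.inOrbit-sound t) (F.Orb-sym (Orb-step fc))))
                   (λ t → F.inOrbit-complete (Orb-trans fc (F.inOrbit-sound t) (Orb-step fc)))

  out-sg : ∀ e → out (sg e) ≡ out (th e)
  out-sg e = trans (cong out (sym (fc-th e))) (out-fc (th e))

  sg-sg⁻¹ : ∀ e → sg (sg⁻¹ e) ≡ e
  sg-sg⁻¹ e = inverseʳ σ

  sg⁻¹-sg : ∀ e → sg⁻¹ (sg e) ≡ e
  sg⁻¹-sg e = inverseˡ σ

  sg⁻¹-injective : ∀ {x y} → sg⁻¹ x ≡ sg⁻¹ y → x ≡ y
  sg⁻¹-injective e = trans (sym (sg-sg⁻¹ _)) (trans (cong sg e) (sg-sg⁻¹ _))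

  out-th-sg⁻¹ : ∀ e → out (th (sg⁻¹ e)) ≡ out e
  out-th-sg⁻¹ e = trans (sym (out-sg (sg⁻¹ e))) (cong out (sg-sg⁻¹ e))

  gσ-inner : ∀ e → out (th e) ≡ false → gσ (e , false) ≡ (sg e , false)
  gσ-inner e h = cong (λ b → if b then back e else (sg e , false)) (trans (out-sg e) h)

  gσ-turn : ∀ e → out (th e) ≡ true → gσ (e , false) ≡ back e
  gσ-turn e h = cong (λ b → if b then back e else (sg e , false)) (trans (out-sg e) h)

  -- Pulled back along `ψ` from the rotation of `O`: the definition of `gσ` alone does not show that
  -- it is a permutation.
  gσ-injective : ∀ {p q} → Valid p → Valid q → gσ p ≡ gσ q → p ≡ q
  gσ-injective {p} {q} vp vq e = trans (sym (proj₂ P)) (trans (cong ψ (OP.sg-injective (inj _ _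
      (trans (σ-com (proj₁ P)) (trans (cong gσ (proj₂ P)) (trans e (trans (cong gσ (sym (proj₂ Q))) (sym (σ-com
          (proj₁ Q)))))))))) (proj₂ Q))
    where
    P = surj p vp
    Q = surj q vq

  Bridge : Fin n → Set
  Bridge e = out e ≡ true × out (th e) ≡ true

  -- If the previous dart at the vertex were not a bridge, two darts of the glued map would share their successor.
  bridge-sg⁻¹ : ∀ e → Bridge e → Bridge (sg⁻¹ e)
  bridge-sg⁻¹ e (o , o') = by-cases (out (sg⁻¹ e)) refl
    where
    by-cases : ∀ b → out (sg⁻¹ e) ≡ b → Bridge (sg⁻¹ e)
    by-cases true  h = h , trans (out-th-sg⁻¹ e) o
    by-cases false h = contradiction (trans (sym (trans (cong out (sym sg-e≡)) (trans (out-sg e) o'))) h) λ ()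
      where
      z : Fin n
      z = sg⁻¹ (sg⁻¹ e)
      shared : gσ (e , false) ≡ gσ (z , false)
      shared = begin
        gσ (e , false)                     ≡⟨ gσ-turn e o' ⟩
        (sg⁻¹ e , not (OnBoundaryB (sg⁻¹ e))) ≡⟨ cong (λ b → sg⁻¹ e , not b) (trans (cong (out (sg⁻¹ e) ∨_) (trans
            (out-th-sg⁻¹ e) o)) (∨-zeroʳ _)) ⟩
        (sg⁻¹ e , false)                   ≡⟨ cong (_, false) (sg-sg⁻¹ (sg⁻¹ e)) ⟨
        (sg z , false)                     ≡⟨ gσ-inner z (trans (out-th-sg⁻¹ (sg⁻¹ e)) h) ⟨
        gσ (z , false)                     ∎
        where open ≡-Reasoning
      sg-e≡ : sg e ≡ sg⁻¹ e
      sg-e≡ = trans (cong sg (cong proj₁ (gσ-injective {e , false} {z , false} tt tt shared))) (sg-sg⁻¹ (sg⁻¹ e))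

  bridge-sg : ∀ e → Bridge e → Bridge (sg e)
  bridge-sg e = Orb-closed sg⁻¹ Bridge bridge-sg⁻¹ (Orbit.Orb-sym sg⁻¹ sg⁻¹-injective (1 , sg⁻¹-sg e))

  bridge-th : ∀ e → Bridge e → Bridge (th e)
  bridge-th e (o , o') = o' , trans (cong out (θ-inv e)) o

  -- All edges being bridges, L has a single face; it has the length of a face of O, namely 3, which is odd.
  no-bridge : ∀ e → out e ≡ true → out (th e) ≡ true → ⊥
  no-bridge e o o' = odd (cases (th b)) (cases (th (fc b))) (cases (th (fc (fc b))))
    where
    all-bridges : ∀ x → Bridge x
    all-bridges x = Reach-closed Bridge bridge-sg bridge-th (proj₁ (proj₂ L.twoConnected) e x) (o , o')
    unmirrored : ∀ q → Valid q → q ≡ (proj₁ q , false)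
    unmirrored (x , false) _ = refl
    unmirrored (x , true)  v = contradiction (≡⇒T (cong (_∨ out (th x)) (proj₁ (all-bridges x)))) v
    p : Fin O.n → Fin n
    p d = proj₁ (ψ d)
    -- When every dart is a bridge, `gσ` always turns back, so `th ∘ p` carries the face permutation
    -- of `O` to the inverse of that of `L`.
    p-fc : ∀ d → fc (th (p (O.fc d))) ≡ th (p d)
    p-fc d = trans (fc-th _) (trans (cong (sg ∘ proj₁) step) (sg-sg⁻¹ (th (p d))))
      where
      step : ψ (O.fc d) ≡ back (th (p d))
      step = trans (σ-com (O.th d)) (trans (cong gσ (trans (θ-com d) (cong gθ (unmirrored (ψ d) (valid d)))))
        (gσ-turn (th (p d)) (trans (cong out (θ-inv (p d))) (proj₁ (all-bridges (p d))))))
    d : Fin O.n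
    d = proj₁ (surj (e , false) tt)
    b : Fin n
    b = th (p d)
    fc³ : fc (fc (fc b)) ≡ b
    fc³ = trans (cong (fc ∘ fc ∘ fc ∘ th ∘ p) (sym (Period.returns (OP.F.orbitSize≡⇒Period (O.triangles d)))))
      (trans (cong (fc ∘ fc) (p-fc (O.fc (O.fc d)))) (trans (cong fc (p-fc (O.fc d))) (p-fc d)))
    Cases : Fin n → Set
    Cases x = x ≡ b ⊎ x ≡ fc b ⊎ x ≡ fc (fc b)
    cases : ∀ x → Cases x
    cases x = Orb-closed fc Cases
      (λ { y (inj₁ e) → inj₂ (inj₁ (cong fc e)) ; y (inj₂ (inj₁ e)) → inj₂ (inj₂ (cong fc e))
         ; y (inj₂ (inj₂ e)) → inj₁ (trans (cong fc e) fc³) })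
      (Orb-trans fc (F.Orb-sym (in-outer b)) (in-outer x)) (inj₁ refl)
      where
      in-outer : ∀ x → Orb fc L.outer x
      in-outer x = F.inOrbit-sound (≡⇒T (proj₁ (all-bridges x)))
    fc-moves : fc b ≢ b
    fc-moves e = L.proper b (trans (cong L.c (sym e)) (L.c-vert (th b)))
    th-sym : ∀ {x y} → th x ≡ y → x ≡ th y
    th-sym e = trans (sym (θ-inv _)) (cong th e)
    odd : Cases (th b) → Cases (th (fc b)) → Cases (th (fc (fc b))) → ⊥
    odd (inj₁ e₁) _ _ = θ-fpf b e₁
    odd (inj₂ (inj₁ e₁)) _ (inj₁ e₃) = fc-moves (fc-injective (trans (th-sym e₃) e₁))
    odd (inj₂ (inj₁ e₁)) _ (inj₂ (inj₁ e₃)) = fc-moves (trans (sym (cong fc (trans (th-sym e₃) (sym (th-sym e₁))))) fc³)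
    odd (inj₂ (inj₁ e₁)) _ (inj₂ (inj₂ e₃)) = θ-fpf _ e₃
    odd (inj₂ (inj₂ e₁)) (inj₁ e₂) _ = fc-moves (sym (fc-injective (trans (th-sym e₂) e₁)))
    odd (inj₂ (inj₂ e₁)) (inj₂ (inj₁ e₂)) _ = θ-fpf _ e₂
    odd (inj₂ (inj₂ e₁)) (inj₂ (inj₂ e₂)) _ = fc-moves (trans (th-sym e₂) (sym (th-sym e₁)))

  -- Boundary darts occur only once, in the copy marked false, and are fixed.
  mirror : GDart → GDart
  mirror (e , s) = e , (if OnBoundaryB e then false else not s)

  mirror-valid : ∀ q → Valid (mirror q)
  mirror-valid (e , s) = by-cases (OnBoundaryB e) refl s
    where
    by-cases : ∀ b → OnBoundaryB e ≡ b → ∀ s → Valid (e , (if b then false else not s))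
    by-cases true  h s     = tt
    by-cases false h true  = tt
    by-cases false h false = subst T h

  mirror-false : ∀ e → mirror (e , false) ≡ (e , not (OnBoundaryB e))
  mirror-false e = cong (e ,_) (helper (OnBoundaryB e))
    where
    helper : ∀ b → (if b then false else true) ≡ not b
    helper true  = refl
    helper false = refl

  mirror-back : ∀ e → mirror (back e) ≡ (sg⁻¹ e , false)
  mirror-back e = cong (sg⁻¹ e ,_) (helper (OnBoundaryB (sg⁻¹ e)))
    where
    helper : ∀ b → (if b then false else not (not b)) ≡ false
    helper true  = refl
    helper false = refl

  mirror-involutive : ∀ q → Valid q → mirror (mirror q) ≡ q
  mirror-involutive (e , false) _ = cong (e ,_) (helper (OnBoundaryB e))
    where
    helper : ∀ b → (if b then false else not (if b then false else true)) ≡ false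
    helper true  = refl
    helper false = refl
  mirror-involutive (e , true) v = cong (e ,_) (helper (OnBoundaryB e) v)
    where
    helper : ∀ b → ¬ T b → (if b then false else not (if b then false else false)) ≡ true
    helper true  ¬t = contradiction tt ¬t
    helper false _  = refl

  mirror-gθ : ∀ q → mirror (gθ q) ≡ gθ (mirror q)
  mirror-gθ (e , s) = cong (λ b → th e , (if b then false else not s))
    (trans (cong (λ x → out (th e) ∨ out x) (θ-inv e)) (∨-comm (out (th e)) (out e)))

  -- This will say that the automorphism conjugates the rotation to its inverse. The delicate case
  -- is the outer angle: there `no-bridge` shows that `e` itself is not on the outer face, so the
  -- second `gσ` rotates inside `L`.
  gσ-mirror-gσ : ∀ q → Valid q → gσ (mirror (gσ q)) ≡ mirror q
  gσ-mirror-gσ (e , false) _ = trans (by-cases (out (th e)) refl) (sym (mirror-false e))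
    where
    open ≡-Reasoning
    back-sg : back (sg e) ≡ (e , not (OnBoundaryB e))
    back-sg = cong (λ x → x , not (OnBoundaryB x)) (sg⁻¹-sg e)
    by-cases : ∀ b → out (th e) ≡ b → gσ (mirror (gσ (e , false))) ≡ (e , not (OnBoundaryB e))
    by-cases false h = begin
      gσ (mirror (gσ (e , false)))     ≡⟨ cong (gσ ∘ mirror) (gσ-inner e h) ⟩
      gσ (mirror (sg e , false))       ≡⟨ cong gσ (mirror-false (sg e)) ⟩
      gσ (sg e , not (out (sg e) ∨ out (th (sg e)))) ≡⟨ cong (λ b → gσ (sg e , not (b ∨ out (th (sg e))))) (trans
          (out-sg e) h) ⟩
      gσ (sg e , not (out (th (sg e)))) ≡⟨ turn (out (th (sg e))) refl ⟩
      back (sg e)                      ≡⟨ back-sg ⟩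
      (e , not (OnBoundaryB e))        ∎
      where
      turn : ∀ b → out (th (sg e)) ≡ b → gσ (sg e , not b) ≡ back (sg e)
      turn true  h = gσ-turn (sg e) h
      turn false _ = refl
    by-cases true h = begin
      gσ (mirror (gσ (e , false)))  ≡⟨ cong (gσ ∘ mirror) (gσ-turn e h) ⟩
      gσ (mirror (back e))          ≡⟨ cong gσ (mirror-back e) ⟩
      gσ (sg⁻¹ e , false)           ≡⟨ gσ-inner (sg⁻¹ e) (trans (out-th-sg⁻¹ e) (inner (out e) refl)) ⟩
      (sg (sg⁻¹ e) , false)         ≡⟨ cong (_, false) (sg-sg⁻¹ e) ⟩
      (e , false)                   ≡⟨ cong (λ b → e , not b) (trans (cong (out e ∨_) h) (∨-zeroʳ (out e))) ⟨
      (e , not (OnBoundaryB e))     ∎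
      where
      inner : ∀ b → out e ≡ b → b ≡ false
      inner false _ = refl
      inner true  o = ⊥-elim (no-bridge e o h)
  gσ-mirror-gσ (e , true) v = begin
    gσ (mirror (back e))          ≡⟨ cong gσ (mirror-back e) ⟩
    gσ (sg⁻¹ e , false)           ≡⟨ gσ-inner (sg⁻¹ e) (trans (out-th-sg⁻¹ e) (inner (out e) refl)) ⟩
    (sg (sg⁻¹ e) , false)         ≡⟨ cong (_, false) (sg-sg⁻¹ e) ⟩
    (e , false)                   ≡⟨ cong (e ,_) (helper (OnBoundaryB e)) ⟨
    mirror (e , true)             ∎
    where
    open ≡-Reasoning
    helper : ∀ b → (if b then false else false) ≡ false
    helper true  = refl
    helper false = refl
    inner : ∀ b → out e ≡ b → b ≡ false
    inner false _ = refl
    inner true  o = contradiction (≡⇒T (cong (_∨ out (th e)) o)) v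

  φ : Fin O.n → Fin O.n
  φ d = proj₁ (surj (mirror (ψ d)) (mirror-valid (ψ d)))

  ψ-φ : ∀ d → ψ (φ d) ≡ mirror (ψ d)
  ψ-φ d = proj₂ (surj (mirror (ψ d)) (mirror-valid (ψ d)))

  φ-involutive : ∀ d → φ (φ d) ≡ d
  φ-involutive d = inj _ _ (trans (ψ-φ (φ d)) (trans (cong mirror (ψ-φ d)) (mirror-involutive (ψ d) (valid d))))

  φ-th : ∀ d → O.th (φ d) ≡ φ (O.th d)
  φ-th d = inj _ _ (trans (θ-com (φ d)) (trans (cong gθ (ψ-φ d)) (trans (sym (mirror-gθ (ψ d)))
    (trans (cong mirror (sym (θ-com d))) (sym (ψ-φ (O.th d)))))))

  σφσ : ∀ d → O.sg (φ (O.sg d)) ≡ φ d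
  σφσ d = inj _ _ (trans (σ-com (φ (O.sg d))) (trans (cong gσ (trans (ψ-φ (O.sg d)) (cong mirror (σ-com d))))
    (trans (gσ-mirror-gσ (ψ d) (valid d)) (sym (ψ-φ d)))))

  automorphism : OrRevAut O.map
  automorphism = record
    { φ     = permutation φ φ φ-involutive φ-involutive
    ; θ-com = φ-th
    ; σ-rev = λ d → trans (cong O.sg⁻¹ (sym (σφσ d))) (inverseˡ O.σ)
    }

  -- Until the first boundary dart is met, `gσ` agrees with the rotation of `L`. The dart found is
  -- fixed by `mirror`, and one fixed dart suffices to fix the vertex.
  boundary-dart : ∀ {v} → L.OnOuter v → ∃ λ b → OnBoundaryB b ≡ true × Orb gσ (v , false) (b , false)
  boundary-dart {v} (_ , (k , refl) , o) = search k v (T⇒≡ o)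
    where
    search : ∀ k v → out (iter sg k v) ≡ true → ∃ λ b → OnBoundaryB b ≡ true × Orb gσ (v , false) (b , false)
    search zero    v o = v , cong (_∨ out (th v)) o , 0 , refl
    search (suc k) v o = by-cases (out (th v)) refl
      where
      by-cases : ∀ b → out (th v) ≡ b → ∃ λ b → OnBoundaryB b ≡ true × Orb gσ (v , false) (b , false)
      by-cases true  h = v , trans (cong (out v ∨_) h) (∨-zeroʳ (out v)) , 0 , refl
      by-cases false h with search k (sg v) (trans (cong out (sym (iter-suc sg k v))) o)
      ... | b , bnd , r = b , bnd , Orb-trans gσ (1 , gσ-inner v h) r

  ψ-iter : ∀ k d → ψ (iter O.sg k d) ≡ iter gσ k (ψ d)
  ψ-iter zero    d = refl
  ψ-iter (suc k) d = trans (σ-com (iter O.sg k d)) (cong gσ (ψ-iter k d))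

  fixes : ∀ {v w} → GSameVertex (ψ v) (w , false) → L.OnOuter w → FixesVertex O.map automorphism v
  fixes {v} v~w w-out with boundary-dart w-out
  ... | b , bnd , w~b with Orb-trans gσ v~w w~b
  ... | k , e = R.fixes-vertex (R.fixed-dart-fixes {d = iter O.sg k v} (k , refl) (inj _ _ (begin
      ψ (φ (iter O.sg k v))        ≡⟨ ψ-φ (iter O.sg k v) ⟩
      mirror (ψ (iter O.sg k v))   ≡⟨ cong mirror ψ≡ ⟩
      mirror (b , false)           ≡⟨ cong (λ c → b , (if c then false else true)) bnd ⟩
      (b , false)                  ≡⟨ ψ≡ ⟨
      ψ (iter O.sg k v)            ∎)))
    where
    open ≡-Reasoning
    module R = Reversal O.map φ σφσ
    ψ≡ : ψ (iter O.sg k v) ≡ (b , false)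
    ψ≡ = trans (ψ-iter k v) e

lsp⇒automorphism : (O : Lopsp) → CanBeWrittenAsLsp O → HasFixingOrRevAut O
lsp⇒automorphism O (L , I) = automorphism , fixes v₀-com v₀-out , fixes v₁-com v₁-out , fixes v₂-com v₂-out
  where
  open Mirror O L I
  open IsoToGlued I using (v₀-com; v₁-com; v₂-com)
  open Lsp L using (v₀-out; v₁-out; v₂-out)

-- Colours

third-colour : ∀ {a b x y : Fin 3} → a ≢ b → x ≢ a → x ≢ b → y ≢ a → y ≢ b → x ≡ y
third-colour {a} {b} {x} {y} = decided a b x y
  where
  decided : ∀ (a b x y : Fin 3) → a ≢ b → x ≢ a → x ≢ b → y ≢ a → y ≢ b → x ≡ y
  decided = from-yes (all? {n = 3} λ a → all? λ b → all? λ x → all? λ y →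
    ¬? (a ≟ b) →-dec ¬? (x ≟ a) →-dec ¬? (x ≟ b) →-dec ¬? (y ≟ a) →-dec ¬? (y ≟ b) →-dec x ≟ y)

swapAround : Fin 3 → Fin 3 → Fin 3
swapAround 0F 0F = 0F
swapAround 0F 1F = 2F
swapAround 0F 2F = 1F
swapAround 1F 0F = 2F
swapAround 1F 1F = 1F
swapAround 1F 2F = 0F
swapAround 2F 0F = 1F
swapAround 2F 1F = 0F
swapAround 2F 2F = 2F

swapAround-centre : ∀ k → swapAround k k ≡ k
swapAround-centre = from-yes (all? λ k → swapAround k k ≟ k)

swapAround-involutive : ∀ k x → swapAround k (swapAround k x) ≡ x
swapAround-involutive = from-yes (all? λ k → all? λ x → swapAround k (swapAround k x) ≟ x)

swapAround-moves : ∀ k x → x ≢ k → swapAround k x ≢ x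
swapAround-moves = from-yes (all? λ k → all? λ x → ¬? (x ≟ k) →-dec ¬? (swapAround k x ≟ x))

swapAround-≢ : ∀ k x → x ≢ k → swapAround k x ≢ k
swapAround-≢ = from-yes (all? λ k → all? λ x → ¬? (x ≟ k) →-dec ¬? (swapAround k x ≟ k))

-- The normal form to which a given automorphism is reduced: involutivity and preservation of
-- colours are gained on the way.
record ColourReflection (O : Lopsp) : Set where
  open Lopsp O
  field
    φ            : Fin n → Fin n
    φ-involutive : ∀ d → φ (φ d) ≡ d
    φ-th         : ∀ d → th (φ d) ≡ φ (th d)
    σφσ          : ∀ d → sg (φ (sg d)) ≡ φ d
    φ-c          : ∀ d → c (φ d) ≡ c d
    fix₀         : Orb sg v₀ (φ v₀)
    fix₁         : Orb sg v₁ (φ v₁)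
    fix₂         : Orb sg v₂ (φ v₂)

module Triangulation (O : Lopsp) where
  open Lopsp O public using (c; c-vert; v₀; v₁; v₂; proper)
  open MapProps (Lopsp.map O) public

  fc³ : ∀ d → fc (fc (fc d)) ≡ d
  fc³ d = Period.returns (F.orbitSize≡⇒Period (Lopsp.triangles O d))

  fc²-sg : ∀ d → fc (fc (sg d)) ≡ th d
  fc²-sg d = trans (cong (fc ∘ fc) (sym (fc-th d))) (fc³ (th d))

  sg-sg⁻¹ : ∀ e → sg (sg⁻¹ e) ≡ e
  sg-sg⁻¹ e = inverseʳ σ

  sg⁻¹-sg : ∀ e → sg⁻¹ (sg e) ≡ e
  sg⁻¹-sg e = inverseˡ σ

  c-Orb : ∀ {d e} → Orb sg d e → c e ≡ c d
  c-Orb = Orb-invariant sg c c-vert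

  c-sg⁻¹ : ∀ d → c (sg⁻¹ d) ≡ c d
  c-sg⁻¹ d = trans (sym (c-vert (sg⁻¹ d))) (cong c (sg-sg⁻¹ d))

  c-th-sg≢c : ∀ d → c (th (sg d)) ≢ c d
  c-th-sg≢c d e = proper (sg d) (trans (c-vert d) (sym e))

  -- The far ends of consecutive darts are joined by the third side of their triangle.
  c-th-sg≢c-th : ∀ d → c (th (sg d)) ≢ c (th d)
  c-th-sg≢c-th d e = proper (fc (sg d)) (trans (c-vert (th (sg d))) (trans e
    (trans (cong c (sym (fc²-sg d))) (c-vert (th (fc (sg d)))))))

  c-th-sg⁻¹≢c : ∀ d → c (th (sg⁻¹ d)) ≢ c d
  c-th-sg⁻¹≢c d e = proper (sg⁻¹ d) (trans (c-sg⁻¹ d) (sym e))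

  c-th-sg⁻¹≢c-th : ∀ d → c (th (sg⁻¹ d)) ≢ c (th d)
  c-th-sg⁻¹≢c-th d e = c-th-sg≢c-th (sg⁻¹ d) (trans (cong (c ∘ th) (sg-sg⁻¹ d)) (sym e))

  -- With three colours, the far ends around a vertex alternate between the two colours that the
  -- vertex does not have.
  c-th-sg² : ∀ d → c (th (sg (sg d))) ≡ c (th d)
  c-th-sg² d = third-colour {a = c (th (sg d))} {b = c d} (c-th-sg≢c d)
    (c-th-sg≢c-th (sg d)) (λ e → c-th-sg≢c (sg d) (trans e (sym (c-vert d))))
    (λ e → c-th-sg≢c-th d (sym e)) (λ e → proper d (sym e))

  module MapReflection (φ : Fin n → Fin n) (φ-th : ∀ d → th (φ d) ≡ φ (th d)) (σφσ : ∀ d → sg (φ (sg d)) ≡ φ d) where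
    open Reversal (Lopsp.map O) φ σφσ public

    φ-sg : ∀ d → φ (sg d) ≡ sg⁻¹ (φ d)
    φ-sg d = trans (sym (sg⁻¹-sg _)) (cong sg⁻¹ (σφσ d))

    -- `φ ∘ φ` commutes with rotation and reversal, so on a connected map one fixed dart makes it
    -- the identity. That dart is `v`: if `φ` moves `v` by `k` rotations, then reversing orientation
    -- makes it move the image back by `k`.
    involutive : ∀ {v} → Orb sg v (φ v) → ∀ d → φ (φ d) ≡ d
    involutive {v} (k , e) d = Reach-closed (λ d → φ (φ d) ≡ d) step-sg
        (λ d h → trans (cong φ (sym (φ-th d))) (trans (sym (φ-th (φ d))) (cong th h)))
        (proj₁ (Lopsp.plane O) v d) (V.iter-injective k (trans (cong (iter sg k ∘ φ) (sym e)) (trans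
            (iter-reversal k v) (sym e))))
      where
      step-sg : ∀ d → φ (φ d) ≡ d → φ (φ (sg d)) ≡ sg d
      step-sg d h = trans (sym (σφσ (φ (sg d)))) (cong sg (trans (cong φ (σφσ d)) h))

    -- The colours at the two ends of one dart determine the third colour of the adjacent triangle,
    -- and so on through the map; hence the action on colours can be read off at `v₀`.
    colours-from : ∀ (s : Fin 3 → Fin 3) → (∀ {x y} → s x ≡ s y → x ≡ y) →
                   c (φ v₀) ≡ s (c v₀) → c (φ (th v₀)) ≡ s (c (th v₀)) → ∀ d → c (φ d) ≡ s (c d)
    colours-from s s-inj h h′ d = proj₁ (Reach-closed (λ d → c (φ d) ≡ s (c d) × c (φ (th d)) ≡ s (c (th d)))
      step-sg (λ d (p , q) → q , trans (cong (c ∘ φ) (θ-inv d)) (trans p (cong (s ∘ c) (sym (θ-inv d)))))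
      (proj₁ (Lopsp.plane O) v₀ d) (h , h′))
      where
      step-sg : ∀ d → c (φ d) ≡ s (c d) × c (φ (th d)) ≡ s (c (th d)) →
                c (φ (sg d)) ≡ s (c (sg d)) × c (φ (th (sg d))) ≡ s (c (th (sg d)))
      step-sg d (p , q) =
          trans (trans (cong c (φ-sg d)) (c-sg⁻¹ (φ d))) (trans p (cong s (sym (c-vert d))))
        , trans (cong c (trans (sym (φ-th (sg d))) (cong th (φ-sg d))))
            (third-colour {a = s (c d)} {b = s (c (th d))} (λ e → proper d (s-inj e))
              (λ e → c-th-sg⁻¹≢c (φ d) (trans e (sym p)))
              (λ e → c-th-sg⁻¹≢c-th (φ d) (trans e (sym (trans (cong c (φ-th d)) q))))
              (λ e → c-th-sg≢c d (s-inj e)) (λ e → c-th-sg≢c-th d (s-inj e)))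

-- A reflection that exchanges two colours forces all vertices of these colours to have degree 4, so that O is a
-- bipyramid with poles of colour k. The equator is an even set of edges; the hemispheres S that it bounds tell the
-- poles apart, and composing with the rotation ρ by one step about the axis through the poles restores the colours.
module Bipyramid (O : Lopsp)
  (φ : Fin (Lopsp.n O) → Fin (Lopsp.n O)) (φ-th : ∀ d → Lopsp.th O (φ d) ≡ φ (Lopsp.th O d))
  (σφσ : ∀ d → Lopsp.sg O (φ (Lopsp.sg O d)) ≡ φ d)
  (k : Fin 3) (k≢one : k ≢ one) (φ-c : ∀ d → Lopsp.c O (φ d) ≡ swapAround k (Lopsp.c O d))
  (fix₀ : Orb (Lopsp.sg O) (Lopsp.v₀ O) (φ (Lopsp.v₀ O)))
  (fix₁ : Orb (Lopsp.sg O) (Lopsp.v₁ O) (φ (Lopsp.v₁ O)))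
  (fix₂ : Orb (Lopsp.sg O) (Lopsp.v₂ O) (φ (Lopsp.v₂ O))) where
  open Triangulation O
  open MapReflection φ φ-th σφσ

  private
    s : Fin 3 → Fin 3
    s = swapAround k

    pole : ∀ {v} → Orb sg v (φ v) → c v ≡ k
    pole {v} o = by-cases (c v ≟ k)
      where
      by-cases : Dec (c v ≡ k) → c v ≡ k
      by-cases (yes e)  = e
      by-cases (no c≢k) = contradiction (trans (sym (φ-c v)) (c-Orb o)) (swapAround-moves k (c v) c≢k)

    φ-injective : ∀ {x y} → φ x ≡ φ y → x ≡ y
    φ-injective e = trans (sym (involutive fix₀ _)) (trans (cong φ e) (involutive fix₀ _))

    -- The marked vertices are fixed and so have colour `k`, which differs from `one`: the degree
    -- condition covers every vertex of colour `one`.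
    period-one : ∀ d → c d ≡ one → Period sg d 4
    period-one d c≡ = V.orbitSize≡⇒Period (Lopsp.deg-one O d (away fix₀) (away fix₁) (away fix₂) c≡)
      where
      away : ∀ {v} → Orb sg v (φ v) → ¬ Orb sg v d
      away fix o = k≢one (trans (sym (trans (c-Orb o) (pole fix))) c≡)

    -- The colours other than `k` are `one` and the colour that `φ` exchanges with it, so `φ`
    -- transports the degree.
    degree-4 : ∀ d → c d ≢ k → iter sg 4 d ≡ d × iter sg 2 d ≢ d
    degree-4 d c≢k = by-cases (c d ≟ one)
      where
      by-cases : Dec (c d ≡ one) → iter sg 4 d ≡ d × iter sg 2 d ≢ d
      by-cases (yes e) = Period.returns per , Period.minimal per 2 (s≤s z≤n) (s≤s (s≤s (s≤s z≤n)))
        where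
        per = period-one d e
      by-cases (no ≢one) = φ-injective (V.iter-injective 4 (trans (iter-reversal 4 d) (sym (Period.returns per))))
          , λ e → Period.minimal per 2 (s≤s z≤n) (s≤s (s≤s (s≤s z≤n)))
              (trans (cong (iter sg 2 ∘ φ) (sym e)) (iter-reversal 2 d))
        where
        per : Period sg (φ d) 4
        per = period-one (φ d) (trans (φ-c d) (third-colour {a = k} {b = c d} (λ e → c≢k (sym e))
          (swapAround-≢ k (c d) c≢k) (swapAround-moves k (c d) c≢k) (λ e → k≢one (sym e)) (λ e → ≢one (sym e))))

    polar : Fin n → Bool
    polar d = does (c d ≟ k)

    equator : Fin n → Bool
    equator d = not (polar d) ∧ not (polar (th d))

    polar-true : ∀ {d} → c d ≡ k → polar d ≡ true
    polar-true {d} = dec-true (c d ≟ k)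

    polar-false : ∀ {d} → c d ≢ k → polar d ≡ false
    polar-false {d} = dec-false (c d ≟ k)

    double-step : Fin n → Fin n
    double-step d = if polar d then d else sg (sg d)

    -- At a vertex of degree 4 the far ends alternate between poles and equator, so `sg ∘ sg` pairs
    -- the two equator darts. No equator dart starts at a pole.
    equator-even : Even equator
    equator-even e = V.orbitSum-involution double-step equator e
      (λ d → involution d (c d ≟ k)) (λ d → orbit d (polar d)) (λ d → invariant d (c d ≟ k)) (λ d _ → fixed d (c d ≟ k))
      where
      step-polar : ∀ {d} → c d ≡ k → double-step d ≡ d
      step-polar {d} p = cong (if_then d else sg (sg d)) (polar-true p)
      step-other : ∀ {d} → c d ≢ k → double-step d ≡ sg (sg d)
      step-other {d} p = cong (if_then d else sg (sg d)) (polar-false p)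
      involution : ∀ d → Dec (c d ≡ k) → double-step (double-step d) ≡ d
      involution d (yes p) = trans (cong double-step (step-polar p)) (step-polar p)
      involution d (no ¬p) = trans (cong double-step (step-other ¬p))
        (trans (step-other (λ e → ¬p (trans (sym (c-Orb (2 , refl))) e))) (proj₁ (degree-4 d ¬p)))
      orbit : ∀ d b → Orb sg d (if b then d else sg (sg d))
      orbit d true  = 0 , refl
      orbit d false = 2 , refl
      invariant : ∀ d → Dec (c d ≡ k) → equator (double-step d) ≡ equator d
      invariant d (yes p) = cong equator (step-polar p)
      invariant d (no ¬p) = trans (cong equator (step-other ¬p))
        (cong₂ (λ x y → not (does (x ≟ k)) ∧ not (does (y ≟ k))) (c-Orb {d} (2 , refl)) (c-th-sg² d))
      fixed : ∀ d → Dec (c d ≡ k) → double-step d ≡ d → equator d ≡ false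
      fixed d (yes p) _ = cong (λ b → not b ∧ not (polar (th d))) (polar-true p)
      fixed d (no ¬p) e = contradiction (trans (sym (step-other ¬p)) e) (proj₂ (degree-4 d ¬p))

    hemispheres : ∃ (Bounding equator)
    hemispheres = Homology.euler⇒jordan (Lopsp.map O) (proj₁ (Lopsp.plane O)) v₀ (proj₂ (Lopsp.plane O)) equator
      (λ d → trans (cong (λ x → not (polar (th d)) ∧ not (polar x)) (θ-inv d)) (∧-comm (not (polar
          (th d))) _)) equator-even

    S : Fin n → Bool
    S = proj₁ hemispheres

    S-fc : ∀ d → S (fc d) ≡ S d
    S-fc = proj₁ (proj₂ hemispheres)

    S-∂ : ∀ d → S d xor S (th d) ≡ equator d
    S-∂ = proj₂ (proj₂ hemispheres)

    S-sg : ∀ d → S (sg d) ≡ S (th d)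
    S-sg d = trans (cong S (sym (fc-th d))) (S-fc (th d))

    S-sg-polar : ∀ d → c d ≡ k → S (sg d) ≡ S d
    S-sg-polar d p = trans (S-sg d) (sym (xor-cancel (trans (S-∂ d) (cong (λ b → not b ∧ not (polar (th d)))
        (polar-true p)))))

    S-th-spoke : ∀ d → c (th d) ≡ k → S (th d) ≡ S d
    S-th-spoke d p = sym (xor-cancel (trans (S-∂ d) (trans (cong (λ b → not (polar d) ∧ not b) (polar-true p))
        (∧-zeroʳ _))))

    S-th-equator : ∀ d → c d ≢ k → c (th d) ≢ k → S (th d) ≡ not (S d)
    S-th-equator d p q = flip (S d) (trans (S-∂ d) (cong₂ (λ a b → not a ∧ not b) (polar-false p) (polar-false q)))
      where
      flip : ∀ a {b} → a xor b ≡ true → b ≡ not a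
      flip false e = e
      flip true {false} _ = refl

    turn : Bool → Fin n → Fin n
    turn b d = if b then sg d else sg⁻¹ d

    -- Seen from outside, the rotations at the two poles run in opposite directions about the axis.
    r : Fin n → Fin n
    r d = turn (S d) d

    -- An equator dart is moved through its triangle: `fc (fc d)` is the spoke from the pole to the
    -- start of `d`, and `fc` leads from the rotated spoke to the rotated equator dart.
    ρ : Fin n → Fin n
    ρ d = if polar d then r d else if polar (th d) then th (r (th d)) else fc (r (fc (fc d)))

    ρ-polar : ∀ {d} → c d ≡ k → ρ d ≡ r d
    ρ-polar {d} p = cong (if_then r d else (if polar (th d) then th (r (th d)) else fc (r (fc (fc d))))) (polar-true p)

    ρ-spoke : ∀ {d} → c (th d) ≡ k → ρ d ≡ th (r (th d))
    ρ-spoke {d} p = trans (cong (if_then r d else (if polar (th d) then th (r (th d)) else fc (r (fc (fc d)))))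
        (polar-false (λ e → proper d (trans e (sym p)))))
      (cong (if_then th (r (th d)) else fc (r (fc (fc d)))) (polar-true p))

    ρ-equator : ∀ {d} → c d ≢ k → c (th d) ≢ k → ρ d ≡ fc (r (fc (fc d)))
    ρ-equator {d} p q = trans (cong (if_then r d else (if polar (th d) then th (r (th d)) else fc (r (fc (fc d)))))
        (polar-false p))
      (cong (if_then th (r (th d)) else fc (r (fc (fc d)))) (polar-false q))

    r-sg : ∀ {d} → c d ≡ k → r (sg d) ≡ sg (r d)
    r-sg {d} p = trans (cong (λ b → turn b (sg d)) (S-sg-polar d p)) (go (S d))
      where
      go : ∀ b → turn b (sg d) ≡ sg (turn b d)
      go true  = refl
      go false = trans (sg⁻¹-sg d) (sym (sg-sg⁻¹ d))

    -- For a spoke from one pole, this is the spoke from the other side of the equator that ends at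
    -- the same vertex.
    opposite : Fin n → Fin n
    opposite d = th (sg (sg (th d)))

    -- The two triangles on an equator edge contain consecutive spokes and their opposites, in
    -- opposite rotational order.
    opposite-sg : ∀ a → c a ≡ k → sg (opposite (sg a)) ≡ opposite a
    opposite-sg a p = fc-injective (begin
        fc (fc (sg (fc (sg a))))   ≡⟨ cong (fc ∘ fc) (fc-th (fc (sg a))) ⟨
        fc (fc (fc w))             ≡⟨ fc³ w ⟩
        w                          ≡⟨ sg-injective (trans (fc²-sg a) (sym (proj₁ (degree-4 (th a) (λ e → proper a
            (trans p (sym e))))))) ⟩
        iter sg 3 (th a)           ≡⟨ fc-th (sg (sg (th a))) ⟨
        fc (opposite a)            ∎)
      where
      open ≡-Reasoning
      w : Fin n
      w = th (fc (sg a))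

    opposite-turn : ∀ b a → c a ≡ k → turn (not b) (opposite a) ≡ opposite (turn b a)
    opposite-turn true  a p = trans (cong sg⁻¹ (sym (opposite-sg a p))) (sg⁻¹-sg _)
    opposite-turn false a p = trans (cong (sg ∘ opposite) (sym (sg-sg⁻¹ a)))
      (trans (cong sg (sym (sg-opp (sg⁻¹ a) (trans (c-sg⁻¹ a) p)))) (sg-sg⁻¹ _))
      where
      sg-opp : ∀ x → c x ≡ k → sg⁻¹ (opposite x) ≡ opposite (sg x)
      sg-opp x q = trans (cong sg⁻¹ (sym (opposite-sg x q))) (sg⁻¹-sg _)

    apex : ∀ {d} → c d ≢ k → c (th d) ≢ k → c (fc (fc d)) ≡ k
    apex {d} p q = third-colour {a = c d} {b = c (th d)} (proper d)
      (λ e → c-th-sg≢c-th (th d) (trans (sym (c-vert _)) (trans e (cong c (sym (θ-inv d))))))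
      (λ e → c-th-sg≢c (th d) (trans (sym (c-vert _)) e)) (p ∘ sym) (q ∘ sym)

    nadir : ∀ {d} → c d ≢ k → c (th d) ≢ k → c (th (sg d)) ≡ k
    nadir {d} p q = third-colour {a = c d} {b = c (th d)} (proper d) (c-th-sg≢c d) (c-th-sg≢c-th d) (p ∘ sym) (q ∘ sym)

    ρ-sg : ∀ d → ρ (sg d) ≡ sg (ρ d)
    ρ-sg d = by-cases (c d ≟ k) (c (th d) ≟ k)
      where
      open ≡-Reasoning
      by-cases : Dec (c d ≡ k) → Dec (c (th d) ≡ k) → ρ (sg d) ≡ sg (ρ d)
      by-cases (yes p) _ = trans (ρ-polar (trans (c-vert d) p)) (trans (r-sg p) (cong sg (sym (ρ-polar p))))
      by-cases (no p) (yes q) = trans (ρ-equator (λ e → p (trans (sym (c-vert d)) e)) (λ e → c-th-sg≢c-th d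
          (trans e (sym q))))
        (trans (cong (fc ∘ r) (fc²-sg d)) (cong sg (sym (ρ-spoke q))))
      -- Here `sg d` points to the pole across the equator, which lies in the other hemisphere, so
      -- `r` turns the other way there; `opposite-turn` compares the two turns.
      by-cases (no p) (no q) = begin
        ρ (sg d)                      ≡⟨ ρ-spoke (nadir p q) ⟩
        th (turn (S (th (sg d))) (th (sg d)))  ≡⟨ cong₂ (λ b x → th (turn b x)) S-nadir opp ⟩
        th (turn (not (S a)) (opposite a))     ≡⟨ cong th (opposite-turn (S a) a (apex p q)) ⟩
        th (opposite (r a))           ≡⟨ θ-inv _ ⟩
        sg (fc (r a))                 ≡⟨ cong sg (ρ-equator p q) ⟨
        sg (ρ d)                      ∎
        where
        a : Fin n
        a = fc (fc d)
        opp : th (sg d) ≡ opposite a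
        opp = cong (th ∘ sg) (sym (fc³ d))
        S-nadir : S (th (sg d)) ≡ not (S a)
        S-nadir = trans (S-th-spoke (sg d) (nadir p q)) (trans (S-sg d)
          (trans (S-th-equator d p q) (cong not (sym (trans (S-fc _) (S-fc d))))))

    ρ-th : ∀ d → ρ (th d) ≡ th (ρ d)
    ρ-th d = by-cases (c d ≟ k) (c (th d) ≟ k)
      where
      open ≡-Reasoning
      by-cases : Dec (c d ≡ k) → Dec (c (th d) ≡ k) → ρ (th d) ≡ th (ρ d)
      by-cases (yes p) _ = trans (ρ-spoke (trans (cong c (θ-inv d)) p)) (trans (cong (th ∘ r) (θ-inv d)) (cong th
          (sym (ρ-polar p))))
      by-cases (no p) (yes q) = trans (ρ-polar q) (trans (sym (θ-inv _)) (cong th (sym (ρ-spoke q))))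
      by-cases (no p) (no q) = sg-injective (begin
        sg (ρ (th d))         ≡⟨ ρ-sg (th d) ⟨
        ρ (fc d)              ≡⟨ ρ-spoke c-y ⟩
        th y                  ≡⟨ fc²-sg y ⟨
        fc (fc (sg y))        ≡⟨ cong (fc ∘ fc) (r-sg c-y) ⟨
        fc (fc (r (fc (fc d)))) ≡⟨ cong fc (ρ-equator p q) ⟨
        sg (th (ρ d))         ∎)
        where
        y : Fin n
        y = r (th (fc d))
        c-y : c (th (fc d)) ≡ k
        c-y = trans (sym (c-vert (th (fc d)))) (apex p q)

    c-turn : ∀ b d → c (turn b d) ≡ c d
    c-turn true  d = c-vert d
    c-turn false d = c-sg⁻¹ d

    c-th-turn : ∀ b d → c d ≡ k → c (th (turn b d)) ≡ s (c (th d))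
    c-th-turn b d p = third-colour {a = k} {b = c (th d)} (λ e → proper d (trans p e))
        (λ e → ≢c b (trans e (sym p))) (≢c-th b)
        (swapAround-≢ k _ ≢k) (swapAround-moves k _ ≢k)
      where
      ≢k : c (th d) ≢ k
      ≢k e = proper d (trans p (sym e))
      ≢c : ∀ b → c (th (turn b d)) ≢ c d
      ≢c true  = c-th-sg≢c d
      ≢c false = c-th-sg⁻¹≢c d
      ≢c-th : ∀ b → c (th (turn b d)) ≢ c (th d)
      ≢c-th true  = c-th-sg≢c-th d
      ≢c-th false = c-th-sg⁻¹≢c-th d

    ρ-c : ∀ d → c (ρ d) ≡ s (c d)
    ρ-c d = by-cases (c d ≟ k) (c (th d) ≟ k)
      where
      by-cases : Dec (c d ≡ k) → Dec (c (th d) ≡ k) → c (ρ d) ≡ s (c d)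
      by-cases (yes p) _ = trans (cong c (ρ-polar p)) (trans (c-turn (S d) d) (trans p (trans (sym
          (swapAround-centre k)) (cong s (sym p)))))
      by-cases (no p) (yes q) = trans (cong c (ρ-spoke q)) (trans (c-th-turn _ (th d) q) (cong (s ∘ c) (θ-inv d)))
      by-cases (no p) (no q) = trans (cong c (ρ-equator p q)) (trans (c-vert _) (trans (c-th-turn _ (fc (fc d))
          (apex p q))
        (cong s (trans (sym (c-vert _)) (cong c (fc³ d))))))

    ρ-fixes : ∀ {v} → Orb sg v (φ v) → Orb sg v (φ (ρ v))
    ρ-fixes {v} fix = fixes-vertex fix (ρ v) (subst (Orb sg v) (sym (ρ-polar (pole fix))) (go (S v)))
      where
      go : ∀ b → Orb sg v (turn b v)
      go true  = Orb-step sg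
      go false = V.Orb-sym (1 , sg-sg⁻¹ v)

  recoloured : ColourReflection O
  recoloured = record
    { φ            = φ ∘ ρ
    -- Involutivity is obtained afresh from the fixed vertex `v₀`, with no appeal to how `φ` and `ρ`
    -- commute.
    ; φ-involutive = MapReflection.involutive (φ ∘ ρ) φρ-th φρ-σ (ρ-fixes fix₀)
    ; φ-th         = φρ-th
    ; σφσ          = φρ-σ
    ; φ-c          = λ d → trans (φ-c (ρ d)) (trans (cong s (ρ-c d)) (swapAround-involutive k (c d)))
    ; fix₀         = ρ-fixes fix₀
    ; fix₁         = ρ-fixes fix₁
    ; fix₂         = ρ-fixes fix₂
    }
    where
    φρ-th : ∀ d → th (φ (ρ d)) ≡ φ (ρ (th d))
    φρ-th d = trans (φ-th (ρ d)) (cong φ (sym (ρ-th d)))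
    φρ-σ : ∀ d → sg (φ (ρ (sg d))) ≡ φ (ρ d)
    φρ-σ d = trans (cong (sg ∘ φ) (ρ-sg d)) (σφσ (ρ d))

-- The colour of the fixed vertex `v₀` is kept, so the colour permutation is the identity or the
-- transposition fixing `c v₀`. The far end of `v₀` tells which.
colourReflection : (O : Lopsp) → HasFixingOrRevAut O → ColourReflection O
colourReflection O (A , fixes₀ , fixes₁ , fixes₂) = by-cases (c (φ (th v₀)) ≟ c (th v₀))
  where
  open Triangulation O
  φ : Fin n → Fin n
  φ = OrRevAut.φ A ⟨$⟩ʳ_
  σφσ : ∀ d → sg (φ (sg d)) ≡ φ d
  σφσ d = trans (cong sg (sym (OrRevAut.σ-rev A d))) (sg-sg⁻¹ (φ d))
  φ-th : ∀ d → th (φ d) ≡ φ (th d)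
  φ-th = OrRevAut.θ-com A
  open MapReflection φ φ-th σφσ
  fix₀ : Orb sg v₀ (φ v₀)
  fix₀ = fixes₀ v₀ (0 , refl)
  fix₁ : Orb sg v₁ (φ v₁)
  fix₁ = fixes₁ v₁ (0 , refl)
  fix₂ : Orb sg v₂ (φ v₂)
  fix₂ = fixes₂ v₂ (0 , refl)
  k : Fin 3
  k = c v₀
  by-cases : Dec (c (φ (th v₀)) ≡ c (th v₀)) → ColourReflection O
  by-cases (yes e) = record
    { φ = φ ; φ-involutive = involutive fix₀ ; φ-th = φ-th ; σφσ = σφσ
    ; φ-c = colours-from (λ x → x) (λ e → e) (c-Orb fix₀) e
    ; fix₀ = fix₀ ; fix₁ = fix₁ ; fix₂ = fix₂ }
  by-cases (no changed) = Bipyramid.recoloured O φ φ-th σφσ k (Lopsp.c-v₀ O)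
    (colours-from (swapAround k)
      (λ e → trans (sym (swapAround-involutive k _)) (trans (cong (swapAround k) e) (swapAround-involutive k _)))
      (trans (c-Orb fix₀) (sym (swapAround-centre k)))
      (third-colour {a = k} {b = c (th v₀)} (proper v₀)
        (λ e → proper (φ v₀) (trans (c-Orb fix₀) (trans (sym e) (cong c (sym (φ-th v₀)))))) changed
        (swapAround-≢ k _ (λ e → proper v₀ (sym e))) (swapAround-moves k _ (λ e → proper v₀ (sym e)))))
    fix₀ fix₁ fix₂

-- The mirror line and its two sides

Parity : ℕ → Set
Parity k = (∃ λ h → k ≡ h + h) ⊎ (∃ λ h → k ≡ suc (h + h))

parity : ∀ k → Parity k
parity zero    = inj₁ (0 , refl)
parity (suc k) with parity k
... | inj₁ (h , e) = inj₂ (h , cong suc e)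
... | inj₂ (h , e) = inj₁ (suc h , trans (cong suc e) (cong suc (sym (+-suc h h))))

module MirrorLine (O : Lopsp) (R : ColourReflection O) where
  open Triangulation O public
  open ColourReflection R public
  open MapReflection φ φ-th σφσ public using (φ-sg; iter-reversal)

  φ-injective : ∀ {x y} → φ x ≡ φ y → x ≡ y
  φ-injective e = trans (sym (φ-involutive _)) (trans (cong φ e) (φ-involutive _))

  c-th-even : ∀ h d → c (th (iter sg (h + h) d)) ≡ c (th d)
  c-th-even zero    d = refl
  c-th-even (suc h) d = trans (cong (λ k → c (th (sg (iter sg k d)))) (+-suc h h))
    (trans (c-th-sg² (iter sg (h + h) d)) (c-th-even h d))

  c-th-odd : ∀ h d → c (th (iter sg (suc (h + h)) d)) ≢ c (th d)
  c-th-odd h d e = c-th-sg≢c-th (iter sg (h + h) d) (trans e (sym (c-th-even h d)))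

  abstract

    -- The colours of the far ends alternate, so they could not close up after an odd number of
    -- steps.
    even-period : ∀ d → ∃ λ h → Period sg d (h + h)
    even-period d = go (parity p)
      where
      p : ℕ
      p = proj₁ (V.period d)
      per : Period sg d p
      per = proj₂ (V.period d)
      go : Parity p → ∃ λ h → Period sg d (h + h)
      go (inj₁ (h , e)) = h , subst (Period sg d) e per
      go (inj₂ (h , e)) = contradiction (cong (c ∘ th) (trans (cong (λ k → iter sg k d) (sym e))
          (Period.returns per))) (c-th-odd h d)

    -- `φ` keeps the colour of the far end, so it moves `v` by an even number `h + h` of rotations,
    -- and the dart halfway is fixed.
    fixed-dart : ∀ {v} → Orb sg v (φ v) → ∃ λ x → Orb sg v x × φ x ≡ x
    fixed-dart {v} (k , e) = go (parity k)
      where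
      go : Parity k → ∃ λ x → Orb sg v x × φ x ≡ x
      go (inj₁ (h , refl)) = iter sg h v , (h , refl) ,
        V.iter-injective h (trans (iter-reversal h v) (trans (sym e) (iter-+ sg h h v)))
      go (inj₂ (h , refl)) = contradiction (trans (cong (c ∘ th) e) (trans (cong c (φ-th v)) (φ-c (th v))))
          (c-th-odd h v)

  halfTurn : Fin n → ℕ
  halfTurn d = proj₁ (even-period d)

  halfTurn-period : ∀ d → Period sg d (halfTurn d + halfTurn d)
  halfTurn-period d = proj₂ (even-period d)

  halfTurn-positive : ∀ d → 0 < halfTurn d
  halfTurn-positive d = go (halfTurn d) (Period.positive (halfTurn-period d))
    where
    go : ∀ h → 0 < h + h → 0 < h
    go (suc h) _ = s≤s z≤n

  halfTurn-< : ∀ d → halfTurn d < halfTurn d + halfTurn d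
  halfTurn-< d = m<m+n (halfTurn d) (halfTurn-positive d)

  ω : Fin n → Fin n
  ω d = iter sg (halfTurn d) d

  ω-Orb : ∀ d → Orb sg d (ω d)
  ω-Orb d = halfTurn d , refl

  ω-moves : ∀ d → ω d ≢ d
  ω-moves d = Period.minimal (halfTurn-period d) (halfTurn d) (halfTurn-positive d) (halfTurn-< d)

  fixed-double : ∀ {d} i → φ d ≡ d → φ (iter sg i d) ≡ iter sg i d → iter sg (i + i) d ≡ d
  fixed-double {d} i e e′ = trans (iter-+ sg i i d) (trans (cong (iter sg i) (sym e′)) (trans (iter-reversal i d) e))

  double-fixed : ∀ {d} i → φ d ≡ d → iter sg (i + i) d ≡ d → φ (iter sg i d) ≡ iter sg i d
  double-fixed {d} i e e′ = V.iter-injective i (trans (iter-reversal i d) (trans e (trans (sym e′) (iter-+ sg i i d))))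

  φ-ω : ∀ {d} → φ d ≡ d → φ (ω d) ≡ ω d
  φ-ω {d} e = double-fixed (halfTurn d) e (Period.returns (halfTurn-period d))

  no-double : ∀ d i → 0 < i → i < halfTurn d → iter sg (i + i) d ≢ d
  no-double d i 0<i i<h = Period.minimal (halfTurn-period d) (i + i) (<-≤-trans 0<i (m≤m+n i i)) (+-mono-< i<h i<h)

  unfixed-between : ∀ {d} i → φ d ≡ d → 0 < i → i < halfTurn d → φ (iter sg i d) ≢ iter sg i d
  unfixed-between {d} i e 0<i i<h e′ = no-double d i 0<i i<h (fixed-double i e e′)

  -- If `d` and its `i`-th rotation are both fixed, rotating `i + i` times returns to `d`. For `i`
  -- below the period `h + h` this leaves only 0 and `h`.
  fixed-darts : ∀ {d e} → φ d ≡ d → φ e ≡ e → Orb sg d e → e ≡ d ⊎ e ≡ ω d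
  fixed-darts {d} {e} fd fe o = go (V.reduce (halfTurn-period d) o)
    where
    h : ℕ
    h = halfTurn d
    go : (∃ λ i → i < h + h × iter sg i d ≡ e) → e ≡ d ⊎ e ≡ ω d
    go (zero , _ , refl) = inj₁ refl
    go (i@(suc _) , i<2h , refl) with <-cmp i h
    ... | tri< i<h _ _ = contradiction fe (unfixed-between i fd (s≤s z≤n) i<h)
    ... | tri≈ _ i≡h _ = inj₂ (cong (λ k → iter sg k d) i≡h)
    -- Beyond the half turn, `j = i - h` lies strictly between 0 and `h`, and doubling it also
    -- returns to `d`.
    ... | tri> _ _ h<i = contradiction returns (no-double d j (m<n⇒0<n∸m h<i) (+-cancelˡ-< h j h (subst (_< h + h)
        (sym h+j) i<2h)))
      where
      j : ℕ
      j = i ∸ h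
      h+j : h + j ≡ i
      h+j = m+[n∸m]≡n (<⇒≤ h<i)
      rearrange : i + i ≡ (j + j) + (h + h)
      rearrange = trans (cong₂ _+_ (sym h+j) (sym h+j)) (trans (cong₂ _+_ (+-comm h j) (+-comm h j))
        (trans (+-assoc j h (j + h)) (trans (cong (j +_) (trans (sym (+-assoc h j h)) (trans (cong (_+ h)
            (+-comm h j)) (+-assoc j h h)))) (sym (+-assoc j j (h + h))))))
      returns : iter sg (j + j) d ≡ d
      returns = trans (cong (iter sg (j + j)) (sym (Period.returns (halfTurn-period d))))
        (trans (sym (iter-+ sg (j + j) (h + h) d)) (trans (cong (λ k → iter sg k d) (sym rearrange))
            (fixed-double i fd fe)))

  ω-involutive : ∀ {d} → φ d ≡ d → ω (ω d) ≡ d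
  ω-involutive {d} e = go (fixed-darts e (φ-ω (φ-ω e)) (Orb-trans sg (ω-Orb d) (ω-Orb (ω d))))
    where
    go : ω (ω d) ≡ d ⊎ ω (ω d) ≡ ω d → ω (ω d) ≡ d
    go (inj₁ e) = e
    go (inj₂ e) = contradiction e (ω-moves (ω d))

  fixed : Fin n → Bool
  fixed d = does (φ d ≟ d)

  fixed-true : ∀ {d} → φ d ≡ d → fixed d ≡ true
  fixed-true {d} = dec-true (φ d ≟ d)

  fixed-false : ∀ {d} → φ d ≢ d → fixed d ≡ false
  fixed-false {d} = dec-false (φ d ≟ d)

  fixed⁻ : ∀ {d} → fixed d ≡ true → φ d ≡ d
  fixed⁻ {d} = go (φ d ≟ d)
    where
    go : (p : Dec (φ d ≡ d)) → does p ≡ true → φ d ≡ d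
    go (yes e) _ = e

  fixed-cong : ∀ {d e} → (φ d ≡ d → φ e ≡ e) → (φ e ≡ e → φ d ≡ d) → fixed d ≡ fixed e
  fixed-cong to from = T-iff (λ t → ≡⇒T (fixed-true (to (fixed⁻ (T⇒≡ t))))) (λ t → ≡⇒T (fixed-true (from (fixed⁻
      (T⇒≡ t)))))

  fixed-th : ∀ d → fixed (th d) ≡ fixed d
  fixed-th d = fixed-cong (λ e → th-injective (trans (φ-th d) e)) (λ e → trans (sym (φ-th d)) (cong th e))

  fixed-φ : ∀ d → fixed (φ d) ≡ fixed d
  fixed-φ d = fixed-cong φ-injective (cong φ)

  -- ω pairs the fixed darts at each vertex.
  even-on-axis : ∀ X → (∀ d → φ d ≡ d → X (ω d) ≡ X d) → (∀ d → fixed d ≡ false → X d ≡ false) → Even X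
  even-on-axis X hω h₀ e = V.orbitSum-involution τ X e (λ d → inv d (fixed d) refl)
      (λ d → orb d (fixed d)) (λ d → inva d (fixed d) refl) (λ d _ → fix d (fixed d) refl)
    where
    τ : Fin n → Fin n
    τ d = if fixed d then ω d else d
    τ-fixed : ∀ {d} → fixed d ≡ true → τ d ≡ ω d
    τ-fixed {d} = cong (if_then ω d else d)
    τ-unfixed : ∀ {d} → fixed d ≡ false → τ d ≡ d
    τ-unfixed {d} = cong (if_then ω d else d)
    inv : ∀ d b → fixed d ≡ b → τ (τ d) ≡ d
    inv d true  f = trans (cong τ (τ-fixed f)) (trans (τ-fixed (fixed-true (φ-ω (fixed⁻ f)))) (ω-involutive (fixed⁻ f)))
    inv d false f = trans (cong τ (τ-unfixed f)) (τ-unfixed f)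
    orb : ∀ d b → Orb sg d (if b then ω d else d)
    orb d true  = ω-Orb d
    orb d false = 0 , refl
    inva : ∀ d b → fixed d ≡ b → X (τ d) ≡ X d
    inva d true  f = trans (cong X (τ-fixed f)) (hω d (fixed⁻ f))
    inva d false f = cong X (τ-unfixed f)
    fix : ∀ d b → fixed d ≡ b → τ d ≡ d → X d ≡ false
    fix d true  f e = contradiction (trans (sym (τ-fixed f)) e) (ω-moves d)
    fix d false f _ = h₀ d f

  connected : Connected (Lopsp.map O)
  connected = proj₁ (Lopsp.plane O)

  jordan : Jordan
  jordan = Homology.euler⇒jordan (Lopsp.map O) connected v₀ (proj₂ (Lopsp.plane O))

  -- φ maps the face of d to the face of th (φ d).
  face-reflected : {B : Set} (G : Fin n → B) → (∀ d → G (fc d) ≡ G d) → ∀ d → G (th (φ (fc d))) ≡ G (th (φ d))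
  face-reflected G hG d = trans (sym (hG (th (φ (fc d))))) (cong G (trans (fc-th (φ (fc d))) (trans (σφσ (th d))
      (sym (φ-th d)))))

  th-φ-th : ∀ d → th (φ (th d)) ≡ φ d
  th-φ-th d = trans (φ-th (th d)) (cong φ (θ-inv d))

  -- When `X` is invariant under `φ`, the mirror image of `G` has the same boundary `X`, so it
  -- differs from `G` by a constant.
  reflected-difference : ∀ X G → Bounding X G → (∀ d → X (φ d) ≡ X d) → ∀ d e → G e xor G (th (φ e)) ≡ G d xor G
      (th (φ d))
  reflected-difference X G (hG , hX) hφ d e = faceReach-invariant (λ d → G d xor G (th (φ d)))
    (λ d → cong₂ _xor_ (hG d) (face-reflected G hG d))
    (λ d → xor-cancel (begin
      (G (th d) xor G (th (φ (th d)))) xor (G d xor G (th (φ d)))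
        ≡⟨ xor-interchange (G (th d)) (G (th (φ (th d)))) (G d) (G (th (φ d))) ⟩
      (G (th d) xor G d) xor (G (th (φ (th d))) xor G (th (φ d)))
        ≡⟨ cong₂ _xor_ (trans (cong (λ x → G (th d) xor G x) (sym (θ-inv d))) (hX (th d)))
                       (trans (cong (λ x → G x xor G (th (φ d))) (th-φ-th d)) (hX (φ d))) ⟩
      X (th d) xor X (φ d)
        ≡⟨ cong₂ _xor_ (trans (sym (hX (th d))) (trans (cong (λ x → G (th d) xor G x) (θ-inv d)) (trans (xor-comm
            (G (th d)) (G d)) (hX d)))) (hφ d) ⟩
      X d xor X d
        ≡⟨ xor-same (X d) ⟩
      false ∎)) (connected d e)
    where
    open ≡-Reasoning

  -- At a fixed dart the mirror image of its face is the face across its edge, so the constant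
  -- difference equals `X d` at every fixed dart.
  reflected-boundary : ∀ {X G d} → Bounding X G → φ d ≡ d → G d xor G (th (φ d)) ≡ X d
  reflected-boundary {X} {G} {d} (_ , hX) e = trans (cong (λ x → G d xor G (th x)) e) (hX d)

  abstract

    -- A dart stands for the face on its side: S selects the faces on one side of the mirror line.
    sides : ∃ (Bounding fixed)
    sides = jordan fixed fixed-th (even-on-axis fixed
      (λ d e → trans (fixed-true (φ-ω e)) (sym (fixed-true e))) (λ d f → f))

  S : Fin n → Bool
  S = proj₁ sides

  S-fc : ∀ d → S (fc d) ≡ S d
  S-fc = proj₁ (proj₂ sides)

  S-th : ∀ d → S (th d) ≡ S d xor fixed d
  S-th d = xor-cancelˡ (S d) (proj₂ (proj₂ sides) d)

  S-sg : ∀ d → S (sg d) ≡ S d xor fixed d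
  S-sg d = trans (cong S (sym (fc-th d))) (trans (S-fc (th d)) (S-th d))

  S-th-sg : ∀ d → S (th d) ≡ S (sg d)
  S-th-sg d = trans (S-th d) (sym (S-sg d))

  -- The constant difference is evaluated at a fixed dart of the vertex of `v₀`, where it is `true`.
  S-reflected : ∀ d → S (th (φ d)) ≡ not (S d)
  S-reflected d = go (S d) (trans (reflected-difference fixed S (proj₂ sides) fixed-φ x d)
      (trans (reflected-boundary {X = fixed} {G = S} (proj₂ sides) φx) (fixed-true φx)))
    where
    x : Fin n
    x = proj₁ (fixed-dart fix₀)
    φx : φ x ≡ x
    φx = proj₂ (proj₂ (fixed-dart fix₀))
    go : ∀ a {b} → a xor b ≡ true → b ≡ not a
    go false e = e
    go true {false} _ = refl

  S-φ : ∀ d → S (φ d) ≡ not (S (sg d))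
  S-φ d = trans (cong S (sym (th-φ-th d))) (trans (S-reflected (th d)) (cong not (S-th-sg d)))

  S-sg-fixed : ∀ {d} → φ d ≡ d → S (sg d) ≡ not (S d)
  S-sg-fixed {d} e = trans (S-sg d) (trans (cong (S d xor_) (fixed-true e)) (go (S d)))
    where
    go : ∀ b → b xor true ≡ not b
    go true  = refl
    go false = refl

  S-th-fixed : ∀ {d} → φ d ≡ d → S (th d) ≡ not (S d)
  S-th-fixed e = trans (S-th-sg _) (S-sg-fixed e)

  -- Around a vertex `S` changes only in the step after a fixed dart, and no fixed dart lies
  -- strictly between `d` and `ω d`.
  S-ω : ∀ {d} → φ d ≡ d → S (ω d) ≡ not (S d)
  S-ω {d} e = go (halfTurn d) (halfTurn-positive d) ≤-refl
    where
    go : ∀ i → 0 < i → i ≤ halfTurn d → S (iter sg i d) ≡ not (S d)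
    go (suc zero)      _ _   = S-sg-fixed e
    go (suc i@(suc _)) _ i<h = trans (S-sg (iter sg i d)) (trans (cong (S (iter sg i d) xor_)
      (fixed-false (unfixed-between i e (s≤s z≤n) i<h))) (trans (xor-identityʳ _) (go i (s≤s z≤n) (<⇒≤ i<h))))

  S-change : ∀ {d} → S d ≢ S (sg d) → φ d ≡ d
  S-change {d} changed = go (fixed d) refl
    where
    go : ∀ b → fixed d ≡ b → φ d ≡ d
    go true  f = fixed⁻ f
    go false f = contradiction (sym (trans (S-sg d) (trans (cong (S d xor_) f) (xor-identityʳ _)))) changed

  -- The darts of the half. The fixed darts with `S` false are the outer sides of the boundary edges
  -- and will form the outer face.
  inside : Fin n → Bool
  inside d = S d ∨ fixed d

  inside-S : ∀ {d} → S d ≡ true → inside d ≡ true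
  inside-S {d} = cong (_∨ fixed d)

  inside-fixed : ∀ {d} → φ d ≡ d → inside d ≡ true
  inside-fixed {d} e = trans (cong (S d ∨_) (fixed-true e)) (∨-zeroʳ (S d))

  inside-¬S : ∀ {d} → S d ≡ false → inside d ≡ fixed d
  inside-¬S {d} = cong (_∨ fixed d)

  inside-outer : ∀ {d} → inside d ≡ true → S d ≡ false → φ d ≡ d
  inside-outer i s = fixed⁻ (trans (sym (inside-¬S s)) i)

  inside-sg : ∀ {d} → S (sg d) ≡ true → inside d ≡ true
  inside-sg {d} e = go (S d) (fixed d) (trans (sym (S-sg d)) e)
    where
    go : ∀ a b → a xor b ≡ true → a ∨ b ≡ true
    go true  _ _ = refl
    go false b e = e

  inside-th : ∀ d → inside (th d) ≡ inside d
  inside-th d = trans (cong₂ _∨_ (S-th d) (fixed-th d)) (go (S d) (fixed d))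
    where
    go : ∀ a b → (a xor b) ∨ b ≡ a ∨ b
    go true  true  = refl
    go true  false = refl
    go false true  = refl
    go false false = refl

  -- The rotation of the half: at a vertex on the mirror line, the darts strictly outside are skipped by going to the
  -- other fixed dart ω d.
  σL : Fin n → Fin n
  σL d = if S (sg d) then sg d else ω d

  σR : Fin n → Fin n
  σR d = if S d then sg⁻¹ d else ω d

  σL-in : ∀ {d} → S (sg d) ≡ true → σL d ≡ sg d
  σL-in {d} = cong (if_then sg d else ω d)

  σL-jump : ∀ {d} → S (sg d) ≡ false → σL d ≡ ω d
  σL-jump {d} = cong (if_then sg d else ω d)

  σR-in : ∀ {d} → S d ≡ true → σR d ≡ sg⁻¹ d
  σR-in {d} = cong (if_then sg⁻¹ d else ω d)

  σR-jump : ∀ {d} → S d ≡ false → σR d ≡ ω d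
  σR-jump {d} = cong (if_then sg⁻¹ d else ω d)

  jump-fixed : ∀ {d} → inside d ≡ true → S (sg d) ≡ false → φ d ≡ d × S d ≡ true
  jump-fixed {d} i s = go (S d) refl
    where
    go : ∀ b → S d ≡ b → φ d ≡ d × S d ≡ true
    go true  h = S-change (λ e → contradiction (trans (sym h) (trans e s)) λ ()) , h
    go false h = contradiction (trans (sym s) (trans (S-sg-fixed (inside-outer i h)) (cong not h))) λ ()

  σL-inside : ∀ d → inside d ≡ true → inside (σL d) ≡ true
  σL-inside d i = go (S (sg d)) refl
    where
    go : ∀ b → S (sg d) ≡ b → inside (σL d) ≡ true
    go true  s = trans (cong inside (σL-in s)) (inside-S s)
    go false s = trans (cong inside (σL-jump s)) (inside-fixed (φ-ω (proj₁ (jump-fixed i s))))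

  σR-inside : ∀ d → inside d ≡ true → inside (σR d) ≡ true
  σR-inside d i = go (S d) refl
    where
    go : ∀ b → S d ≡ b → inside (σR d) ≡ true
    go true  s = trans (cong inside (σR-in s)) (inside-sg (trans (cong S (sg-sg⁻¹ d)) s))
    go false s = trans (cong inside (σR-jump s)) (inside-fixed (φ-ω (inside-outer i s)))

  σR-σL : ∀ d → inside d ≡ true → σR (σL d) ≡ d
  σR-σL d i = go (S (sg d)) refl
    where
    go : ∀ b → S (sg d) ≡ b → σR (σL d) ≡ d
    go true  s = trans (cong σR (σL-in s)) (trans (σR-in s) (sg⁻¹-sg d))
    go false s = trans (cong σR (σL-jump s)) (trans (σR-jump (trans (S-ω (proj₁ f)) (cong not (proj₂ f))))
        (ω-involutive (proj₁ f)))
      where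
      f = jump-fixed i s

  σL-σR : ∀ d → inside d ≡ true → σL (σR d) ≡ d
  σL-σR d i = go (S d) refl
    where
    go : ∀ b → S d ≡ b → σL (σR d) ≡ d
    go true  s = trans (cong σL (σR-in s)) (trans (σL-in (trans (cong S (sg-sg⁻¹ d)) s)) (sg-sg⁻¹ d))
    go false s = trans (cong σL (σR-jump s)) (trans (σL-jump (trans (S-sg-fixed (φ-ω f)) (cong not (trans (S-ω f)
        (cong not s))))) (ω-involutive f))
      where
      f = inside-outer i s

  σL-Orb : ∀ d → Orb sg d (σL d)
  σL-Orb d = go (S (sg d))
    where
    go : ∀ b → Orb sg d (if b then sg d else ω d)
    go true  = Orb-step sg
    go false = ω-Orb d

  σL-S : ∀ {d} → inside d ≡ true → S (σL d) ≡ S (sg d)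
  σL-S {d} i = go (S (sg d)) refl
    where
    go : ∀ b → S (sg d) ≡ b → S (σL d) ≡ S (sg d)
    go true  s = cong S (σL-in s)
    go false s = trans (cong S (σL-jump s)) (trans (S-ω (proj₁ f)) (trans (cong not (proj₂ f)) (sym s)))
      where
      f = jump-fixed i s

-- The half as an lsp-operation

module HalfMap (O : Lopsp) (R : ColourReflection O) where
  open MirrorLine O R public
  private module I = Enum inside

  abstract

    m : ℕ
    m = I.size

    at : Fin m → Fin n
    at = I.at

    at-injective : ∀ {i j} → at i ≡ at j → i ≡ j
    at-injective = I.at-injective

    at-inside : ∀ i → inside (at i) ≡ true
    at-inside i = T⇒≡ (I.at-∈ i)

    pos : ∀ d → inside d ≡ true → Fin m
    pos d i = I.pos d (≡⇒T i)

    at-pos : ∀ d (i : inside d ≡ true) → at (pos d i) ≡ d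
    at-pos d i = I.at-pos d (≡⇒T i)

  Preserving : (Fin n → Fin n) → Set
  Preserving g = ∀ d → inside d ≡ true → inside (g d) ≡ true

  abstract

    restrict : (g : Fin n → Fin n) → Preserving g → Fin m → Fin m
    restrict g g-inside i = pos (g (at i)) (g-inside (at i) (at-inside i))

    at-restrict : ∀ g (g-inside : Preserving g) i → at (restrict g g-inside i) ≡ g (at i)
    at-restrict g g-inside i = at-pos (g (at i)) (g-inside (at i) (at-inside i))

  restrict-inverse : ∀ g h (gi : Preserving g) (hi : Preserving h) → (∀ d → inside d ≡ true → g (h d) ≡ d) →
                     ∀ i → restrict g gi (restrict h hi i) ≡ i
  restrict-inverse g h gi hi inv i = at-injective (trans (at-restrict g gi (restrict h hi i))
    (trans (cong g (at-restrict h hi i)) (inv (at i) (at-inside i))))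

  th-inside : Preserving th
  th-inside d i = trans (inside-th d) i

  half : Map
  half = record
    { n     = m
    ; θ     = permutation (restrict th th-inside) (restrict th th-inside) θθ θθ
    ; σ     = permutation (restrict σL σL-inside) (restrict σR σR-inside)
                (restrict-inverse σL σR σL-inside σR-inside σL-σR) (restrict-inverse σR σL σR-inside σL-inside σR-σL)
    ; θ-inv = θθ
    ; θ-fpf = λ i e → θ-fpf (at i) (trans (sym (at-restrict th th-inside i)) (cong at e))
    }
    where
    θθ : ∀ i → restrict th th-inside (restrict th th-inside i) ≡ i
    θθ = restrict-inverse th th th-inside th-inside (λ d _ → θ-inv d)

  module H = MapProps half

  at-th : ∀ i → at (H.th i) ≡ th (at i)
  at-th = at-restrict th th-inside

  at-sg : ∀ i → at (H.sg i) ≡ σL (at i)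
  at-sg = at-restrict σL σL-inside

  at-sg⁻¹ : ∀ i → at (H.sg⁻¹ i) ≡ σR (at i)
  at-sg⁻¹ = at-restrict σR σR-inside

  S-at-sg : ∀ i → S (at (H.sg i)) ≡ S (sg (at i))
  S-at-sg i = trans (cong S (at-sg i)) (σL-S (at-inside i))

  S-at-fc : ∀ i → S (at (H.fc i)) ≡ S (at i)
  S-at-fc i = trans (S-at-sg (H.th i)) (trans (cong (S ∘ sg) (at-th i)) (S-fc (at i)))

  at-sg-in : ∀ {i} → S (sg (at i)) ≡ true → at (H.sg i) ≡ sg (at i)
  at-sg-in {i} s = trans (at-sg i) (σL-in s)

  at-sg-jump : ∀ {i} → S (sg (at i)) ≡ false → at (H.sg i) ≡ ω (at i)
  at-sg-jump {i} s = trans (at-sg i) (σL-jump s)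

  at-fc-in : ∀ {i} → S (at i) ≡ true → at (H.fc i) ≡ fc (at i)
  at-fc-in {i} s = trans (at-sg-in (trans (cong (S ∘ sg) (at-th i)) (trans (S-fc (at i)) s))) (cong sg (at-th i))

  at-fixed : ∀ {i} → S (at i) ≡ false → φ (at i) ≡ at i
  at-fixed s = inside-outer (at-inside _) s

  -- A retraction onto the half, since a fixed dart is its own image. It carries paths and rotations
  -- of `O` to the half, which gives connectedness and matches the vertices.
  foldDart : Fin n → Fin n
  foldDart d = if S d then d else φ d

  foldDart-inside : ∀ d → inside (foldDart d) ≡ true
  foldDart-inside d = go (S d) refl
    where
    go : ∀ b → S d ≡ b → inside (if b then d else φ d) ≡ true
    go true  s = inside-S s
    go false s = reflected (S (sg d)) refl
      where
      reflected : ∀ b → S (sg d) ≡ b → inside (φ d) ≡ true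
      reflected true  s′ = inside-fixed (cong φ (S-change (λ e → contradiction (trans (sym s) (trans e s′)) λ ())))
      reflected false s′ = inside-S (trans (S-φ d) (cong not s′))

  fold : Fin n → Fin m
  fold d = pos (foldDart d) (foldDart-inside d)

  at-fold : ∀ d → at (fold d) ≡ foldDart d
  at-fold d = at-pos (foldDart d) (foldDart-inside d)

  at-fold-S : ∀ {d} → S d ≡ true → at (fold d) ≡ d
  at-fold-S {d} s = trans (at-fold d) (cong (if_then d else φ d) s)

  at-fold-¬S : ∀ {d} → S d ≡ false → at (fold d) ≡ φ d
  at-fold-¬S {d} s = trans (at-fold d) (cong (if_then d else φ d) s)

  at-fold-inside : ∀ {d} → inside d ≡ true → at (fold d) ≡ d
  at-fold-inside {d} i = go (S d) refl
    where
    go : ∀ b → S d ≡ b → at (fold d) ≡ d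
    go true  s = at-fold-S s
    go false s = trans (at-fold-¬S s) (inside-outer i s)

  fold-at : ∀ i → fold (at i) ≡ i
  fold-at i = at-injective (at-fold-inside (at-inside i))

  fold-th : ∀ d → H.th (fold d) ≡ fold (th d)
  fold-th d = at-injective (trans (at-th (fold d)) (go (S d) (S (sg d)) refl refl))
    where
    go : ∀ a b → S d ≡ a → S (sg d) ≡ b → th (at (fold d)) ≡ at (fold (th d))
    go true  true  s s′ = trans (cong th (at-fold-S s)) (sym (at-fold-S (trans (S-th-sg d) s′)))
    go false false s s′ = trans (cong th (at-fold-¬S s)) (trans (φ-th d) (sym (at-fold-¬S (trans (S-th-sg d) s′))))
    go true  false s s′ = trans (cong th (at-fold-S s)) (sym (at-fold-inside (inside-fixed (trans (sym (φ-th d))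
      (cong th (S-change (λ e → contradiction (trans (sym s) (trans e s′)) λ ())))))))
    go false true  s s′ = trans (cong th (trans (at-fold-¬S s) (S-change (λ e → contradiction (trans (sym s)
        (trans e s′)) λ ()))))
      (sym (at-fold-S (trans (S-th-sg d) s′)))

  fold-sg : ∀ {d} → S (sg d) ≡ true → H.sg (fold d) ≡ fold (sg d)
  fold-sg {d} s = at-injective (trans (at-sg (fold d)) (trans (cong σL (at-fold-inside (inside-sg s)))
    (trans (σL-in s) (sym (at-fold-S s)))))

  fold-sg⁻¹ : ∀ {d} → S (sg d) ≡ false → H.sg⁻¹ (fold d) ≡ fold (sg d)
  fold-sg⁻¹ {d} s = at-injective (trans (at-sg⁻¹ (fold d)) (trans (go (S d) refl) (trans (sym (φ-sg d)) (sym
      (at-fold-¬S s)))))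
    where
    go : ∀ b → S d ≡ b → σR (at (fold d)) ≡ sg⁻¹ (φ d)
    go true  s′ = trans (cong σR (at-fold-S s′)) (trans (σR-in s′)
      (cong sg⁻¹ (sym (S-change (λ e → contradiction (trans (sym s′) (trans e s)) λ ())))))
    go false s′ = trans (cong σR (at-fold-¬S s′)) (σR-in (trans (S-φ d) (cong not s)))

  Orb-sg⁻¹ : ∀ i → Orb H.sg i (H.sg⁻¹ i)
  Orb-sg⁻¹ i = H.V.Orb-sym (1 , restrict-inverse σL σR σL-inside σR-inside σL-σR i)

  Orb-fold-sg : ∀ d → Orb H.sg (fold d) (fold (sg d))
  Orb-fold-sg d = go (S (sg d)) refl
    where
    go : ∀ b → S (sg d) ≡ b → Orb H.sg (fold d) (fold (sg d))
    go true  s = 1 , fold-sg s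
    go false s = subst (Orb H.sg (fold d)) (fold-sg⁻¹ s) (Orb-sg⁻¹ (fold d))

  Orb-fold : ∀ {d e} → Orb sg d e → Orb H.sg (fold d) (fold e)
  Orb-fold {d} o = Orb-closed sg (λ e → Orb H.sg (fold d) (fold e)) (λ e p → Orb-trans H.sg p (Orb-fold-sg e)) o
      (0 , refl)

  Orb-half : ∀ {i j} → Orb sg (at i) (at j) → Orb H.sg i j
  Orb-half {i} {j} o = subst₂ (Orb H.sg) (fold-at i) (fold-at j) (Orb-fold o)

  Orb-at : ∀ {i j} → Orb H.sg i j → Orb sg (at i) (at j)
  Orb-at {i} o = Orb-closed H.sg (λ j → Orb sg (at i) (at j))
    (λ j p → Orb-trans sg p (subst (Orb sg (at j)) (sym (at-sg j)) (σL-Orb (at j)))) o (0 , refl)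

  Reach-Orb : ∀ {i j k} → Reach half i j → Orb H.sg j k → Reach half i k
  Reach-Orb r o = Orb-closed H.sg (Reach half _) (λ _ → rot) o r

  half-connected : Connected half
  half-connected i j = subst₂ (Reach half) (fold-at i) (fold-at j) (Reach-closed (λ d → Reach half (fold (at i))
      (fold d))
    (λ d r → Reach-Orb r (Orb-fold-sg d)) (λ d r → subst (Reach half _) (fold-th d) (rev r)) (connected (at i)
        (at j)) here)

  -- An even edge set X of the half is even in O as well, and there it bounds a set Ŝ of faces.
  half-jordan : H.Jordan
  half-jordan X X-θ X-even = Ŝ ∘ at , Ŝ-fc , λ i → trans (cong (λ d → Ŝ (at i) xor Ŝ d) (at-th i))
      (trans (proj₂ (proj₂ bounded) (at i)) (trans (cong (_∧ X (fold (at i))) (at-inside i)) (cong X (fold-at i))))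
    where
    X̂ : Fin n → Bool
    X̂ d = inside d ∧ X (fold d)
    X̂-outside : ∀ {d} → inside d ≡ false → X̂ d ≡ false
    X̂-outside {d} = cong (_∧ X (fold d))
    X̂-θ : ∀ d → X̂ (th d) ≡ X̂ d
    X̂-θ d = cong₂ _∧_ (inside-th d) (trans (cong X (sym (fold-th d))) (X-θ (fold d)))
    even-inside : ∀ d → inside d ≡ true → V.orbitSum X̂ d ≡ false
    even-inside d i = trans (sum-embed at at-injective _ λ e ∄j → trans (cong (inOrbit sg d e ∧_) (X̂-outside
        (missed ∄j))) (∧-zeroʳ _))
      (trans (sum-cong λ j → cong₂ _∧_ (same j) (trans (cong (_∧ X (fold (at j))) (at-inside j)) (cong X
          (fold-at j)))) (X-even (fold d)))
      where
      missed : ∀ {e} → ¬ (∃ λ j → at j ≡ e) → inside e ≡ false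
      missed {e} ∄j = go (inside e) refl
        where
        go : ∀ b → inside e ≡ b → b ≡ false
        go false _ = refl
        go true  p = contradiction (fold e , at-fold-inside p) ∄j
      same : ∀ j → inOrbit sg d (at j) ≡ inOrbit H.sg (fold d) j
      same j = T-iff (λ t → H.V.inOrbit-complete (subst (Orb H.sg (fold d)) (fold-at j) (Orb-fold (V.inOrbit-sound t))))
        (λ t → V.inOrbit-complete (subst (λ x → Orb sg x (at j)) (at-fold-inside i) (Orb-at (H.V.inOrbit-sound t))))
    X̂-even : Even X̂
    X̂-even e = go (any? λ d → V.Orb? e d ×-dec (inside d ≟ᵇ true))
      where
      go : Dec (∃ λ d → Orb sg e d × inside d ≡ true) → V.orbitSum X̂ e ≡ false
      go (yes (d , o , i)) = trans (V.orbitSum-orbit X̂ o) (even-inside d i)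
      go (no ∄d) = V.orbitSum-zero e λ d o → X̂-outside (¬true (λ i → ∄d (d , o , i)))
        where
        ¬true : ∀ {b} → b ≢ true → b ≡ false
        ¬true {false} _ = refl
        ¬true {true}  h = contradiction refl h
    bounded : ∃ (Bounding X̂)
    bounded = jordan X̂ X̂-θ X̂-even
    Ŝ : Fin n → Bool
    Ŝ = proj₁ bounded
    Ŝ-face : ∀ d → Ŝ (fc d) ≡ Ŝ d
    Ŝ-face = proj₁ (proj₂ bounded)
    -- Folding the other side of the mirror line onto the outside makes Ŝ invariant under th, hence constant there.
    outsideValue : Bool → Fin n → Bool
    outsideValue b d = if b then Ŝ (th (φ d)) else Ŝ d
    κ : Fin n → Bool
    κ d = outsideValue (S d) d
    κ-fc : ∀ d → κ (fc d) ≡ κ d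
    κ-fc d = trans (cong (λ b → outsideValue b (fc d)) (S-fc d)) (go (S d))
      where
      go : ∀ b → outsideValue b (fc d) ≡ outsideValue b d
      go true  = face-reflected Ŝ Ŝ-face d
      go false = Ŝ-face d
    Ŝ-th : ∀ {d} → inside d ≡ false → Ŝ (th d) ≡ Ŝ d
    Ŝ-th {d} o = sym (xor-cancel (trans (proj₂ (proj₂ bounded) d) (X̂-outside o)))
    κ-th : ∀ d → κ (th d) ≡ κ d
    κ-th d = go (S d) (S (th d)) refl refl
      where
      unfixed : S d ≡ S (th d) → fixed d ≡ false
      unfixed e = trans (go (S d) (fixed d)) (trans (cong (S d xor_) (trans (sym (S-th d)) (sym e))) (xor-same (S d)))
        where
        go : ∀ a b → b ≡ a xor (a xor b)
        go false b = refl
        go true  b = sym (not-involutive b)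
      mirror-fixed : S d ≢ S (th d) → φ d ≡ d
      mirror-fixed h = S-change (λ e → h (trans e (sym (S-th-sg d))))
      go : ∀ a b → S d ≡ a → S (th d) ≡ b → κ (th d) ≡ κ d
      go false false s t = trans (cong (λ b → outsideValue b (th d)) t) (trans
        (Ŝ-th (trans (inside-¬S s) (unfixed (trans s (sym t))))) (cong (λ b → outsideValue b d) (sym s)))
      go true true s t = trans (cong (λ b → outsideValue b (th d)) t) (trans (cong Ŝ (th-φ-th d)) (trans
        (sym (Ŝ-th (trans (inside-¬S (trans (S-φ d) (cong not (trans (sym (S-th-sg d)) t)))) (trans (fixed-φ d)
            (unfixed (trans s (sym t)))))))
        (cong (λ b → outsideValue b d) (sym s))))
      go true false s t = trans (cong (λ b → outsideValue b (th d)) t) (trans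
        (cong (Ŝ ∘ th) (sym (mirror-fixed (λ e → contradiction (trans (sym s) (trans e t)) λ ())))) (cong
            (λ b → outsideValue b d) (sym s)))
      go false true s t = trans (cong (λ b → outsideValue b (th d)) t) (trans (cong Ŝ (trans (th-φ-th d)
        (mirror-fixed (λ e → contradiction (trans (sym s) (trans e t)) λ ())))) (cong (λ b → outsideValue b d) (sym s)))
    Ŝ-fc : ∀ i → Ŝ (at (H.fc i)) ≡ Ŝ (at i)
    Ŝ-fc i = go (S (at i)) refl
      where
      go : ∀ b → S (at i) ≡ b → Ŝ (at (H.fc i)) ≡ Ŝ (at i)
      go true  s = trans (cong Ŝ (at-fc-in s)) (Ŝ-face (at i))
      go false s = trans (cong (λ b → outsideValue b (at (H.fc i))) (sym (trans (S-at-fc i) s)))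
        (trans (faceReach-invariant κ κ-fc κ-th (connected (at i) (at (H.fc i)))) (cong (λ b → outsideValue b
            (at i)) s))

  abstract

    -- A fixed vertex lies on the mirror line, and of the fixed darts `x` and `ω x` there, one has
    -- `S` false.
    outer-dart : ∀ {v} → Orb sg v (φ v) → ∃ λ i → Orb sg v (at i) × S (at i) ≡ false
    outer-dart {v} fix = go (S x) refl
      where
      x : Fin n
      x = proj₁ (fixed-dart fix)
      v~x : Orb sg v x
      v~x = proj₁ (proj₂ (fixed-dart fix))
      φx : φ x ≡ x
      φx = proj₂ (proj₂ (fixed-dart fix))
      here-outer : ∀ {y} → φ y ≡ y → Orb sg v y → S y ≡ false → ∃ λ i → Orb sg v (at i) × S (at i) ≡ false
      here-outer {y} φy o s = fold y , subst (Orb sg v) (sym e) o , trans (cong S e) s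
        where
        e : at (fold y) ≡ y
        e = at-fold-inside (inside-fixed φy)
      go : ∀ b → S x ≡ b → ∃ λ i → Orb sg v (at i) × S (at i) ≡ false
      go false s = here-outer φx v~x s
      go true  s = here-outer (φ-ω φx) (Orb-trans sg v~x (ω-Orb x)) (trans (S-ω φx) (cong not s))

  outer : Fin m
  outer = proj₁ (outer-dart fix₀)

  S-outer : S (at outer) ≡ false
  S-outer = proj₂ (proj₂ (outer-dart fix₀))

  -- The face of the dart outer is bounded by a closed curve C on the mirror line. The difference between the two sides of
  -- the mirror line, with respect to a face set bounded by C, is the same at all darts, so C is the whole mirror line.
  outer-face-sound : ∀ {i} → Orb H.fc outer i → S (at i) ≡ false
  outer-face-sound o = trans (Orb-invariant H.fc (S ∘ at) S-at-fc o) S-outer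

  outer-face-complete : ∀ {i} → S (at i) ≡ false → Orb H.fc outer i
  outer-face-complete {i} s = H.F.inOrbit-sound (≡⇒T (trans (sym (trans (B-outer (at-fixed s) s) (cong
      (inOrbit H.fc outer) (fold-at i))))
      (trans (sym (C-outer (at-fixed s) s)) C-true)))
    where
    B : Fin n → Bool
    B d = (not (S d) ∧ fixed d) ∧ inOrbit H.fc outer (fold d)
    C : Fin n → Bool
    C d = B d xor B (th d)
    B-outer : ∀ {x} → φ x ≡ x → S x ≡ false → B x ≡ inOrbit H.fc outer (fold x)
    B-outer {x} f s = cong (_∧ inOrbit H.fc outer (fold x)) (cong₂ (λ a b → not a ∧ b) s (fixed-true f))
    B-inner : ∀ {x} → S x ≡ true → B x ≡ false
    B-inner {x} s = cong (λ a → (not a ∧ fixed x) ∧ inOrbit H.fc outer (fold x)) s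
    B-off : ∀ {x} → fixed x ≡ false → B x ≡ false
    B-off {x} f = trans (cong (λ a → (not (S x) ∧ a) ∧ inOrbit H.fc outer (fold x)) f) (cong (_∧ inOrbit H.fc outer
        (fold x)) (∧-zeroʳ (not (S x))))
    C-outer : ∀ {x} → φ x ≡ x → S x ≡ false → C x ≡ B x
    C-outer {x} f s = trans (cong (B x xor_) (B-inner (trans (S-th-fixed f) (cong not s)))) (xor-identityʳ (B x))
    C-off : ∀ d → fixed d ≡ false → C d ≡ false
    C-off d f = cong₂ _xor_ (B-off f) (B-off (trans (fixed-th d) f))
    C-θ : ∀ d → C (th d) ≡ C d
    C-θ d = trans (cong (λ x → B (th d) xor B x) (θ-inv d)) (xor-comm (B (th d)) (B d))
    -- Along the outer face `x` follows `th (ω x)`, because the rotation of the half jumps from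
    -- `ω x` to `x`. So `C` contains both fixed darts at a vertex or neither, as evenness requires.
    C-ω-outer : ∀ {x} → φ x ≡ x → S x ≡ false → C (ω x) ≡ C x
    C-ω-outer {x} f s = trans (cong (_xor B (th y)) (B-inner Sy)) (trans (B-outer φth-y S-th-y)
        (trans successor (trans (sym (B-outer f s)) (sym (C-outer f s)))))
      where
      y : Fin n
      y = ω x
      φy : φ y ≡ y
      φy = φ-ω f
      Sy : S y ≡ true
      Sy = trans (S-ω f) (cong not s)
      S-th-y : S (th y) ≡ false
      S-th-y = trans (S-th-fixed φy) (cong not Sy)
      φth-y : φ (th y) ≡ th y
      φth-y = trans (sym (φ-th y)) (cong th φy)
      step : H.fc (fold (th y)) ≡ fold x
      step = at-injective (trans (at-sg (H.th (fold (th y)))) (trans (cong σL (trans (at-th (fold (th y)))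
        (trans (cong th (at-fold-inside (inside-fixed φth-y))) (θ-inv y))))
        (trans (σL-jump (trans (S-sg-fixed φy) (cong not Sy))) (trans (ω-involutive f) (sym (at-fold-inside
            (inside-fixed f)))))))
      successor : inOrbit H.fc outer (fold (th y)) ≡ inOrbit H.fc outer (fold x)
      successor = T-iff (λ t → H.F.inOrbit-complete (Orb-trans H.fc (H.F.inOrbit-sound t) (1 , step)))
        (λ t → H.F.inOrbit-complete (Orb-trans H.fc (H.F.inOrbit-sound t) (H.F.Orb-sym (1 , step))))
    C-ω : ∀ d → φ d ≡ d → C (ω d) ≡ C d
    C-ω d f = go (S d) refl
      where
      go : ∀ b → S d ≡ b → C (ω d) ≡ C d
      go false s = C-ω-outer f s
      go true  s = trans (sym (C-ω-outer (φ-ω f) (trans (S-ω f) (cong not s)))) (cong C (ω-involutive f))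
    C-φ : ∀ d → C (φ d) ≡ C d
    C-φ d = go (fixed d) refl
      where
      go : ∀ b → fixed d ≡ b → C (φ d) ≡ C d
      go true  f = cong C (fixed⁻ f)
      go false f = trans (C-off (φ d) (trans (fixed-φ d) f)) (sym (C-off d f))
    bounded : ∃ (Bounding C)
    bounded = jordan C C-θ (even-on-axis C C-ω C-off)
    C-true : C (at i) ≡ true
    C-true = trans (sym (reflected-boundary {C} {proj₁ bounded} (proj₂ bounded) (at-fixed s)))
      (trans (reflected-difference C (proj₁ bounded) (proj₂ bounded) C-φ (at outer) (at i))
      (trans (reflected-boundary {C} {proj₁ bounded} (proj₂ bounded) (at-fixed S-outer))
      (trans (C-outer (at-fixed S-outer) S-outer) (trans (B-outer (at-fixed S-outer) S-outer)
        (T⇒≡ (H.F.inOrbit-complete (0 , sym (fold-at outer))))))))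

  inOuter : ∀ i → inOrbit H.fc outer i ≡ not (S (at i))
  inOuter i = go (S (at i)) refl
    where
    go : ∀ b → S (at i) ≡ b → inOrbit H.fc outer i ≡ not b
    go false s = T⇒≡ (H.F.inOrbit-complete (outer-face-complete s))
    go true  s = T-iff {b = false} (λ t → contradiction (trans (sym s) (outer-face-sound (H.F.inOrbit-sound t))) λ
        ()) λ ()

  half-plane : Plane half
  half-plane = half-connected , Homology.jordan⇒euler half half-connected outer half-jordan

-- Two-connectedness, degrees and the gluing isomorphism

module Avoiding (M : Map) where
  open Map M

  avoid-trans : ∀ {w a b d} → ReachAvoid M w a b → ReachAvoid M w b d → ReachAvoid M w a d
  avoid-trans p here       = p
  avoid-trans p (rot q)    = rot (avoid-trans p q)
  avoid-trans p (rev q ¬w) = rev (avoid-trans p q) ¬w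

  avoid-Orb : ∀ {w a b d} → ReachAvoid M w a b → Orb sg b d → ReachAvoid M w a d
  avoid-Orb p o = Orb-closed sg (ReachAvoid M _ _) (λ _ → rot) o p

module HalfLsp (O : Lopsp) (R : ColourReflection O) where
  open HalfMap O R
  open Avoiding half

  private
    cL : Fin m → Fin 3
    cL i = c (at i)

  cL-sg : ∀ i → cL (H.sg i) ≡ cL i
  cL-sg i = c-Orb (Orb-at (Orb-step H.sg {i}))

  cL-Orb : ∀ {i j} → Orb H.sg i j → cL j ≡ cL i
  cL-Orb = Orb-invariant H.sg cL cL-sg

  cL-proper : ∀ i → cL i ≢ cL (H.th i)
  cL-proper i e = proper (at i) (trans e (cong c (at-th i)))

  fcL³ : ∀ {i} → S (at i) ≡ true → H.fc (H.fc (H.fc i)) ≡ i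
  fcL³ {i} s = at-injective (trans (at-fc-in s₂) (trans (cong fc (at-fc-in s₁)) (trans (cong (fc ∘ fc)
      (at-fc-in s)) (fc³ (at i)))))
    where
    s₁ : S (at (H.fc i)) ≡ true
    s₁ = trans (S-at-fc i) s
    s₂ : S (at (H.fc (H.fc i))) ≡ true
    s₂ = trans (S-at-fc (H.fc i)) s₁

  cL-fc : ∀ i → cL (H.fc i) ≡ cL (H.th i)
  cL-fc i = cL-sg (H.th i)

  -- The corners of the triangle on the inner side of `outer` have three different colours.
  halfVertices≥3 : 3 ≤ H.numVertices
  halfVertices≥3 = H.distinct-vertices corner λ {x} {y} o → corner-colours x y (sym (cL-Orb o))
    where
    i : Fin m
    i = H.th outer
    s : S (at i) ≡ true
    s = trans (cong S (at-th outer)) (trans (S-th-fixed (at-fixed S-outer)) (cong not S-outer))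
    corner : Fin 3 → Fin m
    corner zero             = i
    corner (suc zero)       = H.fc i
    corner (suc (suc zero)) = H.fc (H.fc i)
    d₁ : ∀ j → cL j ≢ cL (H.fc j)
    d₁ j e = cL-proper j (trans e (cL-fc j))
    d₂ : cL (H.fc (H.fc i)) ≢ cL i
    d₂ e = d₁ (H.fc (H.fc i)) (trans e (cong cL (sym (fcL³ s))))
    corner-colours : ∀ x y → cL (corner x) ≡ cL (corner y) → x ≡ y
    corner-colours zero zero _ = refl
    corner-colours (suc zero) (suc zero) _ = refl
    corner-colours (suc (suc zero)) (suc (suc zero)) _ = refl
    corner-colours zero (suc zero) e = contradiction e (d₁ i)
    corner-colours (suc zero) zero e = contradiction (sym e) (d₁ i)
    corner-colours (suc zero) (suc (suc zero)) e = contradiction e (d₁ (H.fc i))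
    corner-colours (suc (suc zero)) (suc zero) e = contradiction (sym e) (d₁ (H.fc i))
    corner-colours zero (suc (suc zero)) e = contradiction (sym e) d₂
    corner-colours (suc (suc zero)) zero e = contradiction e d₂

  -- The third side of the triangle spanned by i and H.sg i avoids their common start vertex.
  module _ {w i : Fin m} (w~i : Orb H.sg w i) (s : S (at (H.sg i)) ≡ true) where
    private
      j : Fin m
      j = H.sg i
      w~j : cL w ≡ cL j
      w~j = sym (trans (cL-sg i) (cL-Orb w~i))
      closing : H.fc (H.fc j) ≡ H.th i
      closing = H.fc-injective (trans (fcL³ s) (sym (H.fc-th i)))
      elsewhere : ∀ {k} → cL k ≢ cL w → ¬ Orb H.sg w k
      elsewhere h o = h (cL-Orb o)

    link-forward : ReachAvoid half w (H.th i) (H.th j)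
    link-forward = avoid-Orb (rev (avoid-Orb here back-to-th) (elsewhere λ e →
        cL-proper j (sym (trans (sym (trans (cong cL (H.θ-inv (H.fc j))) (cL-fc j))) (trans e w~j)))))
        (subst (λ x → Orb H.sg x (H.th j)) (sym (H.θ-inv (H.fc j))) (H.V.Orb-sym (Orb-step H.sg)))
      where
      back-to-th : Orb H.sg (H.th i) (H.th (H.fc j))
      back-to-th = H.V.Orb-sym (1 , closing)

    link-backward : ReachAvoid half w (H.th j) (H.th i)
    link-backward = subst (ReachAvoid half w (H.th j)) closing (rot (rev (rot here) (elsewhere λ e →
      cL-proper i (sym (trans (trans (cong cL (sym closing)) (cL-sg (H.th (H.fc j)))) (trans e (sym (cL-Orb w~i))))))))

  Linked : Fin m → Fin m → Fin m → Set
  Linked w i j = ReachAvoid half w (H.th i) (H.th j) × ReachAvoid half w (H.th j) (H.th i)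

  chain-of-links : ∀ {w i} → Orb H.sg w i → ∀ k → (∀ l → l < k → S (at (iter H.sg (suc l) i)) ≡ true) → Linked w i
      (iter H.sg k i)
  chain-of-links o zero    h = here , here
  chain-of-links o (suc k) h with chain-of-links o k (λ l l<k → h l (<-trans l<k (n<1+n k)))
  ... | p , q = avoid-trans p (link-forward o′ (h k ≤-refl)) , avoid-trans (link-backward o′ (h k ≤-refl)) q
    where
    o′ = Orb-trans H.sg o (k , refl)

  outer-unique : ∀ {i j} → S (at i) ≡ false → S (at j) ≡ false → Orb H.sg i j → j ≡ i
  outer-unique {i} {j} si sj o = go (fixed-darts (at-fixed si) (at-fixed sj) (Orb-at o))
    where
    go : at j ≡ at i ⊎ at j ≡ ω (at i) → j ≡ i
    go (inj₁ e) = at-injective e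
    go (inj₂ e) = contradiction (trans (sym sj) (trans (cong S e) (trans (S-ω (at-fixed si)) (cong not si)))) λ ()

  ¬false⇒true : ∀ {b} → b ≢ false → b ≡ true
  ¬false⇒true {true}  _ = refl
  ¬false⇒true {false} h = contradiction refl h

  -- The far ends of consecutive darts at `w` are joined by third sides of triangles, except when
  -- the step enters an outer dart. A boundary vertex has a single outer dart, so starting the
  -- rotation there leaves an unbroken fan; an inner vertex has none.
  linked : ∀ {w i j} → Orb H.sg w i → Orb H.sg w j → ReachAvoid half w (H.th i) (H.th j)
  linked {w} {i} {j} o o′ = go (any? λ x → H.V.Orb? w x ×-dec (S (at x) ≟ᵇ false))
    where
    go : Dec (∃ λ x → Orb H.sg w x × S (at x) ≡ false) → ReachAvoid half w (H.th i) (H.th j)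
    go (yes (x , w~x , s)) = avoid-trans (proj₂ (from-x o)) (proj₁ (from-x o′))
      where
      per : Period H.sg x (proj₁ (H.V.period x))
      per = proj₂ (H.V.period x)
      from-x : ∀ {y} → Orb H.sg w y → Linked w x y
      from-x {y} w~y = close (H.V.reduce per (Orb-trans H.sg (H.V.Orb-sym w~x) w~y))
        where
        close : (∃ λ k → k < proj₁ (H.V.period x) × iter H.sg k x ≡ y) → Linked w x y
        close (k , k<p , e) = subst (Linked w x) e (chain-of-links w~x k λ l l<k → ¬false⇒true λ s′ →
          Period.minimal per (suc l) (s≤s z≤n) (<-≤-trans (s≤s l<k) k<p) (outer-unique s s′ (suc l , refl)))
    go (no ∄x) = close (Orb-trans H.sg (H.V.Orb-sym o) o′)
      where
      close : Orb H.sg i j → ReachAvoid half w (H.th i) (H.th j)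
      close (k , e) = subst (λ y → ReachAvoid half w (H.th i) (H.th y)) e (proj₁ (chain-of-links o k λ l _ →
        ¬false⇒true λ s → ∄x (_ , Orb-trans H.sg o (suc l , refl) , s)))

  half-twoConnected : TwoConnected half
  half-twoConnected = halfVertices≥3 , half-connected , λ w e e′ ¬e ¬e′ → proj₁ (detour w e ¬e
      (half-connected e e′)) ¬e′
    where
    -- While the path sits at `w`, the invariant is that every neighbour of `w` has been reached
    -- without visiting `w`. Whichever dart the path leaves by, its far end is then available.
    detour : ∀ w e → ¬ Orb H.sg w e → ∀ {f} → Reach half e f →
             (¬ Orb H.sg w f → ReachAvoid half w e f) × (Orb H.sg w f → ∀ d → Orb H.sg w d → ReachAvoid half w e
                 (H.th d))
    detour w e ¬e here = (λ _ → here) , λ o → contradiction o ¬e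
    detour w e ¬e (rot {e' = f} r) =
        (λ ¬o → rot (proj₁ (detour w e ¬e r) (λ o → ¬o (Orb-trans H.sg o (Orb-step H.sg)))))
      , λ o → proj₂ (detour w e ¬e r) (Orb-trans H.sg o (H.V.Orb-sym (Orb-step H.sg)))
    detour w e ¬e (rev {e' = f} r) = (λ ¬o → leave ¬o (H.V.Orb? w f)) , enter
      where
      leave : ¬ Orb H.sg w (H.th f) → Dec (Orb H.sg w f) → ReachAvoid half w e (H.th f)
      leave ¬o (yes o) = proj₂ (detour w e ¬e r) o f o
      leave ¬o (no ¬f) = rev (proj₁ (detour w e ¬e r) ¬f) ¬o
      enter : Orb H.sg w (H.th f) → ∀ d → Orb H.sg w d → ReachAvoid half w e (H.th d)
      enter o d o′ = avoid-trans (subst (ReachAvoid half w e) (sym (H.θ-inv f))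
        (proj₁ (detour w e ¬e r) (λ w~f → cL-proper f (trans (cL-Orb w~f) (sym (cL-Orb o)))))) (linked o o′)

  OuterB : Fin m → Bool
  OuterB = inOrbit H.fc outer

  OnOuter : Fin m → Set
  OnOuter i = ∃ λ j → Orb H.sg i j × T (OuterB j)

  outer⇒S : ∀ {i} → T (OuterB i) → S (at i) ≡ false
  outer⇒S {i} t = not-injective (trans (sym (inOuter i)) (T⇒≡ t))

  S⇒outer : ∀ {i} → S (at i) ≡ false → T (OuterB i)
  S⇒outer {i} s = ≡⇒T (trans (inOuter i) (cong not s))

  Period-at : ∀ {f : Fin m → Fin m} {g : Fin n → Fin n} {i p} → (∀ k → at (iter f k i) ≡ iter g k (at i)) →
              Period g (at i) p → Period f i p
  Period-at {i = i} {p} h (mkPeriod pos ret min) = mkPeriod pos (at-injective (trans (h p) ret))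
    λ k 0<k k<p e → min k 0<k k<p (trans (sym (h k)) (cong at e))

  half-triangles : ∀ i → ¬ T (OuterB i) → orbitSize H.fc i ≡ 3
  half-triangles i ¬t = H.F.orbitSize-period (Period-at follow (F.orbitSize≡⇒Period (Lopsp.triangles O (at i))))
    where
    s : S (at i) ≡ true
    s = ¬false⇒true (¬t ∘ S⇒outer)
    stays : ∀ k → S (at (iter H.fc k i)) ≡ true
    stays zero    = s
    stays (suc k) = trans (S-at-fc (iter H.fc k i)) (stays k)
    follow : ∀ k → at (iter H.fc k i) ≡ iter fc k (at i)
    follow zero    = refl
    follow (suc k) = trans (at-fc-in (stays k)) (cong fc (follow k))

  inner-degree : ∀ {i p} → ¬ OnOuter i → Period sg (at i) p → orbitSize H.sg i ≡ p
  inner-degree {i} ¬o per = H.V.orbitSize-period (Period-at follow per)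
    where
    follow : ∀ k → at (iter H.sg k i) ≡ iter sg k (at i)
    follow zero    = refl
    follow (suc k) = trans (at-sg-in (trans (sym (S-at-sg (iter H.sg k i)))
      (¬false⇒true λ s → ¬o (_ , (suc k , refl) , S⇒outer s)))) (cong sg (follow k))

  -- `halfTurn` comes out of an existence proof; uniqueness of the period, then halving, identifies
  -- it with `h`.
  ω-at-degree : ∀ h {d} → Period sg d (h + h) → ω d ≡ iter sg h d
  ω-at-degree h {d} per = cong (λ k → iter sg k d) (trans (n≡⌊n+n/2⌋ (halfTurn d)) (trans (cong ⌊_/2⌋
    (trans (sym (V.orbitSize-period (halfTurn-period d))) (V.orbitSize-period per))) (sym (n≡⌊n+n/2⌋ h))))

  outer-sg : ∀ {i} → S (at i) ≡ false → at (H.sg i) ≡ sg (at i)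
  outer-sg s = at-sg-in (trans (S-sg-fixed (at-fixed s)) (cong not s))

  -- The half keeps `x`, `sg x` and `sg (sg x)`, the last being `ω x`, and then jumps back to `x`.
  -- This is why degree 4 in `O` becomes degree 3 on the boundary.
  outer-degree-4 : ∀ {i} → S (at i) ≡ false → Period sg (at i) 4 → Period H.sg i 3
  outer-degree-4 {i} s per = mkPeriod (s≤s z≤n) (at-injective at₃)
      λ { 1 _ _ e → minimal 1 (s≤s z≤n) (s≤s (s≤s z≤n)) (trans (sym at₁) (cong at e))
        ; 2 _ _ e → minimal 2 (s≤s z≤n) (s≤s (s≤s (s≤s z≤n))) (trans (sym at₂) (cong at e))
        ; (suc (suc (suc _))) _ (s≤s (s≤s (s≤s ()))) _ }
    where
    open Period per
    x : Fin n
    x = at i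
    φx : φ x ≡ x
    φx = at-fixed s
    ω≡ : ω x ≡ sg (sg x)
    ω≡ = ω-at-degree 2 per
    s₁ : S (sg x) ≡ true
    s₁ = trans (S-sg-fixed φx) (cong not s)
    s₂ : S (sg (sg x)) ≡ true
    s₂ = trans (cong S (sym ω≡)) (trans (S-ω φx) (cong not s))
    s₃ : S (sg (sg (sg x))) ≡ false
    s₃ = trans (cong (S ∘ sg) (sym ω≡)) (trans (S-sg-fixed (φ-ω φx)) (cong not (trans (S-ω φx) (cong not s))))
    at₁ : at (H.sg i) ≡ sg x
    at₁ = outer-sg s
    at₂ : at (H.sg (H.sg i)) ≡ sg (sg x)
    at₂ = trans (at-sg-in (trans (cong (S ∘ sg) at₁) s₂)) (cong sg at₁)
    at₃ : at (H.sg (H.sg (H.sg i))) ≡ x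
    at₃ = trans (at-sg-jump (trans (cong (S ∘ sg) at₂) s₃)) (trans (cong ω (trans at₂ (sym ω≡))) (ω-involutive φx))

  -- Both darts lie on the mirror line, so the half keeps both.
  outer-degree-2 : ∀ {i} → S (at i) ≡ false → Period sg (at i) 2 → Period H.sg i 2
  outer-degree-2 {i} s per = mkPeriod (s≤s z≤n) (at-injective at₂)
      λ { 1 _ _ e → minimal 1 (s≤s z≤n) (s≤s (s≤s z≤n)) (trans (sym (outer-sg s)) (cong at e))
        ; (suc (suc _)) _ (s≤s (s≤s ())) _ }
    where
    open Period per
    at₂ : at (H.sg (H.sg i)) ≡ at i
    at₂ = trans (at-sg-jump (trans (cong (S ∘ sg) (outer-sg s)) (trans (cong S returns) s)))
      (trans (cong ω (trans (outer-sg s) (sym (ω-at-degree 1 per)))) (ω-involutive (at-fixed s)))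

  private
    module Corner {v} (fix : Orb sg v (φ v)) where
      dart : Fin m
      dart = proj₁ (outer-dart fix)
      Orb-dart : Orb sg v (at dart)
      Orb-dart = proj₁ (proj₂ (outer-dart fix))
      S-dart : S (at dart) ≡ false
      S-dart = proj₂ (proj₂ (outer-dart fix))
      on-outer : OnOuter dart
      on-outer = dart , (0 , refl) , S⇒outer S-dart
      same-vertex : ∀ {i} → Orb sg v (at i) → Orb H.sg dart i
      same-vertex o = Orb-half (Orb-trans sg (V.Orb-sym Orb-dart) o)
      inner-away : ∀ {i} → ¬ OnOuter i → ¬ Orb sg v (at i)
      inner-away ¬o o = ¬o (dart , H.V.Orb-sym (same-vertex o) , S⇒outer S-dart)

    module C₀ = Corner fix₀
    module C₁ = Corner fix₁
    module C₂ = Corner fix₂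

  half-c-v₁ : cL C₁.dart ≡ one → orbitSize H.sg C₁.dart ≡ 2
  half-c-v₁ e = H.V.orbitSize-period (outer-degree-2 C₁.S-dart (V.Period-Orb C₁.Orb-dart
    (V.orbitSize≡⇒Period (Lopsp.c-v₁ O (trans (sym (c-Orb C₁.Orb-dart)) e)))))

  half-deg-outer : ∀ i → OnOuter i → ¬ Orb H.sg C₀.dart i → ¬ Orb H.sg C₁.dart i → ¬ Orb H.sg C₂.dart i → cL i ≡ one → orbitSize H.sg i ≡ 3
  half-deg-outer i (j , o , t) ¬0 ¬1 ¬2 e = H.V.orbitSize-period (H.V.Period-Orb (H.V.Orb-sym o) (outer-degree-4
      (outer⇒S t) (V.orbitSize≡⇒Period
    (Lopsp.deg-one O (at j) (λ p → ¬0 (same C₀.same-vertex p)) (λ p → ¬1 (same C₁.same-vertex p)) (λ p → ¬2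
        (same C₂.same-vertex p))
      (trans (cL-Orb o) e)))))
    where
    same : ∀ {v d} → (∀ {i} → Orb sg v (at i) → Orb H.sg d i) → Orb sg v (at j) → Orb H.sg d i
    same f p = Orb-trans H.sg (f p) (H.V.Orb-sym o)

  L : Lsp
  L = record
    { map          = half
    ; plane        = half-plane
    ; twoConnected = half-twoConnected
    ; outer        = outer
    ; c            = cL
    ; c-vert       = cL-sg
    ; v₀           = C₀.dart
    ; v₁           = C₁.dart
    ; v₂           = C₂.dart
    ; v₀-out       = C₀.on-outer
    ; v₁-out       = C₁.on-outer
    ; v₂-out       = C₂.on-outer
    ; triangles    = half-triangles
    ; proper       = cL-proper
    ; deg-inner    = λ i ¬o e → inner-degree ¬o (V.orbitSize≡⇒Period
                       (Lopsp.deg-one O (at i) (C₀.inner-away ¬o) (C₁.inner-away ¬o) (C₂.inner-away ¬o) e))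
    ; deg-outer    = half-deg-outer
    ; c-v₀         = λ e → Lopsp.c-v₀ O (trans (sym (c-Orb C₀.Orb-dart)) e)
    ; c-v₂         = λ e → Lopsp.c-v₂ O (trans (sym (c-Orb C₂.Orb-dart)) e)
    ; c-v₁         = half-c-v₁
    }

  open Glue L

  -- A dart of the half with `S` false is fixed; one with `S` true has its reverse outside `S`
  -- exactly when it is fixed.
  boundary-fixed : ∀ i → OnBoundaryB i ≡ fixed (at i)
  boundary-fixed i = trans (cong₂ _∨_ (inOuter i) (trans (inOuter (H.th i)) (cong (not ∘ S) (at-th i)))) (go (S
      (at i)) refl)
    where
    go : ∀ b → S (at i) ≡ b → not b ∨ not (S (th (at i))) ≡ fixed (at i)
    go false s = sym (fixed-true (at-fixed s))
    go true  s = trans (cong not (trans (S-th (at i)) (cong (_xor fixed (at i)) s))) (not-involutive _)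

  ψ : Fin n → GDart
  ψ d = fold d , not (inside d)

  ψ-at : ∀ i → ψ (at i) ≡ (i , false)
  ψ-at i = cong₂ _,_ (fold-at i) (cong not (at-inside i))

  outside-S : ∀ {d} → inside d ≡ false → S d ≡ false
  outside-S {d} o = go (S d) refl
    where
    go : ∀ b → S d ≡ b → b ≡ false
    go false _ = refl
    go true  s = trans (sym (inside-S s)) o

  boundary-fold : ∀ d → OnBoundaryB (fold d) ≡ fixed d
  boundary-fold d = trans (boundary-fixed (fold d)) (go (S d) refl)
    where
    go : ∀ b → S d ≡ b → fixed (at (fold d)) ≡ fixed d
    go true  s = cong fixed (at-fold-S s)
    go false s = trans (cong fixed (at-fold-¬S s)) (fixed-φ d)

  ψ-valid : ∀ d → Valid (ψ d)
  ψ-valid d = go (inside d) refl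
    where
    go : ∀ b → inside d ≡ b → Valid (fold d , not b)
    go true  _ = tt
    go false o t = contradiction (trans (sym (T⇒≡ t)) (trans (boundary-fold d) (trans (sym (inside-¬S
        (outside-S o))) o))) λ ()

  ψ-injective : ∀ d e → ψ d ≡ ψ e → d ≡ e
  ψ-injective d e h = go (inside d) (inside e) refl refl
    where
    folds : at (fold d) ≡ at (fold e)
    folds = cong (at ∘ proj₁) h
    insides : inside d ≡ inside e
    insides = not-injective (cong proj₂ h)
    go : ∀ a b → inside d ≡ a → inside e ≡ b → d ≡ e
    go true  true  p q = trans (sym (at-fold-inside p)) (trans folds (at-fold-inside q))
    go false false p q = φ-injective (trans (sym (at-fold-¬S (outside-S p))) (trans folds (at-fold-¬S (outside-S q))))
    go true  false p q = contradiction (trans (sym p) (trans insides q)) λ ()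
    go false true  p q = contradiction (trans (sym p) (trans insides q)) λ ()

  ψ-surjective : ∀ q → Valid q → ∃ λ d → ψ d ≡ q
  ψ-surjective (i , false) _ = at i , ψ-at i
  ψ-surjective (i , true)  v = φ x , cong₂ _,_ (at-injective (trans (at-fold-¬S Sφ) (φ-involutive x)))
      (cong not (trans (inside-¬S Sφ) (trans (fixed-φ x) unfixed)))
    where
    x : Fin n
    x = at i
    unfixed : fixed x ≡ false
    unfixed = ¬true (λ f → v (≡⇒T (trans (boundary-fixed i) f)))
      where
      ¬true : ∀ {b} → b ≢ true → b ≡ false
      ¬true {false} _ = refl
      ¬true {true}  h = contradiction refl h
    Sx : S x ≡ true
    Sx = ¬false⇒true λ s → contradiction (trans (sym (fixed-true (at-fixed s))) unfixed) λ ()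
    Sφ : S (φ x) ≡ false
    Sφ = trans (S-φ x) (cong not (trans (S-sg x) (cong₂ _xor_ Sx unfixed)))

  ψ-th : ∀ d → ψ (th d) ≡ gθ (ψ d)
  ψ-th d = cong₂ _,_ (sym (fold-th d)) (cong not (inside-th d))

  -- If `sg d` lies in `S`, the rotation of `L` applies. Otherwise `gσ` is `back` in both copies:
  -- from the last dart of the half it turns into the mirror copy, and within the copy `φ` has
  -- reversed the rotation.
  ψ-sg : ∀ d → ψ (sg d) ≡ gσ (ψ d)
  ψ-sg d = sym (go (S (sg d)) refl)
    where
    back-fold : S (sg d) ≡ false → back (fold d) ≡ ψ (sg d)
    back-fold s = trans (cong (λ i → i , not (OnBoundaryB i)) (fold-sg⁻¹ s))
      (cong (λ b → fold (sg d) , not b) (trans (boundary-fold (sg d)) (sym (inside-¬S s))))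
    inner : ∀ b → OuterB (H.sg (fold d)) ≡ b → gσ (fold d , false) ≡ (if b then back (fold d) else (H.sg
        (fold d) , false))
    inner b e = cong (if_then back (fold d) else (H.sg (fold d) , false)) e
    outerness : inside d ≡ true → OuterB (H.sg (fold d)) ≡ not (S (sg d))
    outerness i = trans (inOuter (H.sg (fold d))) (cong not (trans (S-at-sg (fold d)) (cong (S ∘ sg)
        (at-fold-inside i))))
    go : ∀ b → S (sg d) ≡ b → gσ (ψ d) ≡ ψ (sg d)
    go true s = trans (cong (λ b → gσ (fold d , not b)) (inside-sg s))
      (trans (inner false (trans (outerness (inside-sg s)) (cong not s)))
      (cong₂ _,_ (fold-sg s) (cong not (sym (inside-S s)))))
    go false s = trans (by-inside (inside d) refl) (back-fold s)
      where
      by-inside : ∀ b → inside d ≡ b → gσ (fold d , not b) ≡ back (fold d)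
      by-inside true  i = inner true (trans (outerness i) (cong not s))
      by-inside false _ = refl

  ψ-iter : ∀ k d → ψ (iter sg k d) ≡ iter gσ k (ψ d)
  ψ-iter zero    d = refl
  ψ-iter (suc k) d = trans (ψ-sg (iter sg k d)) (cong gσ (ψ-iter k d))

  ψ-vertex : ∀ {v i} → Orb sg v (at i) → GSameVertex (ψ v) (i , false)
  ψ-vertex {v} {i} (k , e) = k , trans (sym (ψ-iter k v)) (trans (cong ψ e) (ψ-at i))

  fold-c : ∀ d → c (at (fold d)) ≡ c d
  fold-c d = go (S d) refl
    where
    go : ∀ b → S d ≡ b → c (at (fold d)) ≡ c d
    go true  s = cong c (at-fold-S s)
    go false s = trans (cong c (at-fold-¬S s)) (φ-c d)

  isomorphism : IsoToGlued O L
  isomorphism = record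
    { ψ      = ψ
    ; valid  = ψ-valid
    ; inj    = ψ-injective
    ; surj   = ψ-surjective
    ; θ-com  = ψ-th
    ; σ-com  = ψ-sg
    ; c-com  = fold-c
    ; v₀-com = ψ-vertex C₀.Orb-dart
    ; v₁-com = ψ-vertex C₁.Orb-dart
    ; v₂-com = ψ-vertex C₂.Orb-dart
    }

theorem12 : (O : Lopsp) → CanBeWrittenAsLsp O ⇔ HasFixingOrRevAut O
theorem12 O = mk⇔ (lsp⇒automorphism O) λ A → HalfLsp.L O (colourReflection O A) , HalfLsp.isomorphism O
    (colourReflection O A)
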